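{- Let $G$ be a connected ribbon graph and fix any total order $\prec$ on $E(G)$. Then \[ P_{G}(X,Y,A,B) = \sum_{Q \in \mathcal{Q}_{G}} T_{G_{Q}}(X,A)\, T_{G^{*}_{Q^{*}}}(Y,B)\, A^{s(F_{\mathcal{VI}(Q)})/2}\, B^{s(R_{\mathcal{VE}(Q)})/2}. \]
   Context: A ribbon graph is a compact surface with boundary decomposed into vertex discs and edge ribbons. For a ribbon graph $F$: $v(F)$, $e(F)$, $c(F)$, $bc(F)$ are its numbers of vertices, edges, connected components and boundary components, and $s(F) = 2c(F) - v(F) + e(F) - bc(F)$. A spanning subgraph contains all vertex discs and some edges; for $H\subseteq E(G)$, $F_H$ is the spanning subgraph of $G$ with edge set $H$. The dual $G^*$ is obtained by gluing a disc to each boundary component of $G$ (the vertices of $G^*$) and deleting the vertex discs of $G$; edges $e$ of $G$ correspond to edges $e^*$ of $G^*$. For $H \subseteq E(G)$, $R_H$ denotes the spanning subgraph of $G^*$ with edge set $\{e^* : e\in H\}$; for a spanning subgraph $F$ of $G$, $F^* = R_{E(G)\setminus E(F)}$. The generalized Krushkal polynomial of $G$ is \[ P_G(X,Y,A,B) = \sum_{F\subseteq G} X^{c(F)-c(G)}\, Y^{c(F^*)-c(G^*)}\, A^{s(F)/2}\, B^{s(F^*)/2}. \] For an ordinary graph $H$ with nullity $n(H)=e(H)-v(H)+c(H)$, the Tutte polynomial is $T_H(X,Y) = \sum_{F\subseteq H} X^{c(F)-c(H)} Y^{n(F)}$ (sum over spanning subgraphs). The partial dual $G^H$ is obtained by gluing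 a disc to each boundary curve of $F_H$ and removing the interiors of the vertex discs of $G$; its edges correspond to those of $G$. $\mathcal{Q}_G$ is the set of quasi-trees of $G$, i.e. spanning subgraphs $Q$ with $bc(Q) = 1$; then $G^{E(Q)}$ has a single vertex. Edges $e,e'$ link (w.r.t. $Q$) if, traversing the boundary of the vertex of $G^{E(Q)}$, the attaching arcs of $e$ and $e'$ alternate. An edge is live if it links no $\prec$-lower edge, dead otherwise; internal if in $E(Q)$, external otherwise; orientable/nonorientable according as it forms an orientable/nonorientable loop in $G^{E(Q)}$. Let $\mathcal{I}_o(Q)$ (resp. $\mathcal{E}_o(Q)$) be the internally (resp. externally) live orientable edges, $\mathcal{VI}(Q)$ the internal edges that are dead or live nonorientable, and $\mathcal{VE}(Q)$ the external edges that are dead or live nonorientable. $Q^*$ denotes the quasi-tree of $G^*$ with edges $e^*$, $e\notin E(Q)$. $G_Q$ is the ordinary graph whose vertices are the connected components of $F_{\mathcal{VI}(Q)}$ and whose edges are the edges of $\mathcal{I}_o(Q)$, each joining the components containing its endpoints. $G^*_{Q^*}$ is the ordinary graph whose vertices are the connected components of $R_{\mathcal{VE}(Q)}$ and whose edges are the edges $e^*$, $e \in \mathcal{E}_o(Q)$, each joining the components containing its endpoints in $G^*$. -}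

module Defs where

open import Level using (0ℓ)
open import Data.Bool using (Bool; true; false; not; _∧_; _∨_; if_then_else_)
open import Data.Bool.Properties using () renaming (_≟_ to _≟B_)
open import Data.Nat using (ℕ; zero; suc; _∸_) renaming (_+_ to _+ℕ_; _*_ to _*ℕ_)
open import Data.Fin using (Fin)
open import Data.Fin.Properties using () renaming (_≟_ to _≟F_)
open import Data.Fin.Subset using (Subset; ∁; ∣_∣; ⁅_⁆) renaming (⊤ to Full)
open import Data.Vec using (Vec; lookup; []; _∷_)
open import Data.List using (List; []; _∷_; _++_; map; filterᵇ; length; concatMap; allFin; takeWhileᵇ)
open import Data.Bool.ListAction using (any; all)
open import Data.Product using (_×_; _,_; proj₁; proj₂)
open import Data.Product.Properties using (≡-dec)
open import Data.Sum using (_⊎_; inj₁; inj₂)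
open import Data.Sum.Properties using () renaming (≡-dec to ⊎-dec)
open import Relation.Nullary using (¬_; Dec; yes; no)
open import Relation.Nullary.Decidable using (⌊_⌋)
open import Relation.Unary using () renaming (Decidable to UDec)
open import Relation.Binary using (Rel; DecidableEquality; IsStrictTotalOrder)
open import Relation.Binary.PropositionalEquality using (_≡_; refl; cong; sym; trans)
open import Algebra.Bundles using (CommutativeRing)

module Conn {A : Set} (_≟A_ : DecidableEquality A) where

  eqb : A → A → Bool
  eqb x y = ⌊ x ≟A y ⌋

  adjacent : List (A × A) → A → A → Bool
  adjacent Es x y = any (λ p → (eqb (proj₁ p) x ∧ eqb (proj₂ p) y) ∨ (eqb (proj₁ p) y ∧ eqb (proj₂ p) x)) Es

  memb : A → List A → Bool
  memb x S = any (eqb x) S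

  step : List A → List (A × A) → List A → List A
  step Vs Es S = filterᵇ (λ y → memb y S ∨ any (λ z → adjacent Es z y) S) Vs

  reachIn : List A → List (A × A) → ℕ → A → List A
  reachIn Vs Es zero    x = x ∷ []
  reachIn Vs Es (suc k) x = step Vs Es (reachIn Vs Es k x)

  -- x and y lie in the same connected component (walks of length < |Vs| suffice)
  reach : List A → List (A × A) → A → A → Bool
  reach Vs Es x y = memb y (reachIn Vs Es (length Vs) x)

  -- number of connected components of the graph (Vs , Es), Vs duplicate-free:
  -- each component is counted at its first node in Vs
  countCompFrom : List A → List (A × A) → List A → List A → ℕ
  countCompFrom Vs Es seen []       = 0
  countCompFrom Vs Es seen (v ∷ vs) =
    if any (reach Vs Es v) seen then countCompFrom Vs Es (v ∷ seen) vs
    else suc (countCompFrom Vs Es (v ∷ seen) vs)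

  ncomp : List A → List (A × A) → ℕ
  ncomp Vs Es = countCompFrom Vs Es [] Vs

  firstIn : (A → Bool) → List A → A → A
  firstIn p []       d = d
  firstIn p (v ∷ vs) d = if p v then v else firstIn p vs d

  rep : List A → List (A × A) → A → A
  rep Vs Es x = firstIn (reach Vs Es x) Vs x

record OGraph : Set₁ where
  field
    Node   : Set
    _≟N_   : DecidableEquality Node
    nodes  : List Node            -- vertex set (duplicate-free)
    edges  : List (Node × Node)

-- all sublists (= all spanning subgraphs, edges being list positions)
sublists : {B : Set} → List B → List (List B)
sublists []       = [] ∷ []
sublists (e ∷ es) = sublists es ++ map (e ∷_) (sublists es)

module RingOps {c ℓ} (R : CommutativeRing c ℓ) where
  open CommutativeRing R

  pow : Carrier → ℕ → Carrier
  pow x zero    = 1#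
  pow x (suc k) = x * pow x k

  sumR : List Carrier → Carrier
  sumR []       = 0#
  sumR (x ∷ xs) = x + sumR xs

  tutte : OGraph → Carrier → Carrier → Carrier
  tutte H x y = sumR (map term (sublists edges))
    where
      open OGraph H
      open Conn _≟N_
      term : List (Node × Node) → Carrier
      term S = pow x (ncomp nodes S ∸ ncomp nodes edges)
             * pow y ((length S +ℕ ncomp nodes S) ∸ length nodes)

-- Ribbon graphs, combinatorially.
-- Each edge ribbon e is a rectangle with four corners (e , end , side):
-- 'end' ∈ Bool names its two attaching arcs, 'side' ∈ Bool its two
-- long sides.  The vertex boundaries consist of the attaching arcs
-- (corner (e,j,i) -- (e,j,not i)) and of the boundary arcs between
-- consecutive attaching arcs; the latter pair up corners by a
-- fixed-point-free involution ν.  Vertices without incident edges are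
-- counted by 'iso'.  Every ribbon graph arises this way (up to
-- homeomorphism) and every such datum defines a ribbon graph.

Flag : ℕ → Set
Flag n = Fin n × Bool × Bool

_≟Fl_ : ∀ {n} → DecidableEquality (Flag n)
_≟Fl_ = ≡-dec _≟F_ (≡-dec _≟B_ _≟B_)

allFlags : (n : ℕ) → List (Flag n)
allFlags n = concatMap (λ e → (e , false , false) ∷ (e , false , true) ∷ (e , true , false) ∷ (e , true , true) ∷ []) (allFin n)

record Ribbon : Set where
  field
    ne      : ℕ
    iso     : ℕ
    ν       : Flag ne → Flag ne
    ν-invol : ∀ x → ν (ν x) ≡ x
    ν-fpf   : ∀ x → ¬ (ν x ≡ x)

-- crossing an attaching arc / running along a long side of a ribbon
αF : ∀ {n} → Flag n → Flag n
αF (e , j , i) = (e , j , not i)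

λF : ∀ {n} → Flag n → Flag n
λF (e , j , i) = (e , not j , i)

flagEdge : ∀ {n} → Flag n → Fin n
flagEdge (e , _ , _) = e

inS : ∀ {n} → Subset n → Fin n → Bool
inS H e = lookup H e

conj : (G : Ribbon) (σ : Flag (Ribbon.ne G) → Flag (Ribbon.ne G)) → (∀ x → σ (σ x) ≡ x) → Ribbon
conj G σ σσ = record
  { ne = ne ; iso = iso ; ν = λ x → σ (ν (σ x))
  ; ν-invol = λ x → trans (cong σ (trans (cong ν (σσ (ν (σ x)))) (ν-invol (σ x)))) (σσ x)
  ; ν-fpf = λ x eq → ν-fpf (σ x) (trans (sym (σσ (ν (σ x)))) (cong σ eq)) }
  where open Ribbon G

-- exchanging the roles of attaching arcs and long sides on the edges of H
swapOn : ∀ {n} → Subset n → Flag n → Flag n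
swapOn H (e , j , i) = if inS H e then (e , i , j) else (e , j , i)

swapOn-invol : ∀ {n} (H : Subset n) (x : Flag n) → swapOn H (swapOn H x) ≡ x
swapOn-invol H (e , j , i) with inS H e in eq
... | true  rewrite eq = refl
... | false rewrite eq = refl

partialDual : (G : Ribbon) → Subset (Ribbon.ne G) → Ribbon
partialDual G H = conj G (swapOn H) (swapOn-invol H)

-- the dual G* = G^{E(G)}; its edge e* corresponds to e
dual : Ribbon → Ribbon
dual G = partialDual G Full

module RibbonInv (G : Ribbon) where
  open Ribbon G public
  open Conn (_≟Fl_ {ne}) public

  Fl : List (Flag ne)
  Fl = allFlags ne

  νE αE λE : List (Flag ne × Flag ne)
  νE = map (λ x → (x , ν x)) Fl
  αE = map (λ x → (x , αF x)) Fl
  λE = map (λ x → (x , λF x)) Fl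

  onEdges : (Fin ne → Bool) → List (Flag ne × Flag ne) → List (Flag ne × Flag ne)
  onEdges p = filterᵇ (λ xy → p (flagEdge (proj₁ xy)))

  compEdges : Subset ne → List (Flag ne × Flag ne)
  compEdges H = νE ++ αE ++ onEdges (inS H) λE

  -- boundary curves of F_H: vertex-boundary arcs, long sides of edges in H,
  -- attaching arcs of edges not in H
  bdryEdges : Subset ne → List (Flag ne × Flag ne)
  bdryEdges H = νE ++ onEdges (inS H) λE ++ onEdges (λ e → not (inS H e)) αE

  v : ℕ
  v = ncomp Fl (νE ++ αE) +ℕ iso

  cS bcS eS sS : Subset ne → ℕ
  cS  H = ncomp Fl (compEdges H) +ℕ iso
  bcS H = ncomp Fl (bdryEdges H) +ℕ iso
  eS  H = ∣ H ∣
  -- s(F) = 2c(F) - v(F) + e(F) - bc(F)   (always ≥ 0)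
  sS  H = (2 *ℕ cS H +ℕ eS H) ∸ (v +ℕ bcS H)

  cG : ℕ
  cG = cS Full

  isQuasiTree : Subset ne → Bool
  isQuasiTree H = ⌊ bcS H Data.Nat.≟ 1 ⌋

  -- G_{V,S}: ordinary graph whose vertices are the components of F_V
  -- (each named by a representative flag, or an isolated vertex), and
  -- whose edges are the e ∈ S, joining the components of their two ends
  quotGraph : Subset ne → Subset ne → OGraph
  quotGraph V S = record
    { Node = Flag ne ⊎ Fin iso
    ; _≟N_ = ⊎-dec _≟Fl_ _≟F_
    ; nodes = map inj₁ (filterᵇ (λ x → eqb (rp x) x) Fl) ++ map inj₂ (allFin iso)
    ; edges = map (λ e → (inj₁ (rp (e , false , false)) , inj₁ (rp (e , true , false))))
                  (filterᵇ (inS S) (allFin ne)) }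
    where
      rp : Flag ne → Flag ne
      rp = rep Fl (compEdges V)

Connected : Ribbon → Set
Connected G = RibbonInv.cG G ≡ 1

iterateL : {B : Set} → (B → B) → B → ℕ → List B
iterateL f x zero    = []
iterateL f x (suc k) = x ∷ iterateL f (f x) k

module QuasiTree (G : Ribbon) (Q : Subset (Ribbon.ne G)) where
  open Ribbon G using (ne)
  -- the one-vertex ribbon graph G^{E(Q)}
  GQ : Ribbon
  GQ = partialDual G Q
  open Ribbon GQ using () renaming (ν to ν')

  arcOf : Flag ne → Fin ne × Bool
  arcOf (e , j , _) = (e , j)

  -- cyclic sequence of attaching arcs met along the boundary of the single
  -- vertex of G^{E(Q)}, starting after the arc (e , end false)
  arcsAfter : Fin ne → List (Fin ne × Bool)
  arcsAfter e = map arcOf (iterateL (λ x → αF (ν' x)) (αF (ν' (e , false , false))) (2 *ℕ ne ∸ 1))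

  -- e and e' link: their attaching arcs alternate, i.e. exactly one arc of e'
  -- lies strictly between the two arcs of e
  links : Fin ne → Fin ne → Bool
  links e e' = not ⌊ e ≟F e' ⌋ ∧
    ⌊ length (filterᵇ (λ a → ⌊ proj₁ a ≟F e' ⌋) (takeWhileᵇ (λ a → not ⌊ ≡-dec _≟F_ _≟B_ a (e , true) ⌋) (arcsAfter e))) Data.Nat.≟ 1 ⌋

  -- e forms an orientable loop of G^{E(Q)}: the vertex together with e is an
  -- annulus (2 boundary components) rather than a Möbius band (1)
  orientable : Fin ne → Bool
  orientable e = ⌊ RibbonInv.bcS GQ ⁅ e ⁆ Data.Nat.≟ 2 ⌋

  module WithOrder {_≺_ : Rel (Fin ne) 0ℓ} (sto : IsStrictTotalOrder _≡_ _≺_) where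
    open IsStrictTotalOrder sto using (_<?_)

    live : Fin ne → Bool
    live e = all (λ e' → not (⌊ e' <? e ⌋ ∧ links e e')) (allFin ne)

    mk : (Fin ne → Bool) → Subset ne
    mk p = Data.Vec.tabulate p

    Io Eo VI VE : Subset ne
    Io = mk (λ e → inS Q e ∧ live e ∧ orientable e)
    Eo = mk (λ e → not (inS Q e) ∧ live e ∧ orientable e)
    VI = mk (λ e → inS Q e ∧ (not (live e) ∨ not (orientable e)))
    VE = mk (λ e → not (inS Q e) ∧ (not (live e) ∨ not (orientable e)))

-- The polynomials (A = a², B = b², so that A^{s/2} = a^s, B^{s/2} = b^s)

allSubsets : (n : ℕ) → List (Subset n)
allSubsets zero    = [] ∷ []
allSubsets (suc n) = map (true ∷_) (allSubsets n) ++ map (false ∷_) (allSubsets n)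

module Polys {c ℓ} (R : CommutativeRing c ℓ) where
  open CommutativeRing R
  open RingOps R

  krushkal : (G : Ribbon) → Carrier → Carrier → Carrier → Carrier → Carrier
  krushkal G X Y a b = sumR (map term (allSubsets ne))
    where
      open Ribbon G using (ne)
      module g = RibbonInv G
      module d = RibbonInv (dual G)
      term : Subset ne → Carrier
      term H = pow X (g.cS H ∸ g.cG) * pow Y (d.cS (∁ H) ∸ d.cG)
             * pow a (g.sS H) * pow b (d.sS (∁ H))

  expansion : (G : Ribbon) {_≺_ : Rel (Fin (Ribbon.ne G)) 0ℓ} → IsStrictTotalOrder _≡_ _≺_ →
              Carrier → Carrier → Carrier → Carrier → Carrier
  expansion G sto X Y a b =
    sumR (map term (filterᵇ (RibbonInv.isQuasiTree G) (allSubsets ne)))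
    where
      open Ribbon G using (ne)
      term : Subset ne → Carrier
      term Q = tutte (RibbonInv.quotGraph G VI Io) X (a * a)
             * tutte (RibbonInv.quotGraph (dual G) VE Eo) Y (b * b)
             * pow a (RibbonInv.sS G VI) * pow b (RibbonInv.sS (dual G) VE)
        where open QuasiTree.WithOrder G Q sto

{-# OPTIONS --safe #-}
-- Each edge e has two transitions on its four flags: across its attaching arcs or along its long
-- sides. All quantities count components of the graph on the flags formed by ν together with some of
-- the transitions; for a quasi-tree Q the transitions chosen by Q form a single closed curve. An
-- edge e is live and orientable for Q exactly when the flags admit a cut at e: a bipartition
-- compatible with ν, with all transitions at the lower edges and with the Q-transitions at the
-- higher ones, such that at e the Q-transition crosses the cut and the other one does not. A flag
-- set closed under ν and under a transition at every edge but one meets that edge in an even number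
-- of flags. This parity shows that the cuts at different live orientable edges do not cross, hence
-- switching such an edge away from Q always adds one boundary component and external ones never
-- change connectivity; this gives all exponents. Resolving the edges from the highest to the lowest,
-- following H unless a cut forbids it, yields the unique quasi-tree Q whose interval contains H, so
-- the sum over H splits into the intervals of the quasi-trees.
module Submission where

open import Defs
open import Data.Bool using (Bool; true; false; not; _∧_; _∨_; _xor_; if_then_else_; T)
open import Data.Bool.Properties using (T-≡; T-∧; T-∨; not-involutive; T?; not-¬; ¬-not; xor-assoc; xor-same; xor-comm; xor-identityʳ; not-distribˡ-xor; ∧-idem; ∧-identityʳ; ∧-zeroʳ) renaming (_≟_ to _≟B_)
open import Data.Bool.ListAction using (any)
open import Data.Empty using (⊥; ⊥-elim)
open import Data.List using (List; []; _∷_; length; filterᵇ; map; _++_; concatMap; allFin; foldr; takeWhileᵇ; applyUpTo)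
open import Data.List.Membership.Propositional using (_∈_; _∉_; find; lose)
open import Data.List.Membership.Propositional.Properties using (∈-filter⁺; ∈-filter⁻; ∈-map⁺; ∈-map⁻; ∈-++⁺ˡ; ∈-++⁺ʳ; ∈-++⁻; ∈-concatMap⁺; ∈-allFin; ∈-applyUpTo⁺; ∈-applyUpTo⁻)
open import Data.List.Relation.Unary.All as All using (All; []; _∷_)
open import Data.List.Relation.Unary.AllPairs as AllPairs using (AllPairs; []; _∷_)
open import Data.List.Relation.Unary.Any as Any using (Any; here; there; _─_)
open import Data.List.Relation.Unary.Any.Properties using (any⁺; any⁻; lookup-result)
open import Data.List.Properties using (length-map; map-tabulate; length-++; length-tabulate; map-applyUpTo; length-applyUpTo; map-++; map-∘)
open import Data.Nat using (ℕ; zero; suc; _≤_; z≤n; s≤s; _+_; _*_; _∸_; _<_) renaming (_≟_ to _≟ℕ_)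
import Data.Nat.Properties as ℕₚ
open import Data.Product using (_×_; _,_; proj₁; proj₂; ∃)
open import Data.Sum using (_⊎_; inj₁; inj₂; [_,_]′)
open import Function using (_∘_; Equivalence; id)
open import Relation.Binary using (DecidableEquality; IsEquivalence; Rel; IsStrictTotalOrder; StrictTotalOrder; tri<; tri≈; tri>)
open import Relation.Binary.Construct.Closure.ReflexiveTransitive using (Star; ε; _◅_; _◅◅_; reverse; gmap)
open import Relation.Binary.PropositionalEquality using (_≡_; _≢_; refl; sym; trans; cong; cong₂; subst; isEquivalence; subst₂; resp₂; ≢-sym)
open import Relation.Nullary using (¬_; Dec; yes; no)
open import Relation.Nullary.Decidable using (⌊_⌋; toWitness; fromWitness; ¬?; _×-dec_; _⊎-dec_; map′; decidable-stable)
open import Data.List.Relation.Unary.All.Properties using (¬All⇒Any¬; ¬Any⇒All¬)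
open import Data.List.Relation.Unary.Unique.Propositional using (Unique)
open import Level using (0ℓ)
open import Data.Unit using (⊤; tt)
open import Data.Fin using (Fin)
open import Data.Fin.Properties using () renaming (_≟_ to _≟F_)
open import Data.Fin.Subset using (Subset; ∁; ∣_∣; ⁅_⁆) renaming (⊤ to Full)
open import Data.Vec using (lookup; tabulate; []; _∷_; zipWith)
import Data.List.Relation.Unary.All.Properties as Allₚ
import Data.List.Relation.Unary.AllPairs.Properties as AllPairsₚ
import Data.List.Relation.Unary.Unique.Propositional.Properties as Uniqueₚ
open import Data.Nat.Solver using (module +-*-Solver)
import Data.List.Relation.Unary.Any.Properties as Anyₚ
open import Data.Vec.Properties using ([]=⇒lookup; lookup⇒[]=; lookup∘tabulate; lookup-zipWith; lookup-map; lookup-replicate; tabulate∘lookup; tabulate-cong)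
open import Data.Fin.Subset.Properties using (x∈⁅x⁆; x∈⁅y⁆⇒x≡y)
open import Data.Product.Properties using (≡-dec)
open import Data.Fin.Induction using (spo-noetherian)
open import Data.List.Relation.Binary.Permutation.Propositional using (↭-sym; ↭⇒↭ₛ)
open import Data.List.Relation.Binary.Permutation.Propositional.Properties using (∈-resp-↭)
import Data.List.Relation.Binary.Permutation.Setoid.Properties as ↭ₛ
import Data.List.Sort as Sort
import Data.List.Relation.Unary.Sorted.TotalOrder.Properties as Sortedₚ
open import Induction.WellFounded using (Acc; acc)
import Relation.Binary.Construct.Flip.EqAndOrd as Flip
import Relation.Binary.Properties.StrictTotalOrder as STO
open import Algebra.Bundles using (CommutativeRing)
import Algebra.Properties.CommutativeSemigroup as CSemi

-- Linking is related to cuts only in the one-vertex graph G^{E(Q)}: the partial dual swaps the two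
-- transitions on the edges of Q, so the state Q becomes the empty one and its curve becomes the
-- vertex boundary. The same swap on all edges gives the dual and carries Q to its complement, with
-- the same cuts; every exponent is thus computed once, for X and A, and reused for Y and B. The
-- order yields a cut at e that respects only the Q-transitions above e, whereas the interval of Q
-- may switch any live orientable edge. This asymmetry is the main obstacle; the parity of the flags
-- common to two cuts removes it. Existence of Q rests on the same parity: the two transitions at an
-- edge cannot both be obstructed. Since `∸` truncates, the exponent of A also needs inequalities: s
-- >= 0 for the edges of VI, and an added edge lowers the number of components by at most one. A
-- chosen live orientable internal edge changes the number of edges and the number of boundary
-- curves, so the nullity enters s with the factor 2; hence the Tutte argument A = a * a.

-- Counting equivalence classes

module _ {A : Set} {P : A → Set} where

  length-─ : ∀ {xs} (p : Any P xs) → length xs ≡ suc (length (xs ─ p))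
  length-─ (here _)  = refl
  length-─ (there p) = cong suc (length-─ p)

  All-─ : ∀ {Q : A → Set} {xs} (p : Any P xs) → All Q xs → All Q (xs ─ p)
  All-─ (here _)  (_ ∷ qs) = qs
  All-─ (there p) (q ∷ qs) = q ∷ All-─ p qs

  AllPairs-─ : ∀ {R : A → A → Set} {xs} (p : Any P xs) → AllPairs R xs → AllPairs R (xs ─ p)
  AllPairs-─ (here _)  (_ ∷ rs) = rs
  AllPairs-─ (there p) (r ∷ rs) = All-─ p r ∷ AllPairs-─ p rs

  Any-─ : ∀ {Q : A → Set} {xs} (p : Any P xs) → Any Q xs → Any Q (xs ─ p) ⊎ ∃ λ y → P y × Q y
  Any-─ (here px) (here qx)  = inj₂ (_ , px , qx)
  Any-─ (here px) (there q)  = inj₁ q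
  Any-─ (there p) (here qx)  = inj₁ (here qx)
  Any-─ (there p) (there q) with Any-─ p q
  ... | inj₁ q' = inj₁ (there q')
  ... | inj₂ w  = inj₂ w

  separated-─ : ∀ {R : A → A → Set} {xs} → (∀ {x y} → R x y → R y x) → AllPairs R xs → (p : Any P xs) →
                All (R (Any.lookup p)) (xs ─ p)
  separated-─ s (r ∷ rs) (here _)  = r
  separated-─ s (r ∷ rs) (there p) = s (lookup-All r p) ∷ separated-─ s rs p
    where
      lookup-All : ∀ {Q : A → Set} {xs} → All Q xs → (p : Any P xs) → Q (Any.lookup p)
      lookup-All (q ∷ _)  (here _)  = q
      lookup-All (_ ∷ qs) (there p) = lookup-All qs p

module _ {A : Set} {_~_ : A → A → Set} (eq : IsEquivalence _~_) where
  private module E = IsEquivalence eq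

  -- The partner of the head is struck from `ys`; by transitivity no later, inequivalent element can
  -- have it as its partner.
  pigeonhole : ∀ {xs ys} → AllPairs (λ x y → ¬ x ~ y) xs → All (λ x → Any (x ~_) ys) xs → length xs ≤ length ys
  pigeonhole []       []       = z≤n
  pigeonhole {x ∷ xs} {ys} (r ∷ rs) (c ∷ cs) =
    subst (suc (length xs) ≤_) (sym (length-─ c)) (s≤s (pigeonhole rs (avoid r cs)))
    where
      avoid : ∀ {zs} → All (λ z → ¬ x ~ z) zs → All (λ z → Any (z ~_) ys) zs → All (λ z → Any (z ~_) (ys ─ c)) zs
      avoid []       []       = []
      avoid (n ∷ ns) (d ∷ ds) with Any-─ c d
      ... | inj₁ d'             = d' ∷ avoid ns ds
      ... | inj₂ (y , x~y , z~y) = ⊥-elim (n (E.trans x~y (E.sym z~y)))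

-- The number of classes of `_~_` that meet `V`, witnessed by a transversal. Two such numbers are
-- compared by pigeonhole, with no quotient type.
record Count {A : Set} (V : A → Set) (_~_ : A → A → Set) (k : ℕ) : Set where
  field
    reps  : List A
    size  : length reps ≡ k
    valid : All V reps
    indep : AllPairs (λ x y → ¬ x ~ y) reps
    cover : ∀ {x} → V x → Any (x ~_) reps

count-≤ : ∀ {A B : Set} {V : A → Set} {W : B → Set} {_~_ : A → A → Set} {_≈_ : B → B → Set} {k m} →
          IsEquivalence _≈_ → Count V _~_ k → Count W _≈_ m → (f : A → B) → (∀ {x} → V x → W (f x)) →
          (∀ {x y} → V x → V y → f x ≈ f y → x ~ y) → k ≤ m
count-≤ {A} {B} {V} {W} {_~_} {_≈_} eq c d f fV reflect =
  subst (_≤ _) (Count.size c) (subst (_ ≤_) (Count.size d)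
    (subst (_≤ length (Count.reps d)) (length-map f (Count.reps c))
      (pigeonhole eq (indep' (Count.valid c) (Count.indep c)) (cover' (Count.valid c)))))
  where
    far : ∀ {x xs} → V x → All V xs → All (λ y → ¬ x ~ y) xs → All (λ y → ¬ f x ≈ y) (map f xs)
    far vx []       []       = []
    far vx (v ∷ vs) (n ∷ ns) = (λ e → n (reflect vx v e)) ∷ far vx vs ns
    indep' : ∀ {xs} → All V xs → AllPairs (λ x y → ¬ x ~ y) xs → AllPairs (λ x y → ¬ x ≈ y) (map f xs)
    indep' []       []       = []
    indep' (v ∷ vs) (r ∷ rs) = far v vs r ∷ indep' vs rs
    cover' : ∀ {xs} → All V xs → All (λ x → Any (x ≈_) (Count.reps d)) (map f xs)
    cover' []       = []
    cover' (v ∷ vs) = Count.cover d (fV v) ∷ cover' vs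

module _ {A : Set} {V : A → Set} {_~_ _≈_ : A → A → Set} (e~ : IsEquivalence _~_) (e≈ : IsEquivalence _≈_) where

  count-≡ : ∀ {k m} → Count V _~_ k → Count V _≈_ m → (∀ {x y} → V x → V y → x ~ y → x ≈ y) →
            (∀ {x y} → V x → V y → x ≈ y → x ~ y) → k ≡ m
  count-≡ c d to from = ℕₚ.≤-antisym (count-≤ e≈ c d (λ x → x) (λ v → v) from) (count-≤ e~ d c (λ x → x) (λ v → v) to)

-- The equivalence generated by `_~_` and the single pair `x`, `y`: a chain never has to use the new
-- pair more than once.
Linked : {A : Set} → (A → A → Set) → A → A → A → A → Set
Linked _~_ x y a b = a ~ b ⊎ (a ~ x × y ~ b) ⊎ (a ~ y × x ~ b)

module _ {A : Set} {_~_ : A → A → Set} (eq : IsEquivalence _~_) {x y : A} where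
  private module E = IsEquivalence eq

  Linked-trans : ∀ {a b c} → Linked _~_ x y a b → Linked _~_ x y b c → Linked _~_ x y a c
  Linked-trans (inj₁ p) (inj₁ q) = inj₁ (E.trans p q)
  Linked-trans (inj₁ p) (inj₂ (inj₁ (q , r))) = inj₂ (inj₁ (E.trans p q , r))
  Linked-trans (inj₁ p) (inj₂ (inj₂ (q , r))) = inj₂ (inj₂ (E.trans p q , r))
  Linked-trans (inj₂ (inj₁ (p , q))) (inj₁ r) = inj₂ (inj₁ (p , E.trans q r))
  Linked-trans (inj₂ (inj₁ (p , q))) (inj₂ (inj₁ (r , s))) = inj₂ (inj₁ (p , s))
  Linked-trans (inj₂ (inj₁ (p , q))) (inj₂ (inj₂ (r , s))) = inj₁ (E.trans p s)
  Linked-trans (inj₂ (inj₂ (p , q))) (inj₁ r) = inj₂ (inj₂ (p , E.trans q r))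
  Linked-trans (inj₂ (inj₂ (p , q))) (inj₂ (inj₁ (r , s))) = inj₁ (E.trans p s)
  Linked-trans (inj₂ (inj₂ (p , q))) (inj₂ (inj₂ (r , s))) = inj₂ (inj₂ (p , s))

  module _ {V : A → Set} {_≈_ : A → A → Set} (eq' : IsEquivalence _≈_)
           (incl : ∀ {a b} → a ~ b → a ≈ b) (x≈y : x ≈ y) (link : ∀ {a b} → a ≈ b → Linked _~_ x y a b)
           {k m} (c : Count V _~_ k) (d : Count V _≈_ m) where
    private module E' = IsEquivalence eq'

    count-link-same : x ~ y → k ≡ m
    count-link-same x~y = count-≡ eq eq' c d (λ _ _ → incl) (λ _ _ → back ∘ link)
      where
        back : ∀ {a b} → Linked _~_ x y a b → a ~ b
        back (inj₁ p) = p
        back (inj₂ (inj₁ (p , q))) = E.trans p (E.trans x~y q)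
        back (inj₂ (inj₂ (p , q))) = E.trans p (E.trans (E.sym x~y) q)

    -- Deleting the representative of the class of `y` leaves a transversal: a new link between two
    -- of the remaining representatives would place one of them in that class.
    count-link-merge : V x → V y → ¬ x ~ y → k ≡ suc m
    count-link-merge vx vy x≁y =
      trans (trans (sym (Count.size c)) (length-─ r)) (cong suc (count-≡ eq' eq' c' d (λ _ _ p → p) (λ _ _ p → p)))
      where
        r : Any (y ~_) (Count.reps c)
        r = Count.cover c vy
        y~r : y ~ Any.lookup r
        y~r = lookup-result r
        away : All (λ s → ¬ Any.lookup r ~ s) (Count.reps c ─ r)
        away = separated-─ (λ n p → n (E.sym p)) (Count.indep c) r
        away-y : ∀ {s} → ¬ Any.lookup r ~ s → ¬ y ~ s
        away-y n p = n (E.trans (E.sym y~r) p)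
        indep' : ∀ {zs} → All (λ s → ¬ Any.lookup r ~ s) zs → AllPairs (λ a b → ¬ a ~ b) zs →
                 AllPairs (λ a b → ¬ a ≈ b) zs
        indep' []       []       = []
        indep' {z ∷ _} (n ∷ ns) (q ∷ qs) = far ns q ∷ indep' ns qs
          where
            far : ∀ {zs} → All (λ s → ¬ Any.lookup r ~ s) zs → All (λ s → ¬ z ~ s) zs → All (λ s → ¬ z ≈ s) zs
            far []         []         = []
            far (n' ∷ ns') (q' ∷ qs') = (λ z≈s → contra n' q' (link z≈s)) ∷ far ns' qs'
              where
                contra : ∀ {s} → ¬ Any.lookup r ~ s → ¬ z ~ s → ¬ Linked _~_ x y z s
                contra ns qs (inj₁ p) = qs p
                contra ns qs (inj₂ (inj₁ (_ , p))) = away-y ns p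
                contra ns qs (inj₂ (inj₂ (p , _))) = away-y n (E.sym p)
        x∈ : Any (x ~_) (Count.reps c ─ r)
        x∈ with Any-─ r (Count.cover c vx)
        ... | inj₁ p = p
        ... | inj₂ (_ , p , q) = ⊥-elim (x≁y (E.trans q (E.sym p)))
        cover' : ∀ {v} → V v → Any (v ≈_) (Count.reps c ─ r)
        cover' vv with Any-─ r (Count.cover c vv)
        ... | inj₁ p = Any.map incl p
        ... | inj₂ (_ , p , q) =
          Any.map (λ x~s → E'.trans (incl (E.trans q (E.sym p))) (E'.trans (E'.sym x≈y) (incl x~s))) x∈
        c' : Count V _≈_ (length (Count.reps c ─ r))
        c' = record { reps = Count.reps c ─ r ; size = refl ; valid = All-─ r (Count.valid c)
                    ; indep = indep' away (AllPairs-─ r (Count.indep c)) ; cover = cover' }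

true⇒T : ∀ {b} → b ≡ true → T b
true⇒T = Equivalence.from T-≡

T⇒true : ∀ {b} → T b → b ≡ true
T⇒true = Equivalence.to T-≡

∈-filterᵇ⁺ : ∀ {A : Set} (p : A → Bool) {x xs} → x ∈ xs → p x ≡ true → x ∈ filterᵇ p xs
∈-filterᵇ⁺ p x∈ px = ∈-filter⁺ (λ x → T? (p x)) x∈ (true⇒T px)

∈-filterᵇ⁻ : ∀ {A : Set} (p : A → Bool) {x xs} → x ∈ filterᵇ p xs → x ∈ xs × p x ≡ true
∈-filterᵇ⁻ p {x} {xs} x∈ with ∈-filter⁻ (λ x → T? (p x)) {xs = xs} x∈
... | x∈xs , px = x∈xs , T⇒true px

unique-⊆-length : ∀ {A : Set} {xs ys : List A} → Unique xs → (∀ {x} → x ∈ xs → x ∈ ys) → length xs ≤ length ys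
unique-⊆-length u s = pigeonhole isEquivalence u (All.tabulate s)

Star-equiv : ∀ {A : Set} {R : A → A → Set} → (∀ {x y} → R x y → R y x) → IsEquivalence (Star R)
Star-equiv s = record { refl = ε ; sym = reverse s ; trans = _◅◅_ }

-- Correctness of the breadth-first search behind ncomp

module Components {A : Set} (_≟_ : DecidableEquality A) where
  open Conn _≟_

  eqb⇒≡ : ∀ x y → T (eqb x y) → x ≡ y
  eqb⇒≡ x y t = toWitness {a? = x ≟ y} t

  ≡⇒eqb : ∀ x → T (eqb x x)
  ≡⇒eqb x = fromWitness {a? = x ≟ x} refl

  module _ (Es : List (A × A)) where

    Link : A → A → Set
    Link x y = (x , y) ∈ Es ⊎ (y , x) ∈ Es

    Path : A → A → Set
    Path = Star Link

    Link-sym : ∀ {x y} → Link x y → Link y x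
    Link-sym (inj₁ p) = inj₂ p
    Link-sym (inj₂ p) = inj₁ p

    Path-equiv : IsEquivalence Path
    Path-equiv = Star-equiv Link-sym

    adjacent⇒Link : ∀ {x y} → T (adjacent Es x y) → Link x y
    adjacent⇒Link {x} {y} t with find (any⁻ _ Es t)
    ... | (u , w) , p∈ , q with Equivalence.to T-∨ q
    ... | inj₁ r with Equivalence.to T-∧ r
    ... | a , b with eqb⇒≡ u x a | eqb⇒≡ w y b
    ... | refl | refl = inj₁ p∈
    adjacent⇒Link {x} {y} t | (u , w) , p∈ , q | inj₂ r with Equivalence.to T-∧ r
    ... | a , b with eqb⇒≡ u y a | eqb⇒≡ w x b
    ... | refl | refl = inj₂ p∈

    Link⇒adjacent : ∀ {x y} → Link x y → T (adjacent Es x y)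
    Link⇒adjacent {x} {y} (inj₁ p) =
      any⁺ _ (lose p (Equivalence.from T-∨ (inj₁ (Equivalence.from T-∧ (≡⇒eqb x , ≡⇒eqb y)))))
    Link⇒adjacent {x} {y} (inj₂ p) =
      any⁺ _ (lose p (Equivalence.from T-∨ (inj₂ (Equivalence.from T-∧ (≡⇒eqb y , ≡⇒eqb x)))))

  memb⇒∈ : ∀ {x xs} → T (memb x xs) → x ∈ xs
  memb⇒∈ {x} {xs} t = Any.map (λ {y} → eqb⇒≡ x y) (any⁻ _ xs t)

  ∈⇒memb : ∀ {x xs} → x ∈ xs → T (memb x xs)
  ∈⇒memb {x} p = any⁺ _ (Any.map (λ { refl → ≡⇒eqb x }) p)

  _∈?_ : ∀ x (xs : List A) → Dec (x ∈ xs)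
  x ∈? xs = Any.any? (x ≟_) xs

  module Search {Vs : List A} {Es : List (A × A)} (uniq : Unique Vs)
                (ends : ∀ {x y} → (x , y) ∈ Es → x ∈ Vs × y ∈ Vs) where

    Link-end : ∀ {x y} → Link Es x y → y ∈ Vs
    Link-end (inj₁ p) = proj₂ (ends p)
    Link-end (inj₂ p) = proj₁ (ends p)

    ∈-step⁻ : ∀ {S y} → y ∈ step Vs Es S → y ∈ S ⊎ ∃ λ z → z ∈ S × Link Es z y
    ∈-step⁻ {S} y∈ with Equivalence.to T-∨ (true⇒T (proj₂ (∈-filterᵇ⁻ _ {xs = Vs} y∈)))
    ... | inj₁ p = inj₁ (memb⇒∈ p)
    ... | inj₂ q with find (any⁻ _ S q)
    ... | z , z∈ , a = inj₂ (z , z∈ , adjacent⇒Link Es a)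

    ∈-step⁺ˡ : ∀ {S y} → y ∈ Vs → y ∈ S → y ∈ step Vs Es S
    ∈-step⁺ˡ v p = ∈-filterᵇ⁺ _ v (T⇒true (Equivalence.from T-∨ (inj₁ (∈⇒memb p))))

    ∈-step⁺ʳ : ∀ {S y z} → z ∈ S → Link Es z y → y ∈ step Vs Es S
    ∈-step⁺ʳ p l = ∈-filterᵇ⁺ _ (Link-end l)
      (T⇒true (Equivalence.from T-∨ (inj₂ (any⁺ _ (lose p (Link⇒adjacent Es l))))))

    Closed : List A → Set
    Closed S = ∀ {y z} → z ∈ S → Link Es z y → y ∈ S

    module _ {x : A} (x∈Vs : x ∈ Vs) where

      S : ℕ → List A
      S k = reachIn Vs Es k x

      S⊆Vs : ∀ k {y} → y ∈ S k → y ∈ Vs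
      S⊆Vs zero    (here refl) = x∈Vs
      S⊆Vs (suc k) y∈ = proj₁ (∈-filterᵇ⁻ _ {xs = Vs} y∈)

      S-unique : ∀ k → Unique (S k)
      S-unique zero    = [] ∷ []
      S-unique (suc k) = Uniqueₚ.filter⁺ _ uniq

      S-mono : ∀ k {y} → y ∈ S k → y ∈ S (suc k)
      S-mono k y∈ = ∈-step⁺ˡ (S⊆Vs k y∈) y∈

      -- Each round either has nothing to add, and then never will, or gains a node. A set of nodes
      -- cannot outgrow `Vs`, so `length Vs` rounds suffice.
      grow : ∀ k → Closed (S k) ⊎ suc k ≤ length (S k)
      grow zero = inj₂ (s≤s z≤n)
      grow (suc k) with grow k
      ... | inj₁ cl = inj₁ λ z∈ l → S-mono k (cl (back (∈-step⁻ z∈)) l)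
        where
          back : ∀ {z} → z ∈ S k ⊎ (∃ λ w → w ∈ S k × Link Es w z) → z ∈ S k
          back (inj₁ p) = p
          back (inj₂ (w , p , l)) = cl p l
      ... | inj₂ le with All.all? (_∈? S k) (S (suc k))
      ... | yes a = inj₁ λ z∈ l → S-mono k (All.lookup a (∈-step⁺ʳ (All.lookup a z∈) l))
      ... | no ¬a with find (¬All⇒Any¬ (_∈? S k) _ ¬a)
      ... | y , y∈ , y∉ = inj₂ (ℕₚ.≤-trans (s≤s le) (unique-⊆-length (¬Any⇒All¬ _ y∉ ∷ S-unique k) sub))
        where
          sub : ∀ {z} → z ∈ y ∷ S k → z ∈ S (suc k)
          sub (here refl) = y∈
          sub (there p)   = S-mono k p

      saturated : Closed (S (length Vs))
      saturated with grow (length Vs)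
      ... | inj₁ cl = cl
      ... | inj₂ le = ⊥-elim (ℕₚ.<-irrefl refl (ℕₚ.≤-trans le (unique-⊆-length (S-unique (length Vs)) (S⊆Vs (length Vs)))))

      start : ∀ k → x ∈ S k
      start zero    = here refl
      start (suc k) = S-mono k (start k)

      sound : ∀ k {y} → y ∈ S k → Path Es x y
      sound zero    (here refl) = ε
      sound (suc k) y∈ with ∈-step⁻ y∈
      ... | inj₁ p = sound k p
      ... | inj₂ (z , z∈ , l) = sound k z∈ ◅◅ (l ◅ ε)

      complete : ∀ {y z} → z ∈ S (length Vs) → Path Es z y → y ∈ S (length Vs)
      complete z∈ ε       = z∈
      complete z∈ (l ◅ p) = complete (saturated z∈ l) p

      reach⇒Path : ∀ {y} → T (reach Vs Es x y) → Path Es x y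
      reach⇒Path t = sound (length Vs) (memb⇒∈ t)

      Path⇒reach : ∀ {y} → Path Es x y → T (reach Vs Es x y)
      Path⇒reach p = ∈⇒memb (complete (start (length Vs)) p)

      Path? : ∀ y → Dec (Path Es x y)
      Path? y with T? (reach Vs Es x y)
      ... | yes t = yes (reach⇒Path t)
      ... | no ¬t = no (¬t ∘ Path⇒reach)

    -- The nodes that `countCompFrom` counts, kept as a list so that they can serve as a transversal
    -- of the components.
    firsts : List A → List A → List A
    firsts seen []       = []
    firsts seen (v ∷ vs) = if any (reach Vs Es v) seen then firsts (v ∷ seen) vs else v ∷ firsts (v ∷ seen) vs

    private module E = IsEquivalence (Path-equiv Es)

    length-firsts : ∀ seen vs → length (firsts seen vs) ≡ countCompFrom Vs Es seen vs
    length-firsts seen []       = refl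
    length-firsts seen (v ∷ vs) with any (reach Vs Es v) seen
    ... | true  = length-firsts (v ∷ seen) vs
    ... | false = cong suc (length-firsts (v ∷ seen) vs)

    hit : ∀ {v} → v ∈ Vs → ∀ seen → any (reach Vs Es v) seen ≡ true → Any (Path Es v) seen
    hit v∈ seen h = Any.map (reach⇒Path v∈) (any⁻ _ seen (true⇒T h))

    miss : ∀ {v} → v ∈ Vs → ∀ seen → any (reach Vs Es v) seen ≡ false → All (λ s → ¬ Path Es v s) seen
    miss v∈ seen h = ¬Any⇒All¬ seen λ a → contra (T⇒true (any⁺ _ (Any.map (Path⇒reach v∈) a)))
      where
        contra : ¬ any (reach Vs Es _) seen ≡ true
        contra h' with trans (sym h) h'
        ... | ()

    firsts-⊆ : ∀ seen vs → (∀ {w} → w ∈ vs → w ∈ Vs) → All (_∈ Vs) (firsts seen vs)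
    firsts-⊆ seen []       sub = []
    firsts-⊆ seen (v ∷ vs) sub with any (reach Vs Es v) seen
    ... | true  = firsts-⊆ (v ∷ seen) vs (sub ∘ there)
    ... | false = sub (here refl) ∷ firsts-⊆ (v ∷ seen) vs (sub ∘ there)

    firsts-new : ∀ seen vs → (∀ {w} → w ∈ vs → w ∈ Vs) → All (λ w → All (λ s → ¬ Path Es w s) seen) (firsts seen vs)
    firsts-new seen []       sub = []
    firsts-new seen (v ∷ vs) sub with any (reach Vs Es v) seen in eq
    ... | true  = All.map All.tail (firsts-new (v ∷ seen) vs (sub ∘ there))
    ... | false = miss (sub (here refl)) seen eq ∷ All.map All.tail (firsts-new (v ∷ seen) vs (sub ∘ there))

    firsts-indep : ∀ seen vs → (∀ {w} → w ∈ vs → w ∈ Vs) → AllPairs (λ x y → ¬ Path Es x y) (firsts seen vs)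
    firsts-indep seen []       sub = []
    firsts-indep seen (v ∷ vs) sub with any (reach Vs Es v) seen
    ... | true  = firsts-indep (v ∷ seen) vs (sub ∘ there)
    ... | false = All.map (λ a p → All.head a (E.sym p)) (firsts-new (v ∷ seen) vs (sub ∘ there))
                  ∷ firsts-indep (v ∷ seen) vs (sub ∘ there)

    firsts-cover : ∀ seen vs → (∀ {w} → w ∈ vs → w ∈ Vs) → ∀ {w} → w ∈ vs →
                   Any (Path Es w) (firsts seen vs) ⊎ Any (Path Es w) seen
    firsts-cover seen (v ∷ vs) sub w∈ with any (reach Vs Es v) seen in eq
    firsts-cover seen (v ∷ vs) sub (here refl) | true = inj₂ (hit (sub (here refl)) seen eq)
    firsts-cover seen (v ∷ vs) sub (there w∈) | true with firsts-cover (v ∷ seen) vs (sub ∘ there) w∈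
    ... | inj₁ a = inj₁ a
    ... | inj₂ (here p) = inj₂ (Any.map (E.trans p) (hit (sub (here refl)) seen eq))
    ... | inj₂ (there a) = inj₂ a
    firsts-cover seen (v ∷ vs) sub (here refl) | false = inj₁ (here ε)
    firsts-cover seen (v ∷ vs) sub (there w∈) | false with firsts-cover (v ∷ seen) vs (sub ∘ there) w∈
    ... | inj₁ a = inj₁ (there a)
    ... | inj₂ (here p) = inj₁ (here p)
    ... | inj₂ (there a) = inj₂ a

    ncomp-count : Count (_∈ Vs) (Path Es) (ncomp Vs Es)
    ncomp-count = record
      { reps = firsts [] Vs ; size = length-firsts [] Vs ; valid = firsts-⊆ [] Vs (λ p → p)
      ; indep = firsts-indep [] Vs (λ p → p) ; cover = λ v∈ → only (firsts-cover [] Vs (λ p → p) v∈) }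
      where
        only : ∀ {w} {xs : List A} → Any (Path Es w) xs ⊎ Any (Path Es w) [] → Any (Path Es w) xs
        only (inj₁ a) = a
        only (inj₂ ())

-- Flags and the parity lemma

xorSum : {A : Set} → (A → Bool) → List A → Bool
xorSum χ = foldr (λ x s → χ x xor s) false

xorSum-++ : ∀ {A : Set} (χ : A → Bool) xs ys → xorSum χ (xs ++ ys) ≡ xorSum χ xs xor xorSum χ ys
xorSum-++ χ []       ys = refl
xorSum-++ χ (x ∷ xs) ys = trans (cong (χ x xor_) (xorSum-++ χ xs ys)) (sym (xor-assoc (χ x) _ _))

xorSum-concatMap : ∀ {A B : Set} (χ : B → Bool) (f : A → List B) xs →
                   xorSum χ (concatMap f xs) ≡ xorSum (λ a → xorSum χ (f a)) xs
xorSum-concatMap χ f []       = refl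
xorSum-concatMap χ f (x ∷ xs) = trans (xorSum-++ χ (f x) _) (cong (xorSum χ (f x) xor_) (xorSum-concatMap χ f xs))

xorSum-zero : ∀ {A : Set} (χ : A → Bool) {xs} → All (λ x → χ x ≡ false) xs → xorSum χ xs ≡ false
xorSum-zero χ []       = refl
xorSum-zero χ (p ∷ ps) rewrite p = xorSum-zero χ ps

xorSum-single : ∀ {A : Set} (χ : A → Bool) {x xs} → Unique xs → x ∈ xs → (∀ y → y ≢ x → χ y ≡ false) → xorSum χ xs ≡ χ x
xorSum-single χ {x} (u ∷ _) (here refl) z
  rewrite xorSum-zero χ (All.map (λ {y} x≢y → z y (λ y≡x → x≢y (sym y≡x))) u) = xor-identityʳ (χ x)
xorSum-single χ (u ∷ us) (there {y} x∈) z rewrite z y (All.lookup u x∈) = xorSum-single χ us x∈ z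

xorSum-─ : ∀ {A : Set} (χ : A → Bool) {y xs} (p : y ∈ xs) → xorSum χ xs ≡ χ y xor xorSum χ (xs ─ p)
xorSum-─ χ (here refl) = refl
xorSum-─ χ {y} (there {x} {xs} p) = trans (cong (χ x xor_) (xorSum-─ χ p))
  (trans (sym (xor-assoc (χ x) (χ y) _)) (trans (cong (_xor xorSum χ (xs ─ p)) (xor-comm (χ x) (χ y))) (xor-assoc (χ y) (χ x) _)))

module _ {A : Set} (ν : A → A) (ν-invol : ∀ x → ν (ν x) ≡ x) (ν-fpf : ∀ x → ¬ ν x ≡ x)
         (χ : A → Bool) (χ-ν : ∀ x → χ (ν x) ≡ χ x) where

  -- `ν` pairs up the entries and the two members of a pair cancel. The bound `k` drives the
  -- recursion, since two entries leave the list at once.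
  xorSum-involution : ∀ k l → length l ≤ k → Unique l → (∀ {x} → x ∈ l → ν x ∈ l) → xorSum χ l ≡ false
  xorSum-involution k       []      _       _        _  = refl
  xorSum-involution (suc k) (x ∷ l) (s≤s h) (x∉ ∷ u) cl =
    trans (cong (χ x xor_) (trans (xorSum-─ χ p) (cong₂ _xor_ (χ-ν x) rest)))
      (trans (cong (χ x xor_) (xor-identityʳ (χ x))) (xor-same (χ x)))
    where
      tail∈ : ∀ {z} → z ∈ x ∷ l → z ≢ x → z ∈ l
      tail∈ (here z≡x) n = ⊥-elim (n z≡x)
      tail∈ (there z∈) n = z∈
      p : ν x ∈ l
      p = tail∈ (cl (here refl)) (ν-fpf x)
      keep : ∀ {z} → z ∈ (l ─ p) → z ∈ l × z ≢ ν x
      keep z∈ = All.lookup (All-─ p (All.tabulate id)) z∈ ,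
                λ z≡ → All.lookup (separated-─ (λ n q → n (sym q)) u p) z∈ (trans (sym (lookup-result p)) (sym z≡))
      cl' : ∀ {z} → z ∈ (l ─ p) → ν z ∈ (l ─ p)
      cl' {z} z∈ with keep z∈
      ... | z∈l , z≢νx with Any-─ p (tail∈ (cl (there z∈l)) (λ νz≡x → z≢νx (trans (sym (ν-invol z)) (cong ν νz≡x))))
      ... | inj₁ q = q
      ... | inj₂ (_ , a , b) = ⊥-elim (All.lookup x∉ z∈l (trans (sym (ν-invol x)) (trans (cong ν (trans a (sym b))) (ν-invol z))))
      rest : xorSum χ (l ─ p) ≡ false
      rest = xorSum-involution k (l ─ p) (ℕₚ.≤-trans (ℕₚ.n≤1+n _) (subst (_≤ k) (length-─ p) h)) (AllPairs-─ p u) cl'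

-- The two ways through an edge ribbon: false crosses an attaching arc, true runs along a long side.
tr : ∀ {n} → Bool → Flag n → Flag n
tr false = αF
tr true  = λF

tr-invol : ∀ {n} b (x : Flag n) → tr b (tr b x) ≡ x
tr-invol false (e , j , i) = cong (λ k → e , j , k) (not-involutive i)
tr-invol true  (e , j , i) = cong (λ k → e , k , i) (not-involutive j)

tr-edge : ∀ {n} b (x : Flag n) → flagEdge (tr b x) ≡ flagEdge x
tr-edge false x = refl
tr-edge true  x = refl

flags4 : ∀ {n} → Fin n → List (Flag n)
flags4 e = (e , false , false) ∷ (e , false , true) ∷ (e , true , false) ∷ (e , true , true) ∷ []

∈-flags4 : ∀ {n} (x : Flag n) → x ∈ flags4 (flagEdge x)
∈-flags4 (e , false , false) = here refl
∈-flags4 (e , false , true)  = there (here refl)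
∈-flags4 (e , true , false)  = there (there (here refl))
∈-flags4 (e , true , true)   = there (there (there (here refl)))

flags4-edge : ∀ {n} {e : Fin n} {x} → x ∈ flags4 e → flagEdge x ≡ e
flags4-edge (here refl) = refl
flags4-edge (there (here refl)) = refl
flags4-edge (there (there (here refl))) = refl
flags4-edge (there (there (there (here refl)))) = refl

∈-allFlags : ∀ {n} (x : Flag n) → x ∈ allFlags n
∈-allFlags x = ∈-concatMap⁺ flags4 (lose (∈-allFin (flagEdge x)) (∈-flags4 x))

allFlags-unique : ∀ n → Unique (allFlags n)
allFlags-unique n = Uniqueₚ.concat⁺ (Allₚ.map⁺ (All.tabulate (λ _ → u4)))
  (AllPairsₚ.map⁺ {f = flags4} (AllPairs.map (λ e≢f {v} → apart e≢f {v}) (Uniqueₚ.allFin⁺ n)))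
  where
    apart : ∀ {e f : Fin n} → e ≢ f → ∀ {v} → ¬ (v ∈ flags4 e × v ∈ flags4 f)
    apart e≢f (p , q) = e≢f (trans (sym (flags4-edge p)) (flags4-edge q))
    u4 : ∀ {e} → Unique (flags4 {n} e)
    u4 = ((λ ()) ∷ (λ ()) ∷ (λ ()) ∷ []) ∷ ((λ ()) ∷ (λ ()) ∷ []) ∷ ((λ ()) ∷ []) ∷ [] ∷ []

module _ {n : ℕ} (χ : Flag n → Bool) where

  quad : Fin n → Bool
  quad e = xorSum χ (flags4 e)

  ClosedAt FlipAt : Fin n → Bool → Set
  ClosedAt e b = ∀ x → flagEdge x ≡ e → χ (tr b x) ≡ χ x
  FlipAt   e b = ∀ x → flagEdge x ≡ e → χ (tr b x) ≡ not (χ x)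

  closed-quad : ∀ {e} b → ClosedAt e b → quad e ≡ false
  closed-quad {e} false cl rewrite cl (e , false , false) refl | cl (e , true , false) refl
    with χ (e , false , false) | χ (e , true , false)
  ... | true | true = refl
  ... | true | false = refl
  ... | false | true = refl
  ... | false | false = refl
  closed-quad {e} true cl rewrite cl (e , false , false) refl | cl (e , false , true) refl
    with χ (e , false , false) | χ (e , false , true)
  ... | true | true = refl
  ... | true | false = refl
  ... | false | true = refl
  ... | false | false = refl

-- With the flags of an edge in the order of `flags4`, the first two conclusions concern the pairs
-- of `αF` and the last two those of `λF`.
xor4 : ∀ p q r s → p xor (q xor (r xor (s xor false))) ≡ false → (p ≡ q → r ≡ s) × (r ≡ s → p ≡ q) × (p ≡ r → q ≡ s) × (q ≡ s → p ≡ r)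
xor4 false false false false _ = (λ _ → refl) , (λ _ → refl) , (λ _ → refl) , (λ _ → refl)
xor4 false false false true ()
xor4 false false true false ()
xor4 false false true true _ = (λ _ → refl) , (λ _ → refl) , (λ ()) , (λ ())
xor4 false true false false ()
xor4 false true false true _ = (λ ()) , (λ ()) , (λ _ → refl) , (λ _ → refl)
xor4 false true true false _ = (λ ()) , (λ ()) , (λ ()) , (λ ())
xor4 false true true true ()
xor4 true false false false ()
xor4 true false false true _ = (λ ()) , (λ ()) , (λ ()) , (λ ())
xor4 true false true false _ = (λ ()) , (λ ()) , (λ _ → refl) , (λ _ → refl)
xor4 true false true true ()
xor4 true true false false _ = (λ _ → refl) , (λ _ → refl) , (λ ()) , (λ ())
xor4 true true false true ()
xor4 true true true false ()
xor4 true true true true _ = (λ _ → refl) , (λ _ → refl) , (λ _ → refl) , (λ _ → refl)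

module _ {n : ℕ} (χ : Flag n → Bool) {e : Fin n} (even : quad χ e ≡ false) where
  private
    rules = xor4 (χ (e , false , false)) (χ (e , false , true)) (χ (e , true , false)) (χ (e , true , true)) even

  -- The transition `b` splits the four flags into two pairs. As their sum is even, agreement within
  -- one pair forces agreement within the other; the proof passes through the pair of the base flag.
  pair-spread : ∀ b x → flagEdge x ≡ e → χ (tr b x) ≡ χ x → ClosedAt χ e b
  pair-spread b (_ , j , i) refl h = from b (to b j i h)
    where
      Base : Bool → Set
      Base b = χ (tr b (e , false , false)) ≡ χ (e , false , false)
      to : ∀ b j i → χ (tr b (e , j , i)) ≡ χ (e , j , i) → Base b
      to false false false h = h
      to false false true  h = sym h
      to false true  false h = sym (proj₁ (proj₂ rules) (sym h))
      to false true  true  h = sym (proj₁ (proj₂ rules) h)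
      to true  false false h = h
      to true  false true  h = sym (proj₂ (proj₂ (proj₂ rules)) (sym h))
      to true  true  false h = sym h
      to true  true  true  h = sym (proj₂ (proj₂ (proj₂ rules)) h)
      from : ∀ b → Base b → ClosedAt χ e b
      from false h (_ , false , false) refl = h
      from false h (_ , false , true) refl = sym h
      from false h (_ , true , false) refl = sym (proj₁ rules (sym h))
      from false h (_ , true , true) refl = proj₁ rules (sym h)
      from true h (_ , false , false) refl = h
      from true h (_ , false , true) refl = sym (proj₁ (proj₂ (proj₂ rules)) (sym h))
      from true h (_ , true , false) refl = sym h
      from true h (_ , true , true) refl = proj₁ (proj₂ (proj₂ rules)) (sym h)

-- Reachability of flags under a choice of transitions

module Transitions (G : Ribbon) where
  open Ribbon G
  open RibbonInv G using (Fl; νE; αE; λE; onEdges; ncomp)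
  open Components (_≟Fl_ {ne}) using (Path; Path-equiv; module Search)

  -- `ν` makes the total over all flags even; if all other edges have an even share, so has `e`.
  even-quads : ∀ χ → (∀ x → χ (ν x) ≡ χ x) → ∀ e → (∀ f → f ≢ e → quad χ f ≡ false) → quad χ e ≡ false
  even-quads χ χ-ν e h = trans (sym (xorSum-single (quad χ) (Uniqueₚ.allFin⁺ ne) (∈-allFin e) h))
    (trans (sym (xorSum-concatMap χ flags4 (allFin ne)))
           (xorSum-involution ν ν-invol ν-fpf χ χ-ν _ Fl ℕₚ.≤-refl (allFlags-unique ne) (λ _ → ∈-allFlags _)))

  -- S e b: the transition b is available at the edge e.
  Spec : Set₁
  Spec = Fin ne → Bool → Set

  data Gen (S : Spec) : Flag ne → Flag ne → Set where
    gν : ∀ x → Gen S x (ν x)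
    gt : ∀ b x → S (flagEdge x) b → Gen S x (tr b x)

  Reach : Spec → Flag ne → Flag ne → Set
  Reach S = Star (Gen S)

  Gen-sym : ∀ {S x y} → Gen S x y → Gen S y x
  Gen-sym {S} (gν x) = subst (Gen S (ν x)) (ν-invol x) (gν (ν x))
  Gen-sym {S} (gt b x s) = subst (Gen S (tr b x)) (tr-invol b x) (gt b (tr b x) (subst (λ f → S f b) (sym (tr-edge b x)) s))

  Reach-equiv : ∀ {S} → IsEquivalence (Reach S)
  Reach-equiv = Star-equiv Gen-sym

  Reach-sym : ∀ {S x y} → Reach S x y → Reach S y x
  Reach-sym = reverse Gen-sym

  Gen-mono : ∀ {S S' x y} → (∀ f b → S f b → S' f b) → Gen S x y → Gen S' x y
  Gen-mono h (gν x) = gν x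
  Gen-mono h (gt b x s) = gt b x (h _ _ s)

  Reach-mono : ∀ {S S' x y} → (∀ f b → S f b → S' f b) → Reach S x y → Reach S' x y
  Reach-mono h = gmap id (Gen-mono h)

  -- The bridge between the edge lists searched by `ncomp` and the relation `Gen`; once it is
  -- established, all counting takes place with `Reach`.
  Presents : Spec → List (Flag ne × Flag ne) → Set
  Presents S Es = (∀ {x y} → Gen S x y → (x , y) ∈ Es) × (∀ {x y} → (x , y) ∈ Es → Gen S x y)

  module _ {S Es} (P : Presents S Es) where
    private
      module Se = Search {Es = Es} (allFlags-unique ne) (λ _ → ∈-allFlags _ , ∈-allFlags _)

      to : ∀ {x y} → Path Es x y → Reach S x y
      to = gmap id λ { (inj₁ p) → proj₂ P p ; (inj₂ p) → Gen-sym (proj₂ P p) }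

      from : ∀ {x y} → Reach S x y → Path Es x y
      from = gmap id (λ g → inj₁ (proj₁ P g))

    presented-count : Count (λ _ → ⊤) (Reach S) (ncomp Fl Es)
    presented-count = record
      { reps = C.reps ; size = C.size ; valid = All.map (λ _ → tt) C.valid
      ; indep = AllPairs.map (λ n p → n (from p)) C.indep ; cover = λ {x} _ → Any.map to (C.cover (∈-allFlags x)) }
      where module C = Count Se.ncomp-count

    presented-dec : ∀ x y → Dec (Reach S x y)
    presented-dec x y = map′ to from (Se.Path? (∈-allFlags x) y)

    presented-reach : ∀ {x y} → T (RibbonInv.reach G Fl Es x y) → Reach S x y
    presented-reach {x} t = to (Se.reach⇒Path (∈-allFlags x) t)

    presented-reach⁻ : ∀ {x y} → Reach S x y → T (RibbonInv.reach G Fl Es x y)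
    presented-reach⁻ {x} r = Se.Path⇒reach (∈-allFlags x) (from r)

  ∈-moves⁺ : ∀ (g : Flag ne → Flag ne) x → (x , g x) ∈ map (λ x → x , g x) Fl
  ∈-moves⁺ g x = ∈-map⁺ (λ x → x , g x) (∈-allFlags x)

  ∈-moves⁻ : ∀ (g : Flag ne → Flag ne) {x y} → (x , y) ∈ map (λ x → x , g x) Fl → y ≡ g x
  ∈-moves⁻ g p with ∈-map⁻ (λ x → x , g x) p
  ... | _ , _ , refl = refl

  presents-moves : ∀ (S : Spec) (p q : Fin ne → Bool) → (∀ f → S f false → p f ≡ true) → (∀ f → p f ≡ true → S f false) →
                   (∀ f → S f true → q f ≡ true) → (∀ f → q f ≡ true → S f true) →
                   ∀ Es → (∀ {z} → z ∈ Es → z ∈ νE ⊎ z ∈ onEdges p αE ⊎ z ∈ onEdges q λE) →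
                   (∀ {z} → z ∈ νE ⊎ z ∈ onEdges p αE ⊎ z ∈ onEdges q λE → z ∈ Es) → Presents S Es
  presents-moves S p q p⁺ p⁻ q⁺ q⁻ Es split join = to , λ z∈ → from (split z∈)
    where
      to : ∀ {x y} → Gen S x y → (x , y) ∈ Es
      to (gν x) = join (inj₁ (∈-moves⁺ ν x))
      to (gt false x s) = join (inj₂ (inj₁ (∈-filterᵇ⁺ _ (∈-moves⁺ αF x) (p⁺ _ s))))
      to (gt true x s)  = join (inj₂ (inj₂ (∈-filterᵇ⁺ _ (∈-moves⁺ λF x) (q⁺ _ s))))
      from : ∀ {x y} → (x , y) ∈ νE ⊎ (x , y) ∈ onEdges p αE ⊎ (x , y) ∈ onEdges q λE → Gen S x y
      from {x} (inj₁ z∈) = subst (Gen S x) (sym (∈-moves⁻ ν z∈)) (gν x)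
      from {x} (inj₂ (inj₁ z∈)) with ∈-filterᵇ⁻ _ {xs = αE} z∈
      ... | z∈' , h = subst (Gen S x) (sym (∈-moves⁻ αF z∈')) (gt false x (p⁻ _ h))
      from {x} (inj₂ (inj₂ z∈)) with ∈-filterᵇ⁻ _ {xs = λE} z∈
      ... | z∈' , h = subst (Gen S x) (sym (∈-moves⁻ λF z∈')) (gt true x (q⁻ _ h))

dec-⇔ : ∀ {A B : Set} (a? : Dec A) (b? : Dec B) → (A → B) → (B → A) → ⌊ a? ⌋ ≡ ⌊ b? ⌋
dec-⇔ (yes a) (yes b) f g = refl
dec-⇔ (yes a) (no ¬b) f g = ⊥-elim (¬b (f a))
dec-⇔ (no ¬a) (yes b) f g = ⊥-elim (¬a (g b))
dec-⇔ (no ¬a) (no ¬b) f g = refl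

⌊⌋-true : ∀ {A : Set} (a? : Dec A) → A → ⌊ a? ⌋ ≡ true
⌊⌋-true (yes _) a = refl
⌊⌋-true (no ¬a) a = ⊥-elim (¬a a)

⌊⌋-false : ∀ {A : Set} (a? : Dec A) → ¬ A → ⌊ a? ⌋ ≡ false
⌊⌋-false (yes a) ¬a = ⊥-elim (¬a a)
⌊⌋-false (no _)  ¬a = refl

true-⌊⌋ : ∀ {A : Set} (a? : Dec A) → ⌊ a? ⌋ ≡ true → A
true-⌊⌋ (yes a) _ = a

not≢ : ∀ {b} → ¬ not b ≡ b
not≢ {true}  ()
not≢ {false} ()

-- Sizes and single-edge changes of edge sets

module _ {n : ℕ} where

  size : (Fin n → Bool) → ℕ
  size h = length (filterᵇ h (allFin n))

  upd : (Fin n → Bool) → Fin n → Bool → Fin n → Bool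
  upd r e b f = if ⌊ f ≟F e ⌋ then b else r f

  upd-at : ∀ r e b → upd r e b e ≡ b
  upd-at r e b rewrite ⌊⌋-true (e ≟F e) refl = refl

  upd-off : ∀ r e b f → f ≢ e → upd r e b f ≡ r f
  upd-off r e b f f≢e rewrite ⌊⌋-false (f ≟F e) f≢e = refl

  module _ {p q : Fin n → Bool} where

    private
      filter-cong : ∀ l → (∀ {f} → f ∈ l → p f ≡ q f) → length (filterᵇ p l) ≡ length (filterᵇ q l)
      filter-cong []      h = refl
      filter-cong (f ∷ l) h with p f | q f | h (here refl)
      ... | true  | true  | refl = cong suc (filter-cong l (h ∘ there))
      ... | false | false | refl = filter-cong l (h ∘ there)

      filter-step : ∀ {e l} → Unique l → e ∈ l → p e ≡ false → q e ≡ true → (∀ f → f ≢ e → p f ≡ q f) →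
                    length (filterᵇ q l) ≡ suc (length (filterᵇ p l))
      filter-step {l = _ ∷ l} (u ∷ _) (here refl) pe qe h rewrite pe | qe =
        cong suc (sym (filter-cong l (λ f∈ → h _ (λ f≡e → All.lookup u f∈ (sym f≡e)))))
      filter-step {l = f ∷ l} (u ∷ us) (there e∈) pe qe h with p f | q f | h f (All.lookup u e∈)
      ... | true  | true  | refl = cong suc (filter-step us e∈ pe qe h)
      ... | false | false | refl = filter-step us e∈ pe qe h

    size-cong : (∀ f → p f ≡ q f) → size p ≡ size q
    size-cong h = filter-cong (allFin n) (λ {f} _ → h f)

    size-step : ∀ e → p e ≡ false → q e ≡ true → (∀ f → f ≢ e → p f ≡ q f) → size q ≡ suc (size p)
    size-step e = filter-step (Uniqueₚ.allFin⁺ n) (∈-allFin e)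

  -- Turns `q` into `q'` one edge at a time. The step learns that `r` has everywhere one of the two
  -- values, so the intermediate sets stay in any interval containing both ends; `ext` stands in for
  -- function extensionality.
  interpolate : (P : (Fin n → Bool) → Set) → (∀ {r r'} → (∀ f → r f ≡ r' f) → P r → P r') → (q q' : Fin n → Bool) → P q →
                (∀ r e → (∀ f → r f ≡ q f ⊎ r f ≡ q' f) → r e ≡ q e → q' e ≢ q e → P r → P (upd r e (q' e))) → P q'
  interpolate P ext q q' Pq step = ext (λ f → mix-done (∈-allFin f)) (Pmix (allFin n))
    where
      mix : List (Fin n) → Fin n → Bool
      mix []      = q
      mix (e ∷ l) = upd (mix l) e (q' e)
      mix-either : ∀ l f → mix l f ≡ q f ⊎ mix l f ≡ q' f
      mix-either []      f = inj₁ refl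
      mix-either (e ∷ l) f with f ≟F e
      ... | yes refl = inj₂ refl
      ... | no  _    = mix-either l f
      mix-done : ∀ {l f} → f ∈ l → mix l f ≡ q' f
      mix-done {e ∷ l} {f} f∈ with f ≟F e
      mix-done f∈          | yes refl = refl
      mix-done (here f≡e)  | no f≢e   = ⊥-elim (f≢e f≡e)
      mix-done (there f∈)  | no _     = mix-done f∈
      Pmix : ∀ l → P (mix l)
      Pmix []      = Pq
      Pmix (e ∷ l) with mix l e ≟B q' e
      ... | yes same = ext unchanged (Pmix l)
        where
          unchanged : ∀ f → mix l f ≡ mix (e ∷ l) f
          unchanged f with f ≟F e
          ... | yes refl = same
          ... | no  _    = refl
      ... | no diff with mix-either l e
      ... | inj₁ old = step (mix l) e (mix-either l) old (λ eq → diff (trans old (sym eq))) (Pmix l)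
      ... | inj₂ new = ⊥-elim (diff new)

-- Boundary curves, components and single-edge changes

module Counts (G : Ribbon) where
  open Ribbon G public
  open Transitions G public
  open RibbonInv G using (Fl; νE; αE; λE; onEdges; ncomp; cS; bcS; v; compEdges; bdryEdges; cG; sS)

  -- The components of Bd h and Cp h are the boundary curves and the connected components of F_h;
  -- Nn e h is Bd h with the edge e cut out.
  Bd Cp : (Fin ne → Bool) → Spec
  Bd h f b = b ≡ h f
  Cp h f b = b ≡ false ⊎ b ≡ h f

  Nn : Fin ne → (Fin ne → Bool) → Spec
  Nn e h f b = f ≢ e × b ≡ h f

  DecSpec : Spec → Set
  DecSpec S = ∀ f b → Dec (S f b)

  Bd? : ∀ h → DecSpec (Bd h)
  Bd? h f b = b ≟B h f

  Cp? : ∀ h → DecSpec (Cp h)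
  Cp? h f b = (b ≟B false) ⊎-dec (b ≟B h f)

  Nn? : ∀ e h → DecSpec (Nn e h)
  Nn? e h f b = ¬? (f ≟F e) ×-dec (b ≟B h f)

  module _ {S : Spec} (S? : DecSpec S) where

    moves : List (Flag ne × Flag ne)
    moves = νE ++ onEdges (λ f → ⌊ S? f false ⌋) αE ++ onEdges (λ f → ⌊ S? f true ⌋) λE

    moves-present : Presents S moves
    moves-present = presents-moves S _ _ (λ f → ⌊⌋-true (S? f false)) (λ f → true-⌊⌋ (S? f false))
      (λ f → ⌊⌋-true (S? f true)) (λ f → true-⌊⌋ (S? f true)) moves split join
      where
        aE = onEdges (λ f → ⌊ S? f false ⌋) αE
        lE = onEdges (λ f → ⌊ S? f true ⌋) λE
        split : ∀ {z} → z ∈ νE ++ aE ++ lE → z ∈ νE ⊎ z ∈ aE ⊎ z ∈ lE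
        split z∈ with ∈-++⁻ νE z∈
        ... | inj₁ p = inj₁ p
        ... | inj₂ p = inj₂ (∈-++⁻ aE p)
        join : ∀ {z} → z ∈ νE ⊎ z ∈ aE ⊎ z ∈ lE → z ∈ νE ++ aE ++ lE
        join (inj₁ p) = ∈-++⁺ˡ p
        join (inj₂ (inj₁ p)) = ∈-++⁺ʳ νE (∈-++⁺ˡ p)
        join (inj₂ (inj₂ p)) = ∈-++⁺ʳ νE (∈-++⁺ʳ aE p)

    reach? : ∀ x y → Dec (Reach S x y)
    reach? = presented-dec moves-present

    K : ℕ
    K = ncomp Fl moves

    K-count : Count (λ _ → ⊤) (Reach S) K
    K-count = presented-count moves-present

  K-cong : ∀ {S S'} (S? : DecSpec S) (S'? : DecSpec S') → (∀ {x y} → Reach S x y → Reach S' x y) →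
           (∀ {x y} → Reach S' x y → Reach S x y) → K S? ≡ K S'?
  K-cong S? S'? f g = count-≡ Reach-equiv Reach-equiv (K-count S?) (K-count S'?) (λ _ _ → f) (λ _ _ → g)

  B C : (Fin ne → Bool) → ℕ
  B h = K (Bd? h)
  C h = K (Cp? h)

  B-cong : ∀ {h h'} → (∀ f → h f ≡ h' f) → B h ≡ B h'
  B-cong {h} {h'} eq = K-cong (Bd? h) (Bd? h') (Reach-mono λ f b s → trans s (eq f)) (Reach-mono λ f b s → trans s (sym (eq f)))

  Cp-cong : ∀ {h h'} → (∀ f → h f ≡ h' f) → ∀ f b → Cp h f b → Cp h' f b
  Cp-cong eq f b (inj₁ p) = inj₁ p
  Cp-cong eq f b (inj₂ p) = inj₂ (trans p (eq f))

  C-cong : ∀ {h h'} → (∀ f → h f ≡ h' f) → C h ≡ C h'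
  C-cong {h} {h'} eq = K-cong (Cp? h) (Cp? h') (Reach-mono (Cp-cong eq)) (Reach-mono (Cp-cong (sym ∘ eq)))

  compEdges-present : ∀ H → Presents (Cp (inS H)) (compEdges H)
  compEdges-present H = presents-moves _ (λ _ → true) (inS H) (λ _ _ → refl) (λ _ _ → inj₁ refl)
    (λ { f (inj₂ p) → sym p }) (λ f p → inj₂ (sym p)) _ split join
    where
      lE = onEdges (inS H) λE
      split : ∀ {z} → z ∈ νE ++ αE ++ lE → z ∈ νE ⊎ z ∈ onEdges (λ _ → true) αE ⊎ z ∈ lE
      split z∈ with ∈-++⁻ νE z∈
      ... | inj₁ p = inj₁ p
      ... | inj₂ p with ∈-++⁻ αE p
      ... | inj₁ q = inj₂ (inj₁ (∈-filterᵇ⁺ _ q refl))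
      ... | inj₂ q = inj₂ (inj₂ q)
      join : ∀ {z} → z ∈ νE ⊎ z ∈ onEdges (λ _ → true) αE ⊎ z ∈ lE → z ∈ νE ++ αE ++ lE
      join (inj₁ p) = ∈-++⁺ˡ p
      join (inj₂ (inj₁ p)) = ∈-++⁺ʳ νE (∈-++⁺ˡ (proj₁ (∈-filterᵇ⁻ _ {xs = αE} p)))
      join (inj₂ (inj₂ p)) = ∈-++⁺ʳ νE (∈-++⁺ʳ αE p)

  bdryEdges-present : ∀ H → Presents (Bd (inS H)) (bdryEdges H)
  bdryEdges-present H = presents-moves _ (λ e → not (inS H e)) (inS H) (λ f p → cong not (sym p))
    (λ f p → trans (cong not (sym p)) (not-involutive (inS H f))) (λ f p → sym p) (λ f p → sym p) _ split join
    where
      lE = onEdges (inS H) λE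
      aE = onEdges (λ e → not (inS H e)) αE
      split : ∀ {z} → z ∈ νE ++ lE ++ aE → z ∈ νE ⊎ z ∈ aE ⊎ z ∈ lE
      split z∈ with ∈-++⁻ νE z∈
      ... | inj₁ p = inj₁ p
      ... | inj₂ p with ∈-++⁻ lE p
      ... | inj₁ q = inj₂ (inj₂ q)
      ... | inj₂ q = inj₂ (inj₁ q)
      join : ∀ {z} → z ∈ νE ⊎ z ∈ aE ⊎ z ∈ lE → z ∈ νE ++ lE ++ aE
      join (inj₁ p) = ∈-++⁺ˡ p
      join (inj₂ (inj₁ p)) = ∈-++⁺ʳ νE (∈-++⁺ʳ lE p)
      join (inj₂ (inj₂ p)) = ∈-++⁺ʳ νE (∈-++⁺ˡ p)

  ∅ : Fin ne → Bool
  ∅ _ = false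

  vertexEdges-present : Presents (Cp ∅) (νE ++ αE)
  vertexEdges-present = presents-moves _ (λ _ → true) ∅ (λ _ _ → refl) (λ _ _ → inj₁ refl)
    (λ { f (inj₁ ()) ; f (inj₂ ()) }) (λ f ()) _ split join
    where
      split : ∀ {z} → z ∈ νE ++ αE → z ∈ νE ⊎ z ∈ onEdges (λ _ → true) αE ⊎ z ∈ onEdges ∅ λE
      split z∈ with ∈-++⁻ νE z∈
      ... | inj₁ p = inj₁ p
      ... | inj₂ p = inj₂ (inj₁ (∈-filterᵇ⁺ _ p refl))
      join : ∀ {z} → z ∈ νE ⊎ z ∈ onEdges (λ _ → true) αE ⊎ z ∈ onEdges ∅ λE → z ∈ νE ++ αE
      join (inj₁ p) = ∈-++⁺ˡ p
      join (inj₂ (inj₁ p)) = ∈-++⁺ʳ νE (proj₁ (∈-filterᵇ⁻ _ {xs = αE} p))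
      join (inj₂ (inj₂ p)) with proj₂ (∈-filterᵇ⁻ _ {xs = λE} p)
      ... | ()

  presented-K : ∀ {S Es} (S? : DecSpec S) → Presents S Es → ncomp Fl Es ≡ K S?
  presented-K S? P = count-≡ Reach-equiv Reach-equiv (presented-count P) (K-count S?) (λ _ _ → id) (λ _ _ → id)

  cS≡ : ∀ H → cS H ≡ C (inS H) + iso
  cS≡ H = cong (_+ iso) (presented-K (Cp? (inS H)) (compEdges-present H))

  bcS≡ : ∀ H → bcS H ≡ B (inS H) + iso
  bcS≡ H = cong (_+ iso) (presented-K (Bd? (inS H)) (bdryEdges-present H))

  v≡ : v ≡ C ∅ + iso
  v≡ = cong (_+ iso) (presented-K (Cp? ∅) vertexEdges-present)

  Invariant : Spec → (Flag ne → Bool) → Set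
  Invariant S χ = ∀ {x y} → Gen S x y → χ y ≡ χ x

  invariant-reach : ∀ {S χ} → Invariant S χ → ∀ {x y} → Reach S x y → χ y ≡ χ x
  invariant-reach inv ε       = refl
  invariant-reach inv (g ◅ r) = trans (invariant-reach inv r) (inv g)

  -- Turns a decidable class of flags into a two-colouring, the form in which parity applies; every
  -- cut below arises in this way.
  indicator-invariant : ∀ {S} {P : Flag ne → Set} (P? : ∀ y → Dec (P y)) → (∀ {y z} → P y → Gen S y z → P z) →
                        Invariant S (λ y → ⌊ P? y ⌋)
  indicator-invariant P? cl {x} {y} g = dec-⇔ (P? y) (P? x) (λ p → cl p (Gen-sym g)) (λ p → cl p g)

  reach-invariant : ∀ {S} (S? : DecSpec S) x → Invariant S (λ y → ⌊ reach? S? x y ⌋)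
  reach-invariant S? x = indicator-invariant (reach? S? x) (λ p g → p ◅◅ (g ◅ ε))

  -- Every edge other than `e` keeps a transition under which `χ` is closed, hence has an even
  -- share.
  Nn-even : ∀ {e r χ} → Invariant (Nn e r) χ → quad χ e ≡ false
  Nn-even {e} {r} {χ} inv = even-quads χ (λ x → inv (gν x)) e
    λ f f≢e → closed-quad χ (r f) λ { x refl → inv (gt (r f) x (f≢e , refl)) }

  base : Fin ne → Flag ne
  base e = e , false , false

  module Toggle (e : Fin ne) (r r' : Fin ne → Bool) (agree : ∀ f → f ≢ e → r' f ≡ r f) where
    private
      x₀ = base e
      b = r' e

    linked? : ∀ x y → Dec (Linked (Reach (Nn e r)) x₀ (tr b x₀) x y)
    linked? x y = R x y ⊎-dec ((R x x₀ ×-dec R (tr b x₀) y) ⊎-dec (R x (tr b x₀) ×-dec R x₀ y))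
      where R = reach? (Nn? e r)

    -- The transition at `e` consists of two links. By parity the second adds nothing once the base
    -- flag has been linked, so the whole transition merges at most one pair of classes.
    across : ∀ x → flagEdge x ≡ e → Linked (Reach (Nn e r)) x₀ (tr b x₀) x (tr b x)
    across x x∈e = true-⌊⌋ (linked? x (tr b x)) (trans (pair-spread χ even b x₀ refl base-pair x x∈e) (⌊⌋-true (linked? x x) (inj₁ ε)))
      where
        χ : Flag ne → Bool
        -- The class of `x` once the base link has been added: it is closed with `e` cut out and
        -- contains both or neither of the base pair.
        χ y = ⌊ linked? x y ⌋
        even : quad χ e ≡ false
        even = Nn-even {r = r} (indicator-invariant (linked? x) (λ p g → Linked-trans Reach-equiv p (inj₁ (g ◅ ε))))
        base-pair : χ (tr b x₀) ≡ χ x₀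
        base-pair = dec-⇔ (linked? x (tr b x₀)) (linked? x x₀) (λ p → Linked-trans Reach-equiv p (inj₂ (inj₂ (ε , ε))))
                      (λ p → Linked-trans Reach-equiv p (inj₂ (inj₁ (ε , ε))))

    link : ∀ {x y} → Reach (Bd r') x y → Linked (Reach (Nn e r)) x₀ (tr b x₀) x y
    link ε = inj₁ ε
    link (g ◅ p) = Linked-trans Reach-equiv (link₁ g) (link p)
      where
        link₁ : ∀ {x y} → Gen (Bd r') x y → Linked (Reach (Nn e r)) x₀ (tr b x₀) x y
        link₁ (gν x) = inj₁ (gν x ◅ ε)
        link₁ (gt c x s) with flagEdge x ≟F e
        ... | yes x∈e = subst (λ c → Linked (Reach (Nn e r)) x₀ (tr b x₀) x (tr c x)) (sym (trans s (cong r' x∈e))) (across x x∈e)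
        ... | no x∉e = inj₁ (gt c x (x∉e , trans s (agree _ x∉e)) ◅ ε)

    include : ∀ {x y} → Reach (Nn e r) x y → Reach (Bd r') x y
    include = Reach-mono λ { f c (f≢e , p) → trans p (sym (agree f f≢e)) }

    toggle-same : Reach (Nn e r) x₀ (tr b x₀) → K (Nn? e r) ≡ B r'
    toggle-same = count-link-same Reach-equiv Reach-equiv include (gt b x₀ refl ◅ ε) link (K-count (Nn? e r)) (K-count (Bd? r'))

    toggle-merge : ¬ Reach (Nn e r) x₀ (tr b x₀) → K (Nn? e r) ≡ suc (B r')
    toggle-merge = count-link-merge Reach-equiv Reach-equiv include (gt b x₀ refl ◅ ε) link (K-count (Nn? e r)) (K-count (Bd? r')) tt tt

    toggle-either : K (Nn? e r) ≡ B r' ⊎ K (Nn? e r) ≡ suc (B r')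
    toggle-either with reach? (Nn? e r) x₀ (tr b x₀)
    ... | yes p = inj₁ (toggle-same p)
    ... | no ¬p = inj₂ (toggle-merge ¬p)

  module AddEdge (e : Fin ne) (r r' : Fin ne → Bool) (re : r e ≡ false) (re' : r' e ≡ true)
                 (agree : ∀ f → f ≢ e → r' f ≡ r f) where
    private
      x₀ = base e

    -- Attaching arcs are always available in `Cp`, so both long sides of `e` connect the same two
    -- components and one link stands for both.
    slide : ∀ j i → Reach (Cp r) (e , j , i) (e , j , false)
    slide j false = ε
    slide j true  = gt false _ (inj₁ refl) ◅ ε

    link : ∀ {x y} → Reach (Cp r') x y → Linked (Reach (Cp r)) x₀ (λF x₀) x y
    link ε = inj₁ ε
    link (g ◅ p) = Linked-trans Reach-equiv (link₁ g) (link p)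
      where
        link₁ : ∀ {x y} → Gen (Cp r') x y → Linked (Reach (Cp r)) x₀ (λF x₀) x y
        link₁ (gν x) = inj₁ (gν x ◅ ε)
        link₁ (gt false x _) = inj₁ (gt false x (inj₁ refl) ◅ ε)
        link₁ (gt true x (inj₂ s)) with flagEdge x ≟F e
        link₁ (gt true (_ , false , i) (inj₂ s)) | yes refl = inj₂ (inj₁ (slide _ i , Reach-sym (slide _ i)))
        link₁ (gt true (_ , true , i) (inj₂ s))  | yes refl = inj₂ (inj₂ (slide _ i , Reach-sym (slide _ i)))
        ... | no x∉e = inj₁ (gt true x (inj₂ (trans s (agree _ x∉e))) ◅ ε)

    include : ∀ {x y} → Reach (Cp r) x y → Reach (Cp r') x y
    include = Reach-mono inc
      where
        inc : ∀ f b → Cp r f b → Cp r' f b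
        inc f b (inj₁ p) = inj₁ p
        inc f b (inj₂ p) with f ≟F e
        ... | yes refl = inj₁ (trans p re)
        ... | no f≢e   = inj₂ (trans p (sym (agree f f≢e)))

    add-same : Reach (Cp r) x₀ (λF x₀) → C r ≡ C r'
    add-same = count-link-same Reach-equiv Reach-equiv include (gt true x₀ (inj₂ (sym re')) ◅ ε) link (K-count (Cp? r)) (K-count (Cp? r'))

    add-merge : ¬ Reach (Cp r) x₀ (λF x₀) → C r ≡ suc (C r')
    add-merge = count-link-merge Reach-equiv Reach-equiv include (gt true x₀ (inj₂ (sym re')) ◅ ε) link
      (K-count (Cp? r)) (K-count (Cp? r')) tt tt

    C-drop : C r ≤ suc (C r')
    C-drop with reach? (Cp? r) x₀ (λF x₀)
    ... | yes p = ℕₚ.≤-trans (ℕₚ.≤-reflexive (add-same p)) (ℕₚ.n≤1+n _)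
    ... | no ¬p = ℕₚ.≤-reflexive (add-merge ¬p)

  private
    ≢false⇒true : ∀ {b c} → b ≢ c → c ≡ false → b ≡ true
    ≢false⇒true n refl = ¬-not n

  -- Each added edge raises the size by one and lowers the number of components by at most one.
  components-bound : ∀ q q' → (∀ f → q f ≡ true → q' f ≡ true) → C q + size q ≤ C q' + size q'
  components-bound q q' q≤q' = interpolate P ext q q' ℕₚ.≤-refl step
    where
      P : (Fin ne → Bool) → Set
      P r = C q + size q ≤ C r + size r
      ext : ∀ {r r'} → (∀ f → r f ≡ r' f) → P r → P r'
      ext eq = subst (C q + size q ≤_) (cong₂ _+_ (C-cong eq) (size-cong eq))
      step : ∀ r e → (∀ f → r f ≡ q f ⊎ r f ≡ q' f) → r e ≡ q e → q' e ≢ q e → P r → P (upd r e (q' e))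
      step r e _ re q'e h = begin
        C q + size q        ≤⟨ h ⟩
        C r + size r        ≤⟨ ℕₚ.+-monoˡ-≤ (size r) C-drop ⟩
        suc (C r') + size r ≡⟨ sym (ℕₚ.+-suc (C r') (size r)) ⟩
        C r' + suc (size r) ≡⟨ cong (C r' +_) (sym (size-step e re0 (trans (upd-at r e _) q'e1) (λ f f≢e → sym (upd-off r e _ f f≢e)))) ⟩
        C r' + size r'      ∎
        where
          open ℕₚ.≤-Reasoning
          r' = upd r e (q' e)
          qe0 : q e ≡ false
          qe0 with q e in eq
          ... | true  = ⊥-elim (q'e (q≤q' e eq))
          ... | false = refl
          re0 = trans re qe0
          q'e1 : q' e ≡ true
          q'e1 = ≢false⇒true q'e qe0
          open AddEdge e r r' re0 (trans (upd-at r e _) q'e1) (upd-off r e _)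

  -- This is s >= 0, with the isolated vertices left out of every term. An added edge either lies
  -- within a component and raises `B` by at most one, or it joins two components and also merges
  -- two boundary curves.
  genus-nonneg : ∀ h → C ∅ + B h ≤ 2 * C h + size h
  genus-nonneg h = interpolate P ext ∅ h P∅ step
    where
      P : (Fin ne → Bool) → Set
      P r = C ∅ + B r ≤ 2 * C r + size r
      ext : ∀ {r r'} → (∀ f → r f ≡ r' f) → P r → P r'
      ext eq = subst₂ _≤_ (cong (C ∅ +_) (B-cong eq)) (cong₂ (λ c s → 2 * c + s) (C-cong eq) (size-cong eq))
      B∅ : B ∅ ≡ C ∅
      B∅ = K-cong (Bd? ∅) (Cp? ∅) (Reach-mono λ _ _ → inj₁) (Reach-mono λ { _ _ (inj₁ p) → p ; _ _ (inj₂ p) → p })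
      P∅ : P ∅
      P∅ = subst (λ b → C ∅ + b ≤ 2 * C ∅ + size ∅) (sym B∅)
             (ℕₚ.≤-trans (ℕₚ.≤-reflexive (cong (C ∅ +_) (sym (ℕₚ.+-identityʳ (C ∅))))) (ℕₚ.m≤m+n (2 * C ∅) (size ∅)))
      step : ∀ r e → (∀ f → r f ≡ false ⊎ r f ≡ h f) → r e ≡ false → h e ≢ false → P r → P (upd r e (h e))
      step r e _ re he Pr with reach? (Cp? r) (base e) (λF (base e))
      ... | yes p = begin
        C ∅ + B r'                ≤⟨ ℕₚ.+-monoʳ-≤ (C ∅) B≤ ⟩
        C ∅ + suc (B r)           ≡⟨ ℕₚ.+-suc (C ∅) (B r) ⟩
        suc (C ∅ + B r)           ≤⟨ s≤s Pr ⟩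
        suc (2 * C r + size r)    ≡⟨ sym (ℕₚ.+-suc (2 * C r) (size r)) ⟩
        2 * C r + suc (size r)    ≡⟨ cong₂ (λ c s → 2 * c + s) (A.add-same p) (sym size') ⟩
        2 * C r' + size r'        ∎
        where
          open ℕₚ.≤-Reasoning
          r' = upd r e (h e)
          he1 : r' e ≡ true
          he1 = trans (upd-at r e _) (≢false⇒true he refl)
          module A = AddEdge e r r' re he1 (upd-off r e _)
          module T' = Toggle e r r' (upd-off r e _)
          module T₀ = Toggle e r r (λ _ _ → refl)
          size' : size r' ≡ suc (size r)
          size' = size-step e re he1 (λ f f≢e → sym (upd-off r e _ f f≢e))
          up : K (Nn? e r) ≡ B r ⊎ K (Nn? e r) ≡ suc (B r) → K (Nn? e r) ≤ suc (B r)
          up (inj₁ q) = ℕₚ.≤-trans (ℕₚ.≤-reflexive q) (ℕₚ.n≤1+n _)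
          up (inj₂ q) = ℕₚ.≤-reflexive q
          down : K (Nn? e r) ≡ B r' ⊎ K (Nn? e r) ≡ suc (B r') → B r' ≤ K (Nn? e r)
          down (inj₁ q) = ℕₚ.≤-reflexive (sym q)
          down (inj₂ q) = ℕₚ.≤-trans (ℕₚ.n≤1+n _) (ℕₚ.≤-reflexive (sym q))
          B≤ : B r' ≤ suc (B r)
          B≤ = ℕₚ.≤-trans (down T'.toggle-either) (up T₀.toggle-either)
      ... | no ¬p = ℕₚ.≤-pred (begin
        suc (C ∅ + B r')              ≡⟨ sym (ℕₚ.+-suc (C ∅) (B r')) ⟩
        C ∅ + suc (B r')              ≡⟨ cong (C ∅ +_) (sym Bdrop) ⟩
        C ∅ + B r                     ≤⟨ Pr ⟩
        2 * C r + size r              ≡⟨ cong (λ c → 2 * c + size r) (A.add-merge ¬p) ⟩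
        2 * suc (C r') + size r       ≡⟨ solve 2 (λ c s → con 2 :* (con 1 :+ c) :+ s := con 1 :+ (con 2 :* c :+ (con 1 :+ s)))
                                           refl (C r') (size r) ⟩
        suc (2 * C r' + suc (size r)) ≡⟨ cong (λ s → suc (2 * C r' + s)) (sym size') ⟩
        suc (2 * C r' + size r')      ∎)
        where
          open ℕₚ.≤-Reasoning
          open +-*-Solver using (solve; con; _:*_; _:+_; _:=_)
          r' = upd r e (h e)
          x₀ = base e
          he1 : r' e ≡ true
          he1 = trans (upd-at r e _) (≢false⇒true he refl)
          module A = AddEdge e r r' re he1 (upd-off r e _)
          module T' = Toggle e r r' (upd-off r e _)
          module T₀ = Toggle e r r (λ _ _ → refl)
          size' : size r' ≡ suc (size r)
          size' = size-step e re he1 (λ f f≢e → sym (upd-off r e _ f f≢e))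
          N⊆C : ∀ {x y} → Reach (Nn e r) x y → Reach (Cp r) x y
          N⊆C = Reach-mono (λ _ _ → inj₂ ∘ proj₂)
          ψ : Flag ne → Bool
          ψ y = ⌊ reach? (Nn? e r) x₀ y ⌋
          ψλ : ψ (λF x₀) ≡ false
          ψλ = ⌊⌋-false (reach? (Nn? e r) x₀ (λF x₀)) (¬p ∘ N⊆C)
          ψαλ : ψ (αF (λF x₀)) ≡ false
          ψαλ = ⌊⌋-false (reach? (Nn? e r) x₀ (αF (λF x₀))) λ q → ¬p (N⊆C q ◅◅ (gt false _ (inj₁ refl) ◅ ε))
          -- Neither flag at the far end of `e` can be reached from `x₀`, so parity keeps the two
          -- flags at the near end together.
          x₀~αx₀ : Reach (Nn e r) x₀ (αF x₀)
          x₀~αx₀ = true-⌊⌋ (reach? (Nn? e r) x₀ (αF x₀))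
            (trans (pair-spread ψ (Nn-even {r = r} (reach-invariant (Nn? e r) x₀)) false (λF x₀) refl (trans ψαλ (sym ψλ)) x₀ refl)
                   (⌊⌋-true (reach? (Nn? e r) x₀ x₀) ε))
          Bdrop : B r ≡ suc (B r')
          Bdrop = trans (sym (T₀.toggle-same (subst (λ b → Reach (Nn e r) x₀ (tr b x₀)) (sym re) x₀~αx₀)))
                        (T'.toggle-merge λ q → ¬p (N⊆C (subst (λ b → Reach (Nn e r) x₀ (tr b x₀)) he1 q)))

-- The list `filterᵇ (inS P) (allFin n)` by recursion on `P`, as needed for induction over subsets.
pick : ∀ {n} → Subset n → List (Fin n)
pick []          = []
pick (true ∷ P)  = Fin.zero ∷ map Fin.suc (pick P)
pick (false ∷ P) = map Fin.suc (pick P)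

filterᵇ-map : ∀ {A B : Set} (g : A → B) p l → filterᵇ p (map g l) ≡ map g (filterᵇ (p ∘ g) l)
filterᵇ-map g p []      = refl
filterᵇ-map g p (x ∷ l) with p (g x)
... | true  = cong (g x ∷_) (filterᵇ-map g p l)
... | false = filterᵇ-map g p l

filter≡pick : ∀ {n} (P : Subset n) → filterᵇ (inS P) (allFin n) ≡ pick P
filter≡pick []      = refl
filter≡pick {suc n} (b ∷ P) with tail
  where
    tail : filterᵇ (inS (b ∷ P)) (Data.List.tabulate Fin.suc) ≡ map Fin.suc (pick P)
    tail = trans (cong (filterᵇ (inS (b ∷ P))) (sym (map-tabulate id Fin.suc)))
             (trans (filterᵇ-map Fin.suc (inS (b ∷ P)) (allFin n)) (cong (map Fin.suc) (filter≡pick P)))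
filter≡pick (true ∷ P)  | t = cong (Fin.zero ∷_) t
filter≡pick (false ∷ P) | t = t

∣∣≡size : ∀ {n} (H : Subset n) → ∣ H ∣ ≡ size (inS H)
∣∣≡size H = trans (go H) (cong length (sym (filter≡pick H)))
  where
    go : ∀ {n} (H : Subset n) → ∣ H ∣ ≡ length (pick H)
    go []          = refl
    go (true ∷ H)  = cong suc (trans (go H) (sym (length-map Fin.suc (pick H))))
    go (false ∷ H) = trans (go H) (sym (length-map Fin.suc (pick H)))

-- s(F) = 2 n(S) + s(F_VI) for F in the interval of Q, where S consists of the edges of F in I_o(Q).
split-∸ : ∀ v bI bh cI cS kI kh s → v + bI ≤ 2 * cI + kI → cI ≤ s + cS → bI + kh ≡ bh + kI + 2 * s →
          (2 * cS + kh) ∸ (v + bh) ≡ 2 * ((s + cS) ∸ cI) + ((2 * cI + kI) ∸ (v + bI))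
split-∸ v bI bh cI cS kI kh s genus bound balance =
  trans (cong (_∸ (v + bh)) (ℕₚ.+-cancelʳ-≡ bI _ _ total)) (ℕₚ.m+n∸n≡m (2 * d + g) (v + bh))
  where
    open +-*-Solver using (solve; con; _:*_; _:+_; _:=_)
    d = (s + cS) ∸ cI
    g = (2 * cI + kI) ∸ (v + bI)
    open Relation.Binary.PropositionalEquality.≡-Reasoning
    total : 2 * cS + kh + bI ≡ 2 * d + g + (v + bh) + bI
    total = begin
      2 * cS + kh + bI                ≡⟨ solve 3 (λ c k b → con 2 :* c :+ k :+ b := con 2 :* c :+ (b :+ k)) refl cS kh bI ⟩
      2 * cS + (bI + kh)              ≡⟨ cong (2 * cS +_) balance ⟩
      2 * cS + (bh + kI + 2 * s)      ≡⟨ solve 4 (λ c b k s → con 2 :* c :+ (b :+ k :+ con 2 :* s) := con 2 :* (s :+ c) :+ (b :+ k))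
                                          refl cS bh kI s ⟩
      2 * (s + cS) + (bh + kI)        ≡⟨ cong (λ z → 2 * z + (bh + kI)) (sym (ℕₚ.m∸n+n≡m bound)) ⟩
      2 * (d + cI) + (bh + kI)        ≡⟨ solve 4 (λ d c b k → con 2 :* (d :+ c) :+ (b :+ k) := con 2 :* d :+ b :+ (con 2 :* c :+ k))
                                          refl d cI bh kI ⟩
      2 * d + bh + (2 * cI + kI)      ≡⟨ cong (2 * d + bh +_) (sym (ℕₚ.m∸n+n≡m genus)) ⟩
      2 * d + bh + (g + (v + bI))     ≡⟨ solve 5 (λ d b g v i → d :+ b :+ (g :+ (v :+ i)) := d :+ g :+ (v :+ b) :+ i)
                                          refl (2 * d) bh g v bI ⟩
      2 * d + g + (v + bh) + bI       ∎

-- Cuts and the exponents they determine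

module Cuts (G : Ribbon) where
  open Counts G public
  open RibbonInv G using (cS; bcS; v; sS)

  sS≡ : ∀ H → sS H ≡ (2 * (C (inS H) + iso) + size (inS H)) ∸ ((C ∅ + iso) + (B (inS H) + iso))
  sS≡ H = cong₂ _∸_ (cong₂ (λ c k → 2 * c + k) (cS≡ H) (∣∣≡size H)) (cong₂ _+_ v≡ (bcS≡ H))

  -- At e the bipartition χ is crossed by the transition b only, so removing e separates its two sides.
  record Cut (S : Spec) (e : Fin ne) (b : Bool) : Set where
    field
      χ      : Flag ne → Bool
      χ-ν    : ∀ x → χ (ν x) ≡ χ x
      closed : ∀ f c → f ≢ e → S f c → ClosedAt χ f c
      keeps  : ClosedAt χ e (not b)
      flips  : FlipAt χ e b

  -- With both transitions open on `D`, a cut is valid for all members of the interval of `Q` at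
  -- once, these being the sets that agree with `Q` off `D`.
  Loose : (Q D : Fin ne → Bool) → Spec
  Loose Q D f b = D f ≡ true ⊎ b ≡ Q f

  AgreeOff : (D h Q : Fin ne → Bool) → Set
  AgreeOff D h Q = ∀ f → D f ≡ false → h f ≡ Q f

  module _ {S : Spec} {e : Fin ne} {q : Bool} (cut : Cut S e q) where
    open Cut cut

    cut-invariant : ∀ {S'} → (∀ f b → S' f b → f ≢ e × S f b) → Invariant S' χ
    cut-invariant h (gν x) = χ-ν x
    cut-invariant h (gt b x s) with h _ _ s
    ... | f≢e , s' = closed _ b f≢e s' x refl

    module _ {r : Fin ne → Bool} (r⊆ : ∀ f → f ≢ e → S f (r f)) where

      Nn-invariant : Invariant (Nn e r) χ
      Nn-invariant = cut-invariant λ { f b (f≢e , refl) → f≢e , r⊆ f f≢e }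

      cut-separates : ∀ x → flagEdge x ≡ e → ¬ Reach (Nn e r) x (tr q x)
      cut-separates x x∈e p = not≢ (trans (sym (flips x x∈e)) (invariant-reach Nn-invariant p))

      -- The pair of `tr q x` under the other transition lies wholly across the cut, out of reach of
      -- `x`. By parity the class of `x` then contains its own pair wholly or not at all, and it
      -- contains `x`.
      cut-joins : ∀ x → flagEdge x ≡ e → Reach (Nn e r) x (tr (not q) x)
      cut-joins x x∈e = true-⌊⌋ (R (tr (not q) x)) (trans
        (pair-spread ψ (Nn-even {r = r} (reach-invariant (Nn? e r) x)) (not q) (tr q x) (trans (tr-edge q x) x∈e)
           (trans (outside _ χ-other) (sym (outside _ (flips x x∈e)))) x x∈e)
        (⌊⌋-true (R x) ε))
        where
          R = reach? (Nn? e r) x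
          ψ : Flag ne → Bool
          ψ y = ⌊ R y ⌋
          outside : ∀ y → χ y ≡ not (χ x) → ψ y ≡ false
          outside y h = ⌊⌋-false (R y) λ p → not≢ (trans (sym h) (invariant-reach Nn-invariant p))
          χ-other : χ (tr (not q) (tr q x)) ≡ not (χ x)
          χ-other = trans (keeps (tr q x) (trans (tr-edge q x) x∈e)) (flips x x∈e)

  module CutSystem (Q D : Fin ne → Bool) (cut : ∀ e → D e ≡ true → Cut (Loose Q D) e (Q e)) where

    loose : ∀ {r} → AgreeOff D r Q → ∀ f → Loose Q D f (r f)
    loose ag f with D f in eq
    ... | true  = inj₁ refl
    ... | false = inj₂ (ag f eq)

    separates : ∀ {r} → AgreeOff D r Q → ∀ {e} → D e ≡ true → ∀ x → flagEdge x ≡ e → ¬ Reach (Nn e r) x (tr (Q e) x)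
    separates ag De = cut-separates (cut _ De) (λ f _ → loose ag f)

    joins : ∀ {r} → AgreeOff D r Q → ∀ {e} → D e ≡ true → ∀ x → flagEdge x ≡ e → Reach (Nn e r) x (tr (not (Q e)) x)
    joins ag De = cut-joins (cut _ De) (λ f _ → loose ag f)

    internal : (Fin ne → Bool) → Fin ne → Bool
    internal h f = h f ∧ Q f

    module _ {h : Fin ne → Bool} (ag : AgreeOff D h Q) where

      -- With an edge of `D` cut out, its `Q`-transition merges two classes because it crosses a
      -- cut, while the other transition joins flags that are already connected. Each switch away
      -- from `Q` thus costs exactly one curve.
      boundary-count : B h ≡ B Q + size (λ f → h f xor Q f)
      boundary-count = interpolate P ext Q h PQ step
        where
          P : (Fin ne → Bool) → Set
          P r = B r ≡ B Q + size (λ f → r f xor Q f)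
          ext : ∀ {r r'} → (∀ f → r f ≡ r' f) → P r → P r'
          ext eq Pr = trans (sym (B-cong eq)) (trans Pr (cong (B Q +_) (size-cong λ f → cong (_xor Q f) (eq f))))
          empty : ∀ l → length (filterᵇ (λ f → Q f xor Q f) l) ≡ 0
          empty []      = refl
          empty (f ∷ l) rewrite xor-same (Q f) = empty l
          PQ : P Q
          PQ = sym (trans (cong (B Q +_) (empty (allFin ne))) (ℕₚ.+-identityʳ (B Q)))
          step : ∀ r e → (∀ f → r f ≡ Q f ⊎ r f ≡ h f) → r e ≡ Q e → h e ≢ Q e → P r → P (upd r e (h e))
          step r e mid re he Pr = trans (sym B') (trans (cong suc Pr) (trans (sym (ℕₚ.+-suc (B Q) _)) (cong (B Q +_) (sym size'))))
            where
              r' = upd r e (h e)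
              x₀ = base e
              De : D e ≡ true
              De with D e in eq
              ... | true  = refl
              ... | false = ⊥-elim (he (ag e eq))
              agr : AgreeOff D r Q
              agr f Df with mid f
              ... | inj₁ p = p
              ... | inj₂ p = trans p (ag f Df)
              r'e : r' e ≡ not (Q e)
              r'e = trans (upd-at r e (h e)) (¬-not he)
              size' : size (λ f → r' f xor Q f) ≡ suc (size (λ f → r f xor Q f))
              size' = size-step e (trans (cong (_xor Q e) re) (xor-same (Q e)))
                        (trans (cong (_xor Q e) r'e) (not-xor (Q e)))
                        (λ f f≢e → cong (_xor Q f) (sym (upd-off r e (h e) f f≢e)))
                where
                  not-xor : ∀ b → not b xor b ≡ true
                  not-xor true  = refl
                  not-xor false = refl
              B' : suc (B r) ≡ B r'
              B' = trans (sym (Toggle.toggle-merge e r r (λ _ _ → refl)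
                           (subst (λ b → ¬ Reach (Nn e r) x₀ (tr b x₀)) (sym re) (separates agr De x₀ refl))))
                         (Toggle.toggle-same e r r' (upd-off r e (h e))
                           (subst (λ b → Reach (Nn e r) x₀ (tr b x₀)) (sym r'e) (joins agr De x₀ refl)))

      -- An external edge of D closes up inside a component, so it does not affect connectivity.
      components-internal : C h ≡ C (internal h)
      components-internal = K-cong (Cp? h) (Cp? (internal h)) (λ p → flatten p) (Reach-mono weaken)
        where
          weaken : ∀ f b → Cp (internal h) f b → Cp h f b
          weaken f b (inj₁ p) = inj₁ p
          weaken f b (inj₂ p) with h f | Q f
          ... | true  | true  = inj₂ p
          ... | true  | false = inj₁ p
          ... | false | _     = inj₁ p
          agi : AgreeOff D (internal h) Q
          agi f Df rewrite ag f Df = ∧-idem (Q f)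
          flatten₁ : ∀ {x y} → Gen (Cp h) x y → Reach (Cp (internal h)) x y
          flatten₁ (gν x) = gν x ◅ ε
          flatten₁ (gt false x s) = gt false x (inj₁ refl) ◅ ε
          flatten₁ (gt true x (inj₂ s)) with Q (flagEdge x) in Qx | D (flagEdge x) in Dx
          ... | true  | _     = gt true x (inj₂ (trans s (sym (trans (cong (h _ ∧_) Qx) (∧-identityʳ _))))) ◅ ε
          ... | false | true  = Reach-mono (λ _ _ → inj₂ ∘ proj₂)
                                  (subst (λ b → Reach (Nn _ (internal h)) x (tr (not b) x)) Qx (joins agi Dx x refl))
          ... | false | false with trans s (trans (ag _ Dx) Qx)
          ... | ()
          flatten : ∀ {x y} → Reach (Cp h) x y → Reach (Cp (internal h)) x y
          flatten ε = ε
          flatten (g ◅ p) = flatten₁ g ◅◅ flatten p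

    -- The edge set `VI`, the least internal part in the interval of `Q`.
    core : Fin ne → Bool
    core f = Q f ∧ not (D f)

    core-agrees : AgreeOff D core Q
    core-agrees f Df rewrite Df = ∧-identityʳ (Q f)

    -- The edges of `h` in `Io`: the spanning subgraph of the quotient graph that corresponds to
    -- `h`.
    chosen : (Fin ne → Bool) → Fin ne → Bool
    chosen h f = h f ∧ Q f ∧ D f

    -- Checked edge by edge. An edge of `D` in both `h` and `Q` counts twice on the left, as a
    -- switch in `core` and as an element of `h`; this is the origin of the factor 2 in front of the
    -- nullity.
    size-balance : ∀ {h} → AgreeOff D h Q →
                   size (λ f → core f xor Q f) + size h ≡ size (λ f → h f xor Q f) + size core + 2 * size (chosen h)
    size-balance {h} ag = go (allFin ne)
      where
        open +-*-Solver using (solve; con; _:*_; _:+_; _:=_)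
        len : (Fin ne → Bool) → List (Fin ne) → ℕ
        len p l = length (filterᵇ p l)
        go : ∀ l → len (λ f → core f xor Q f) l + len h l ≡ len (λ f → h f xor Q f) l + len core l + 2 * len (chosen h) l
        go [] = refl
        go (f ∷ l) with D f in eD
        ... | true with Q f | h f
        ...   | true  | true  = trans (cong suc (trans (ℕₚ.+-suc _ _) (cong suc (go l))))
                                 (solve 3 (λ a b c → con 2 :+ (a :+ b :+ con 2 :* c) := a :+ b :+ con 2 :* (con 1 :+ c)) refl
                                    (len (λ f → h f xor Q f) l) (len core l) (len (chosen h) l))
        ...   | true  | false = cong suc (go l)
        ...   | false | true  = trans (ℕₚ.+-suc _ _) (cong suc (go l))
        ...   | false | false = go l
        go (f ∷ l) | false with Q f | h f | ag f eD
        ...   | true  | true  | _ = trans (ℕₚ.+-suc _ _) (trans (cong suc (go l))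
                                 (solve 3 (λ a b c → con 1 :+ (a :+ b :+ c) := a :+ (con 1 :+ b) :+ c) refl
                                    (len (λ f → h f xor Q f) l) (len core l) (2 * len (chosen h) l)))
        ...   | false | false | _ = go l

    size-internal : ∀ {h} → AgreeOff D h Q → size (internal h) ≡ size core + size (chosen h)
    size-internal {h} ag = go (allFin ne)
      where
        go : ∀ l → length (filterᵇ (internal h) l) ≡ length (filterᵇ core l) + length (filterᵇ (chosen h) l)
        go [] = refl
        go (f ∷ l) with D f in eD
        ... | true with Q f | h f
        ...   | true  | true  = trans (cong suc (go l)) (sym (ℕₚ.+-suc _ _))
        ...   | true  | false = go l
        ...   | false | true  = go l
        ...   | false | false = go l
        go (f ∷ l) | false with Q f | h f | ag f eD
        ...   | true  | true  | _ = cong suc (go l)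
        ...   | false | false | _ = go l

    -- Guarantees that the subtraction defining the nullity in the quotient graph is not truncated.
    core-bound : ∀ {h} → AgreeOff D h Q → C core ≤ size (chosen h) + C (internal h)
    core-bound {h} ag = ℕₚ.+-cancelʳ-≤ (size core) _ _ (begin
      C core + size core                             ≤⟨ components-bound core (internal h) core≤ ⟩
      C (internal h) + size (internal h)             ≡⟨ cong (C (internal h) +_) (size-internal ag) ⟩
      C (internal h) + (size core + size (chosen h)) ≡⟨ solve 3 (λ a b c → a :+ (b :+ c) := c :+ a :+ b)
                                                           refl (C (internal h)) (size core) (size (chosen h)) ⟩
      size (chosen h) + C (internal h) + size core   ∎)
      where
        open ℕₚ.≤-Reasoning
        open +-*-Solver using (solve; _:+_; _:=_)
        core≤ : ∀ f → core f ≡ true → internal h f ≡ true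
        core≤ f p with D f in eD
        ... | true with trans (sym (∧-zeroʳ (Q f))) p
        ...   | ()
        core≤ f p | false = trans (cong (_∧ Q f) (ag f eD)) (trans (∧-idem (Q f))
                              (trans (sym (∧-identityʳ (Q f))) p))

    module _ {H V : Subset ne} (ag : AgreeOff D (inS H) Q) (V≡core : ∀ f → inS V f ≡ core f) where

      cS-split : cS H ≡ C (internal (inS H)) + iso
      cS-split = trans (cS≡ H) (cong (_+ iso) (components-internal ag))

      -- The bracket is the nullity of the chosen subgraph of the quotient graph, whose vertices
      -- number `cS V`: every independent cycle adds 2 to s.
      sS-split : sS H ≡ 2 * ((size (chosen (inS H)) + (C (internal (inS H)) + iso)) ∸ cS V) + sS V
      sS-split = trans (trans (sS≡ H) (cong (λ c → (2 * (c + iso) + size h) ∸ ((C ∅ + iso) + (B h + iso))) (components-internal ag)))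
        (trans (split-∸ (C ∅ + iso) (B core + iso) (B h + iso) (C core + iso) (C (internal h) + iso) (size core) (size h) (size (chosen h))
                  genus bound balance)
               (sym (cong₂ (λ c s → 2 * ((size (chosen h) + (C (internal h) + iso)) ∸ c) + s) cV sV)))
        where
          open +-*-Solver using (solve; con; _:*_; _:+_; _:=_)
          h = inS H
          cV : cS V ≡ C core + iso
          cV = trans (cS≡ V) (cong (_+ iso) (C-cong V≡core))
          sV : sS V ≡ (2 * (C core + iso) + size core) ∸ ((C ∅ + iso) + (B core + iso))
          sV = trans (sS≡ V) (cong₂ (λ x y → x ∸ ((C ∅ + iso) + (y + iso)))
                 (cong₂ (λ x y → 2 * (x + iso) + y) (C-cong V≡core) (size-cong V≡core)) (B-cong V≡core))
          genus : (C ∅ + iso) + (B core + iso) ≤ 2 * (C core + iso) + size core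
          genus = subst₂ _≤_
            (solve 3 (λ v b i → v :+ b :+ con 2 :* i := (v :+ i) :+ (b :+ i)) refl (C ∅) (B core) iso)
            (solve 3 (λ c k i → con 2 :* c :+ k :+ con 2 :* i := con 2 :* (c :+ i) :+ k) refl (C core) (size core) iso)
            (ℕₚ.+-monoˡ-≤ (2 * iso) (genus-nonneg core))
          bound : C core + iso ≤ size (chosen h) + (C (internal h) + iso)
          bound = ℕₚ.≤-trans (ℕₚ.+-monoˡ-≤ iso (core-bound ag)) (ℕₚ.≤-reflexive (ℕₚ.+-assoc (size (chosen h)) _ iso))
          balance : B core + iso + size h ≡ B h + iso + size core + 2 * size (chosen h)
          balance = trans (cong (λ b → b + iso + size h) (boundary-count core-agrees)) (trans balance'
            (cong (λ b → b + iso + size core + 2 * size (chosen h)) (sym (boundary-count ag))))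
            where
            balance' : B Q + size (λ f → core f xor Q f) + iso + size h ≡
                       B Q + size (λ f → h f xor Q f) + iso + size core + 2 * size (chosen h)
            balance' = trans (solve 4 (λ q d i k → q :+ d :+ i :+ k := q :+ i :+ (d :+ k)) refl
                     (B Q) (size (λ f → core f xor Q f)) iso (size h))
              (trans (cong (B Q + iso +_) (size-balance ag))
                (solve 5 (λ q i d k c → q :+ i :+ (d :+ k :+ con 2 :* c) := q :+ d :+ i :+ k :+ con 2 :* c) refl
                     (B Q) iso (size (λ f → h f xor Q f)) (size core) (size (chosen h))))

-- Partial duality

xor-cancelʳ : ∀ b m → (b xor m) xor m ≡ b
xor-cancelʳ b m = trans (xor-assoc b m m) (trans (cong (b xor_) (xor-same m)) (xor-identityʳ b))

module PartialDual (G : Ribbon) (M : Subset (Ribbon.ne G)) where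
  private
    module A = Cuts G
    module A* = Cuts (partialDual G M)
    σ = swapOn M
  open Ribbon G

  swap-edge : ∀ x → flagEdge (σ x) ≡ flagEdge x
  swap-edge (e , j , i) with inS M e
  ... | true  = refl
  ... | false = refl

  swap-tr : ∀ b x → σ (tr b x) ≡ tr (b xor inS M (flagEdge x)) (σ x)
  swap-tr false (e , j , i) with inS M e
  ... | true  = refl
  ... | false = refl
  swap-tr true (e , j , i) with inS M e
  ... | true  = refl
  ... | false = refl

  module _ {χ : Flag ne → Bool} where

    private
      swap-at : ∀ b x {f} → flagEdge x ≡ f → σ (tr b x) ≡ tr (b xor inS M f) (σ x)
      swap-at b x refl = swap-tr b x

    closedAt-swap : ∀ f b → ClosedAt χ f (b xor inS M f) → ClosedAt (χ ∘ σ) f b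
    closedAt-swap f b cl x x∈f = trans (cong χ (swap-at b x x∈f)) (cl (σ x) (trans (swap-edge x) x∈f))

    flipAt-swap : ∀ f b → FlipAt χ f (b xor inS M f) → FlipAt (χ ∘ σ) f b
    flipAt-swap f b fl x x∈f = trans (cong χ (swap-at b x x∈f)) (fl (σ x) (trans (swap-edge x) x∈f))

    keeps-swap : ∀ e q → ClosedAt χ e (not q) → ClosedAt (χ ∘ σ) e (not (q xor inS M e))
    keeps-swap e q cl = closedAt-swap e (not (q xor inS M e)) (subst (ClosedAt χ e) (sym (not-cancel q (inS M e))) cl)
      where
        not-cancel : ∀ q m → not (q xor m) xor m ≡ not q
        not-cancel q m = trans (cong (_xor m) (not-distribˡ-xor q m)) (xor-cancelʳ (not q) m)

    flips-swap : ∀ e q → FlipAt χ e q → FlipAt (χ ∘ σ) e (q xor inS M e)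
    flips-swap e q fl = flipAt-swap e (q xor inS M e) (subst (FlipAt χ e) (sym (xor-cancelʳ q (inS M e))) fl)

  module _ {S : A.Spec} {S* : A*.Spec} where

    -- Under the swap the state `Q` becomes `Q xor M`. Taking `M = Q` gives the empty state of a
    -- one-vertex graph, taking all edges gives the complement in the dual.
    cut-transfer : (∀ f b → S* f b → S f (b xor inS M f)) → ∀ {e q} → A.Cut S e q → A*.Cut S* e (q xor inS M e)
    cut-transfer h {e} {q} c = record
      { χ = χ ∘ σ ; χ-ν = λ x → trans (cong χ (swapOn-invol M (ν (σ x)))) (χ-ν (σ x))
      ; closed = λ f b f≢e s → closedAt-swap f b (closed f (b xor inS M f) f≢e (h f b s))
      ; keeps = keeps-swap e q keeps ; flips = flips-swap e q flips }
      where open A.Cut c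

    cut-transfer⁻ : (∀ f b → S f b → S* f (b xor inS M f)) → ∀ {e q} → A*.Cut S* e q → A.Cut S e (q xor inS M e)
    cut-transfer⁻ h {e} {q} c = record
      { χ = χ ∘ σ ; χ-ν = λ x → trans (cong (χ ∘ σ ∘ ν) (sym (swapOn-invol M x))) (χ-ν (σ x))
      ; closed = λ f b f≢e s → closedAt-swap f b (closed f (b xor inS M f) f≢e (h f b s))
      ; keeps = keeps-swap e q keeps ; flips = flips-swap e q flips }
      where open A*.Cut c

    reach-transfer : (∀ f b → S f b → S* f (b xor inS M f)) → ∀ {x y} → A.Reach S x y → A*.Reach S* (σ x) (σ y)
    reach-transfer h = gmap σ gen
      where
        gen : ∀ {x y} → A.Gen S x y → A*.Gen S* (σ x) (σ y)
        gen (A.gν x) = subst (A*.Gen S* (σ x)) (cong (σ ∘ ν) (swapOn-invol M x)) (A*.gν (σ x))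
        gen (A.gt b x s) = subst (A*.Gen S* (σ x)) (sym (swap-tr b x))
          (A*.gt (b xor inS M (flagEdge x)) (σ x) (subst (λ f → S* f (b xor inS M (flagEdge x))) (sym (swap-edge x)) (h _ b s)))

-- The quotient graphs

module _ {A : Set} where

  AllPairs-separated : ∀ {P : A → Set} {R : A → A → Set} {xs} → Unique xs → All P xs → (∀ {x y} → P x → P y → R x y → x ≡ y) →
                       AllPairs (λ x y → ¬ R x y) xs
  AllPairs-separated []       []       h = []
  AllPairs-separated {P} {R} (u ∷ us) (p ∷ ps) h = far u ps ∷ AllPairs-separated us ps h
    where
      far : ∀ {ys} → All (_ ≢_) ys → All P ys → All (λ y → ¬ R _ y) ys
      far []       []       = []
      far (n ∷ ns) (q ∷ qs) = (λ r → n (h p q r)) ∷ far ns qs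

module Quotient (G : Ribbon) (V S : Subset (Ribbon.ne G)) where
  open Counts G
  open RibbonInv G using (Fl; ncomp; cS; compEdges; eqb; reach; rep; firstIn; quotGraph)
  open OGraph (quotGraph V S) using (Node; _≟N_; nodes; edges) public
  private
    module N = Conn _≟N_
    open Components _≟N_ using (Path; Path-equiv; module Search)
    Es = compEdges V
    pres = compEdges-present V

  rp : Flag ne → Flag ne
  rp = rep Fl Es

  firstIn-hit : ∀ (p : Flag ne → Bool) {l} d → Any (T ∘ p) l → T (p (firstIn p l d))
  firstIn-hit p {x ∷ l} d a with p x in eq
  ... | true = true⇒T eq
  firstIn-hit p {x ∷ l} d (here t)  | false = ⊥-elim (subst T eq t)
  firstIn-hit p {x ∷ l} d (there a) | false = firstIn-hit p d a

  firstIn-cong : ∀ (p q : Flag ne → Bool) {l} d d' → (∀ x → p x ≡ q x) → Any (T ∘ p) l → firstIn p l d ≡ firstIn q l d'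
  firstIn-cong p q {x ∷ l} d d' h a with p x in eq | q x | h x
  ... | true | true | _ = refl
  firstIn-cong p q {x ∷ l} d d' h (here t)  | false | false | _ = ⊥-elim (subst T eq t)
  firstIn-cong p q {x ∷ l} d d' h (there a) | false | false | _ = firstIn-cong p q d d' h a

  self : ∀ x → Any (T ∘ reach Fl Es x) Fl
  self x = lose (∈-allFlags x) (presented-reach⁻ pres ε)

  rp-reach : ∀ x → Reach (Cp (inS V)) x (rp x)
  rp-reach x = presented-reach pres (firstIn-hit (reach Fl Es x) x (self x))

  -- Equivalent flags reach the same flags, so the first hit in `Fl` is the same for both.
  rp-cong : ∀ {x y} → Reach (Cp (inS V)) x y → rp x ≡ rp y
  rp-cong {x} {y} p = firstIn-cong (reach Fl Es x) (reach Fl Es y) x y same (self x)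
    where
      same : ∀ z → reach Fl Es x z ≡ reach Fl Es y z
      same z with reach Fl Es x z in ex | reach Fl Es y z in ey
      ... | true  | true  = refl
      ... | false | false = refl
      ... | true  | false = ⊥-elim (subst T ey (presented-reach⁻ pres (Reach-sym p ◅◅ presented-reach pres (true⇒T ex))))
      ... | false | true  = ⊥-elim (subst T ex (presented-reach⁻ pres (p ◅◅ presented-reach pres (true⇒T ey))))

  IsNode : Node → Set
  IsNode (inj₁ x) = rp x ≡ x
  IsNode (inj₂ k) = ⊤

  ∈-nodes : ∀ {z} → IsNode z → z ∈ nodes
  ∈-nodes {inj₁ x} h = ∈-++⁺ˡ (∈-map⁺ inj₁ (∈-filterᵇ⁺ _ (∈-allFlags x) (⌊⌋-true (rp x ≟Fl x) h)))
  ∈-nodes {inj₂ k} h = ∈-++⁺ʳ (map inj₁ (filterᵇ (λ x → eqb (rp x) x) Fl)) (∈-map⁺ inj₂ (∈-allFin k))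

  nodes-∈ : ∀ {z} → z ∈ nodes → IsNode z
  nodes-∈ {z} z∈ with ∈-++⁻ (map inj₁ (filterᵇ (λ x → eqb (rp x) x) Fl)) z∈
  ... | inj₁ p with ∈-map⁻ inj₁ p
  ...   | x , x∈ , refl = true-⌊⌋ (rp x ≟Fl x) (proj₂ (∈-filterᵇ⁻ _ {xs = Fl} x∈))
  nodes-∈ {z} z∈ | inj₂ p with ∈-map⁻ inj₂ p
  ...   | k , _ , refl = tt

  nodes-unique : Unique nodes
  nodes-unique = Uniqueₚ.++⁺ (Uniqueₚ.map⁺ (λ { refl → refl }) (Uniqueₚ.filter⁺ _ (allFlags-unique ne)))
    (Uniqueₚ.map⁺ (λ { refl → refl }) (Uniqueₚ.allFin⁺ iso)) disjoint
    where
      disjoint : ∀ {z} → ¬ (z ∈ map inj₁ (filterᵇ (λ x → eqb (rp x) x) Fl) × z ∈ map inj₂ (allFin iso))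
      disjoint (p , q) with ∈-map⁻ inj₁ p | ∈-map⁻ inj₂ q
      ... | _ , _ , refl | _ , _ , ()

  module Lifted (h : Fin ne → Bool) where

    -- Isolated vertices carry no flags, so they are adjoined as singleton classes.
    Same : Node → Node → Set
    Same (inj₁ x) (inj₁ y) = Reach (Cp h) x y
    Same (inj₂ k) (inj₂ l) = k ≡ l
    Same _        _        = ⊥

    Same-equiv : IsEquivalence Same
    Same-equiv = record { refl = λ {z} → r z ; sym = λ {z} {w} → s z w ; trans = λ {z} {w} {u} → t z w u }
      where
        r : ∀ z → Same z z
        r (inj₁ x) = ε
        r (inj₂ k) = refl
        s : ∀ z w → Same z w → Same w z
        s (inj₁ x) (inj₁ y) p = Reach-sym p
        s (inj₂ k) (inj₂ l) p = sym p
        t : ∀ z w u → Same z w → Same w u → Same z u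
        t (inj₁ _) (inj₁ _) (inj₁ _) p q = p ◅◅ q
        t (inj₂ _) (inj₂ _) (inj₂ _) p q = trans p q

    Same-count : Count (λ _ → ⊤) Same (C h + iso)
    Same-count = record
      { reps = map inj₁ c.reps ++ map inj₂ (allFin iso)
      ; size = trans (length-++ (map inj₁ c.reps)) (cong₂ _+_ (trans (length-map inj₁ c.reps) c.size)
                 (trans (length-map inj₂ (allFin iso)) (length-tabulate {n = iso} id)))
      ; valid = All.tabulate (λ _ → tt)
      ; indep = AllPairsₚ.++⁺ (AllPairsₚ.map⁺ c.indep) (AllPairsₚ.map⁺ (Uniqueₚ.allFin⁺ iso))
                  (Allₚ.map⁺ (All.tabulate λ _ → Allₚ.map⁺ (All.tabulate λ _ ())))
      ; cover = λ {z} _ → cov z }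
      where
        module c = Count (K-count (Cp? h))
        cov : ∀ z → Any (Same z) (map inj₁ c.reps ++ map inj₂ (allFin iso))
        cov (inj₁ x) = Anyₚ.++⁺ˡ (Anyₚ.map⁺ (c.cover tt))
        cov (inj₂ k) = Anyₚ.++⁺ʳ (map inj₁ c.reps) (Anyₚ.map⁺ (∈-allFin k))

  length-nodes : length nodes ≡ cS V
  length-nodes = trans (count-≡ Same-equiv Same-equiv nodes-count Same-count (λ _ _ → id) (λ _ _ → id)) (sym (cS≡ V))
    where
      open Lifted (inS V)
      canonical : ∀ {z w} → IsNode z → IsNode w → Same z w → z ≡ w
      canonical {inj₁ x} {inj₁ y} p q r = cong inj₁ (trans (sym p) (trans (rp-cong r) q))
      canonical {inj₂ k} {inj₂ l} p q r = cong inj₂ r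
      cov : ∀ z → Any (Same z) nodes
      cov (inj₁ x) = lose (∈-nodes (sym (rp-cong (rp-reach x)))) (rp-reach x)
      cov (inj₂ k) = lose (∈-nodes {inj₂ k} tt) refl
      nodes-count : Count (λ _ → ⊤) Same (length nodes)
      nodes-count = record
        { reps = nodes ; size = refl ; valid = All.tabulate (λ _ → tt)
        ; indep = AllPairs-separated {P = IsNode} nodes-unique (All.tabulate nodes-∈) (λ {z} {w} → canonical {z} {w})
        ; cover = λ {z} _ → cov z }

  edge : Fin ne → Node × Node
  edge e = inj₁ (rp (e , false , false)) , inj₁ (rp (e , true , false))

  module _ (L : List (Fin ne)) {h : Fin ne → Bool} (V⊆h : ∀ f → inS V f ≡ true → h f ≡ true) (L⊆h : ∀ {f} → f ∈ L → h f ≡ true)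
           (h⊆ : ∀ f → h f ≡ true → inS V f ≡ true ⊎ f ∈ L) where
    private
      open Lifted h
      LE = map edge L
      rp-node : ∀ x → IsNode (inj₁ (rp x))
      rp-node x = sym (rp-cong (rp-reach x))
      ends : ∀ {z w} → (z , w) ∈ LE → z ∈ nodes × w ∈ nodes
      ends p with ∈-map⁻ edge p
      ... | e , _ , refl = ∈-nodes (rp-node (e , false , false)) , ∈-nodes (rp-node (e , true , false))
      module Se = Search {Es = LE} nodes-unique ends

      V⇒h : ∀ {x y} → Reach (Cp (inS V)) x y → Reach (Cp h) x y
      V⇒h = Reach-mono inc
        where
          inc : ∀ f b → Cp (inS V) f b → Cp h f b
          inc f b (inj₁ p) = inj₁ p
          inc f true (inj₂ p) = inj₂ (sym (V⊆h f (sym p)))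
          inc f false (inj₂ p) = inj₁ refl

      module E = IsEquivalence (Path-equiv LE)

      slide : ∀ f j i → rp (f , j , i) ≡ rp (f , j , false)
      slide f j false = refl
      slide f j true  = rp-cong (gt false _ (inj₁ refl) ◅ ε)

      gen⇒path : ∀ {x y} → Gen (Cp h) x y → Path LE (inj₁ (rp x)) (inj₁ (rp y))
      gen⇒path (gν x) = E.reflexive (cong inj₁ (rp-cong (gν x ◅ ε)))
      gen⇒path (gt false x s) = E.reflexive (cong inj₁ (rp-cong (gt false x (inj₁ refl) ◅ ε)))
      gen⇒path (gt true (f , j , i) (inj₂ s)) with h⊆ f (sym s)
      ... | inj₁ v = E.reflexive (cong inj₁ (rp-cong (gt true (f , j , i) (inj₂ (sym v)) ◅ ε)))
      ... | inj₂ l = E.trans (E.reflexive (cong inj₁ (slide f j i)))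
                       (E.trans (hop j) (E.reflexive (cong inj₁ (sym (slide f (not j) i)))))
        where
          hop : ∀ j → Path LE (inj₁ (rp (f , j , false))) (inj₁ (rp (f , not j , false)))
          hop false = inj₁ (∈-map⁺ edge l) ◅ ε
          hop true  = inj₂ (∈-map⁺ edge l) ◅ ε

      reach⇒path : ∀ {x y} → Reach (Cp h) x y → Path LE (inj₁ (rp x)) (inj₁ (rp y))
      reach⇒path ε = ε
      reach⇒path (g ◅ p) = gen⇒path g ◅◅ reach⇒path p

      edge-same : ∀ e → e ∈ L → Same (proj₁ (edge e)) (proj₂ (edge e))
      edge-same e e∈ = Reach-sym (V⇒h (rp-reach (e , false , false))) ◅◅
                       (gt true _ (inj₂ (sym (L⊆h e∈))) ◅ V⇒h (rp-reach (e , true , false)))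

      path⇒same : ∀ {z w} → Path LE z w → Same z w
      path⇒same ε = S.refl
        where module S = IsEquivalence Same-equiv
      path⇒same (inj₁ l ◅ p) with ∈-map⁻ edge l
      ... | e , e∈ , refl = S.trans {_} {proj₂ (edge e)} (edge-same e e∈) (path⇒same p)
        where module S = IsEquivalence Same-equiv
      path⇒same (inj₂ l ◅ p) with ∈-map⁻ edge l
      ... | e , e∈ , refl = S.trans {_} {proj₁ (edge e)} (S.sym {proj₁ (edge e)} {proj₂ (edge e)} (edge-same e e∈)) (path⇒same p)
        where module S = IsEquivalence Same-equiv

      same⇒path : ∀ z w → IsNode z → IsNode w → Same z w → Path LE z w
      same⇒path (inj₁ x) (inj₁ y) p q r = subst₂ (Path LE) (cong inj₁ p) (cong inj₁ q) (reach⇒path r)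
      same⇒path (inj₂ k) (inj₂ l) p q refl = ε

      normal : Node → Node
      normal (inj₁ x) = inj₁ (rp x)
      normal (inj₂ k) = inj₂ k

      normal-same : ∀ z → Same z (normal z)
      normal-same (inj₁ x) = V⇒h (rp-reach x)
      normal-same (inj₂ k) = refl

      normal-node : ∀ z → normal z ∈ nodes
      normal-node (inj₁ x) = ∈-nodes (rp-node x)
      normal-node (inj₂ k) = ∈-nodes {inj₂ k} tt

    -- Contracting the components of F_V preserves connectivity: a walk on the flags of F_h projects
    -- along `rp`, and an edge of the quotient lifts to a long side of its ribbon.
    quotient-components : N.ncomp nodes (map edge L) ≡ C h + iso
    quotient-components = ℕₚ.≤-antisym
      (count-≤ Same-equiv Se.ncomp-count Same-count id (λ _ → tt) (λ {z} {w} p q r → same⇒path z w (nodes-∈ p) (nodes-∈ q) r))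
      (count-≤ (Path-equiv LE) Same-count Se.ncomp-count normal (λ {z} _ → normal-node z)
        (λ {z} {w} _ _ p → S.trans {z} {normal z} {w} (normal-same z)
          (S.trans {normal z} {normal w} {w} (path⇒same p) (S.sym {w} {normal w} (normal-same w)))))
      where module S = IsEquivalence Same-equiv

-- Linking and the boundary walk around the single vertex

module _ {A : Set} where

  iterateL-applyUpTo : ∀ (g : A → A) (h : ℕ → A) → (∀ k → h (suc k) ≡ g (h k)) → ∀ N → iterateL g (h 0) N ≡ applyUpTo h N
  iterateL-applyUpTo g h hs zero    = refl
  iterateL-applyUpTo g h hs (suc N) =
    cong (h 0 ∷_) (trans (cong (λ y → iterateL g y N) (sym (hs 0))) (iterateL-applyUpTo g (h ∘ suc) (hs ∘ suc) N))

  takeWhileᵇ-applyUpTo : ∀ (p : A → Bool) (f : ℕ → A) N → ∃ λ m → takeWhileᵇ p (applyUpTo f N) ≡ applyUpTo f m ×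
                         (∀ {k} → k < m → p (f k) ≡ true) × (m ≡ N ⊎ p (f m) ≡ false)
  takeWhileᵇ-applyUpTo p f zero = 0 , refl , (λ ()) , inj₁ refl
  takeWhileᵇ-applyUpTo p f (suc N) with p (f 0) in eq
  ... | false = 0 , refl , (λ ()) , inj₂ eq
  ... | true with takeWhileᵇ-applyUpTo p (f ∘ suc) N
  ... | m , e , good , stop = suc m , cong (f 0 ∷_) e , good' , stop' stop
    where
      good' : ∀ {k} → k < suc m → p (f k) ≡ true
      good' {zero}  _       = eq
      good' {suc k} (s≤s h) = good h
      stop' : m ≡ N ⊎ p (f (suc m)) ≡ false → suc m ≡ suc N ⊎ p (f (suc m)) ≡ false
      stop' (inj₁ q) = inj₁ (cong suc q)
      stop' (inj₂ q) = inj₂ q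

  unique-constant : ∀ {a : A} {l} → Unique l → a ∈ l → (∀ {z} → z ∈ l → z ≡ a) → length l ≡ 1
  unique-constant {l = _ ∷ []}    _            _ _ = refl
  unique-constant {l = _ ∷ _ ∷ _} ((n ∷ _) ∷ _) _ h = ⊥-elim (n (trans (h (here refl)) (sym (h (there (here refl))))))

module Walk (G : Ribbon) (Q : Subset (Ribbon.ne G)) where
  open QuasiTree G Q public
  open Cuts GQ public

  Total : Spec → Set
  Total S = ∀ x y → Reach S x y

  module _ (total : Total (Bd ∅)) (e : Fin ne) where
    private
      x₀ : Flag ne
      x₀ = base e

      g : Flag ne → Flag ne
      g x = αF (ν x)

      αα : ∀ (x : Flag ne) → αF (αF x) ≡ x
      αα = tr-invol false

    walk : ℕ → Flag ne
    walk zero    = x₀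
    walk (suc k) = g (walk k)

    walk-back : ∀ k → αF (walk (suc k)) ≡ ν (walk k)
    walk-back k = αα (ν (walk k))

    -- Two passages through an arc in opposite directions would close in on each other along the walk.
    no-reversal : ∀ d i → ¬ walk i ≡ αF (walk (d + i))
    no-reversal zero i h = not≢ (sym (cong (proj₂ ∘ proj₂) h))
    no-reversal (suc zero) i h = ν-fpf (walk i) (sym (trans h (walk-back i)))
    no-reversal (suc (suc d)) i h = no-reversal d (suc i)
      (trans (cong αF (trans (cong ν (trans h (walk-back (suc (d + i))))) (ν-invol _))) (cong (αF ∘ walk) (sym (ℕₚ.+-suc d i))))

    -- The walk is reversible, so a repetition can be pulled back to its start.
    rewind : ∀ d i → walk i ≡ walk (d + i) → x₀ ≡ walk d
    rewind d zero h = trans h (cong walk (ℕₚ.+-identityʳ d))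
    rewind d (suc i) h = rewind d i (trans (sym (ν-invol _)) (trans (cong ν (trans (sym (walk-back i))
      (trans (cong αF (trans h (cong walk (ℕₚ.+-suc d i)))) (walk-back (d + i))))) (ν-invol _)))

    -- `walk` lists the flags at which arcs have just been crossed; `ν (walk i)` is the flag from
    -- which the next crossing starts.
    Visited : ℕ → Flag ne → Set
    Visited m y = ∃ λ i → i ≤ m × (y ≡ walk i ⊎ y ≡ ν (walk i))

    private
      f∘walk : ℕ → Fin ne × Bool
      f∘walk k = arcOf (walk (suc k))

      isEnd : Fin ne × Bool → Bool
      isEnd a = not ⌊ ≡-dec _≟F_ _≟B_ a (e , true) ⌋

      arcs≡ : arcsAfter e ≡ applyUpTo f∘walk (2 * ne ∸ 1)
      arcs≡ = trans (cong (map arcOf) (iterateL-applyUpTo g (walk ∘ suc) (λ _ → refl) (2 * ne ∸ 1)))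
        (map-applyUpTo (walk ∘ suc) arcOf (2 * ne ∸ 1))

      initial = takeWhileᵇ-applyUpTo isEnd f∘walk (2 * ne ∸ 1)

    len : ℕ
    len = proj₁ initial

    arcs : List (Fin ne × Bool)
    arcs = applyUpTo f∘walk len

    arcs-between : takeWhileᵇ isEnd (arcsAfter e) ≡ arcs
    arcs-between = trans (cong (takeWhileᵇ isEnd) arcs≡) (proj₁ (proj₂ initial))

    not-end : ∀ {k} → k < len → f∘walk k ≢ (e , true)
    not-end {k} k<len h with trans (sym (proj₁ (proj₂ (proj₂ initial)) k<len))
                             (cong not (⌊⌋-true (≡-dec _≟F_ _≟B_ (f∘walk k) (e , true)) h))
    ... | ()

    -- Otherwise the flags visited so far would form a closed set that misses the second arc of `e`,
    -- contradicting `total`.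
    no-return : ∀ {k} → k < len → walk (suc k) ≢ x₀
    no-return {k} k<len ret = absurd (everywhere (total x₀ (e , true , false)) (0 , z≤n , inj₁ refl))
      where
        closed₁ : ∀ {y z} → Gen (Bd ∅) y z → Visited k y → Visited k z
        closed₁ (gν y) (i , i≤k , inj₁ refl) = i , i≤k , inj₂ refl
        closed₁ (gν y) (i , i≤k , inj₂ refl) = i , i≤k , inj₁ (ν-invol _)
        closed₁ (gt false y _) (zero , _ , inj₁ refl) = k , ℕₚ.≤-refl , inj₂ (trans (cong αF (sym ret)) (walk-back k))
        closed₁ (gt false y _) (suc i , i<k , inj₁ refl) = i , ℕₚ.<⇒≤ i<k , inj₂ (walk-back i)
        closed₁ (gt false y _) (i , i≤k , inj₂ refl) with ℕₚ.m≤n⇒m<n∨m≡n i≤k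
        ... | inj₁ i<k  = suc i , i<k , inj₁ refl
        ... | inj₂ refl = 0 , z≤n , inj₁ ret
        everywhere : ∀ {y z} → Reach (Bd ∅) y z → Visited k y → Visited k z
        everywhere ε v = v
        everywhere (s ◅ p) v = everywhere p (closed₁ s v)
        absurd : ¬ Visited k (e , true , false)
        absurd (suc i , i<k , inj₁ h) = not-end (ℕₚ.<-trans i<k k<len) (sym (cong arcOf h))
        absurd (i , i≤k , inj₂ h) = not-end (ℕₚ.≤-<-trans i≤k k<len) (sym (cong (arcOf ∘ αF) h))

    avoids-e : ∀ {k} → k < len → flagEdge (walk (suc k)) ≢ e
    avoids-e {k} k<len = go (walk (suc k)) refl
      where
        go : ∀ y → walk (suc k) ≡ y → flagEdge y ≢ e
        go (_ , true , i)      eq refl = not-end k<len (cong arcOf eq)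
        go (_ , false , false) eq refl = no-return k<len eq
        go (_ , false , true)  eq refl =
          no-reversal (suc k) 0 (sym (trans (cong (αF ∘ g ∘ walk) (ℕₚ.+-identityʳ k)) (cong αF eq)))

    -- Meeting an arc twice in the same direction rewinds to an early return to `e`; opposite
    -- directions are excluded by `no-reversal`.
    arcs-unique : Unique arcs
    arcs-unique = Uniqueₚ.applyUpTo⁺₁ f∘walk len distinct
      where
        same-arc : ∀ (x y : Flag ne) → arcOf x ≡ arcOf y → x ≡ y ⊎ x ≡ αF y
        same-arc (f , j , false) (_ , _ , false) refl = inj₁ refl
        same-arc (f , j , false) (_ , _ , true)  refl = inj₂ refl
        same-arc (f , j , true)  (_ , _ , false) refl = inj₂ refl
        same-arc (f , j , true)  (_ , _ , true)  refl = inj₁ refl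
        distinct : ∀ {i j} → i < j → j < len → f∘walk i ≢ f∘walk j
        distinct {i} {j} i<j j<len h with ℕₚ.m≤n⇒∃[o]m+o≡n i<j
        ... | d , refl with same-arc (walk (suc i)) (walk (suc (suc (i + d)))) h
        ... | inj₁ eq = avoids-e {d} (ℕₚ.≤-<-trans (ℕₚ.m≤n+m d (suc i)) j<len)
                          (sym (cong flagEdge (rewind (suc d) (suc i) (trans eq (cong walk shift)))))
          where
            shift : suc (suc (i + d)) ≡ suc d + suc i
            shift = cong suc (ℕₚ.+-comm (suc i) d)
        ... | inj₂ eq = no-reversal (suc d) (suc i) (trans eq (cong (αF ∘ walk) (cong suc (ℕₚ.+-comm (suc i) d))))

    -- The arcs met, together with the two arcs of `e`, are distinct among `2 * ne` arcs. Hence the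
    -- walk stops because it meets the second arc of `e`, not because the list in `arcsAfter` runs
    -- out.
    len-bound : len < 2 * ne ∸ 1
    len-bound = ℕₚ.∸-monoˡ-≤ 1 (subst₂ _≤_ (cong (suc ∘ suc) (length-applyUpTo f∘walk len)) all-length
      (unique-⊆-length uniq (λ {a} _ → all-∈ a)))
      where
        allArcs : List (Fin ne × Bool)
        allArcs = map (_, false) (allFin ne) ++ map (_, true) (allFin ne)
        all-∈ : ∀ a → a ∈ allArcs
        all-∈ (f , false) = ∈-++⁺ˡ (∈-map⁺ (_, false) (∈-allFin f))
        all-∈ (f , true)  = ∈-++⁺ʳ (map (_, false) (allFin ne)) (∈-map⁺ (_, true) (∈-allFin f))
        all-length : length allArcs ≡ 2 * ne
        all-length = trans (length-++ (map (_, false) (allFin ne))) (cong₂ _+_ (half false) (trans (half true) (sym (ℕₚ.+-identityʳ ne))))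
          where
            half : ∀ b → length (map (_, b) (allFin ne)) ≡ ne
            half b = trans (length-map (_, b) (allFin ne)) (length-tabulate {n = ne} id)
        fresh : ∀ b → All (λ a → (e , b) ≢ a) arcs
        fresh b = All.tabulate λ a∈ h → let (k , k<len , eq) = ∈-applyUpTo⁻ f∘walk a∈ in
                    avoids-e k<len (sym (cong proj₁ (trans h eq)))
        uniq : Unique ((e , false) ∷ (e , true) ∷ arcs)
        uniq = ((λ ()) ∷ fresh false) ∷ fresh true ∷ arcs-unique

    walk-end : flagEdge (walk (suc len)) ≡ e
    walk-end with proj₂ (proj₂ (proj₂ initial))
    ... | inj₁ full = ⊥-elim (ℕₚ.<⇒≢ len-bound full)
    ... | inj₂ stop = cong proj₁ (true-⌊⌋ (≡-dec _≟F_ _≟B_ (f∘walk len) (e , true)) (trans (sym (not-involutive _)) (cong not stop)))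

    reach-walk : ∀ {k} → k ≤ len → Reach (Nn e ∅) x₀ (walk k)
    reach-walk {zero}  _ = ε
    reach-walk {suc k} k<len = reach-walk (ℕₚ.<⇒≤ k<len) ◅◅ (gν (walk k) ◅ gt false _ (avoids-e k<len , refl) ◅ ε)

    -- Both ends of the visited segment are at `e`, where the transition is cut out, so nothing
    -- leads out of it. The class of `x₀` is thus the stretch of boundary between the two arcs of
    -- `e`.
    reach⇒visited : ∀ {y} → Reach (Nn e ∅) x₀ y → Visited len y
    reach⇒visited p = go p (0 , z≤n , inj₁ refl)
      where
        closed₁ : ∀ {y z} → Gen (Nn e ∅) y z → Visited len y → Visited len z
        closed₁ (gν y) (i , i≤k , inj₁ refl) = i , i≤k , inj₂ refl
        closed₁ (gν y) (i , i≤k , inj₂ refl) = i , i≤k , inj₁ (ν-invol _)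
        closed₁ (gt false y (n , _)) (zero , _ , inj₁ refl) = ⊥-elim (n refl)
        closed₁ (gt false y _) (suc i , i<k , inj₁ refl) = i , ℕₚ.<⇒≤ i<k , inj₂ (walk-back i)
        closed₁ (gt false y (n , _)) (i , i≤k , inj₂ refl) with ℕₚ.m≤n⇒m<n∨m≡n i≤k
        ... | inj₁ i<k  = suc i , i<k , inj₁ refl
        ... | inj₂ refl = ⊥-elim (n walk-end)
        go : ∀ {y z} → Reach (Nn e ∅) y z → Visited len y → Visited len z
        go ε v = v
        go (s ◅ p) v = go p (closed₁ s v)

    reach⇒arc : ∀ {f j i} → f ≢ e → Reach (Nn e ∅) x₀ (f , j , i) → (f , j) ∈ arcs
    reach⇒arc f≢e p with reach⇒visited p
    ... | zero , _ , inj₁ h = ⊥-elim (f≢e (cong proj₁ h))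
    ... | suc k , k<len , inj₁ h = subst (_∈ arcs) (sym (cong arcOf h)) (∈-applyUpTo⁺ f∘walk k<len)
    ... | k , k≤len , inj₂ h with ℕₚ.m≤n⇒m<n∨m≡n k≤len
    ... | inj₁ k<len = subst (_∈ arcs) (sym (cong (arcOf ∘ αF) h)) (∈-applyUpTo⁺ f∘walk k<len)
    ... | inj₂ refl  = ⊥-elim (f≢e (trans (cong proj₁ h) walk-end))

    arc⇒reach : ∀ {f j} i → (f , j) ∈ arcs → Reach (Nn e ∅) x₀ (f , j , i)
    arc⇒reach {f} {j} i a∈ with ∈-applyUpTo⁻ f∘walk a∈
    ... | k , k<len , eq = adjust (walk (suc k)) eq (avoids-e k<len) (reach-walk k<len)
      where
        adjust : ∀ y → (f , j) ≡ arcOf y → flagEdge y ≢ e → Reach (Nn e ∅) x₀ y → Reach (Nn e ∅) x₀ (f , j , i)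
        adjust (_ , _ , i') refl n p with i' ≟B i
        ... | yes refl = p
        ... | no i'≢i  = p ◅◅ subst (λ c → Reach (Nn e ∅) (f , j , i') (f , j , c)) (sym (¬-not (i'≢i ∘ sym))) (gt false _ (n , refl) ◅ ε)

    -- The stretch between the arcs of `e` contains both arcs of `f` or neither, which is what
    -- unlinked means.
    Paired : Fin ne → Set
    Paired f = ∀ j → (f , j) ∈ arcs → (f , not j) ∈ arcs

    private
      between : Fin ne → List (Fin ne × Bool)
      between f = filterᵇ (λ a → ⌊ proj₁ a ≟F f ⌋) arcs

      links≡ : ∀ f → links e f ≡ not ⌊ e ≟F f ⌋ ∧ ⌊ length (between f) ≟ℕ 1 ⌋
      links≡ f = cong (λ l → not ⌊ e ≟F f ⌋ ∧ ⌊ length (filterᵇ (λ a → ⌊ proj₁ a ≟F f ⌋) l) ≟ℕ 1 ⌋) arcs-between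

      ∈-between : ∀ {f j} → (f , j) ∈ arcs → (f , j) ∈ between f
      ∈-between {f} a∈ = ∈-filterᵇ⁺ _ a∈ (⌊⌋-true (f ≟F f) refl)

    unlinked⇒paired : ∀ {f} → f ≢ e → links e f ≡ false → Paired f
    unlinked⇒paired {f} f≢e unl j a∈ with Any.any? (≡-dec _≟F_ _≟B_ (f , not j)) arcs
    ... | yes p = p
    ... | no ¬p = ⊥-elim (contra (trans (sym unl) (trans (links≡ f)
                    (cong₂ _∧_ (cong not (⌊⌋-false (e ≟F f) (f≢e ∘ sym))) (⌊⌋-true (_ ≟ℕ 1) one)))))
      where
        only : ∀ {z} → z ∈ between f → z ≡ (f , j)
        only {f' , j'} z∈ with ∈-filterᵇ⁻ _ {xs = arcs} z∈
        ... | z∈arcs , h with true-⌊⌋ (f' ≟F f) h | j' ≟B j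
        ... | refl | yes refl = refl
        ... | refl | no j'≢j  = ⊥-elim (¬p (subst (λ c → (f , c) ∈ arcs) (¬-not j'≢j) z∈arcs))
        one : length (between f) ≡ 1
        one = unique-constant (Uniqueₚ.filter⁺ _ arcs-unique) (∈-between a∈) only
        contra : ¬ false ≡ true
        contra ()

    paired⇒unlinked : ∀ {f} → Paired f → links e f ≡ false
    paired⇒unlinked {f} pr = trans (links≡ f) (trans (cong (not ⌊ e ≟F f ⌋ ∧_) (⌊⌋-false (_ ≟ℕ 1) notOne)) (∧-zeroʳ _))
      where
        two : ∀ l → length l ≡ 1 → (∀ {a} → a ∈ l → ∃ λ b → b ∈ l × b ≢ a) → ⊥
        two (a ∷ []) _ h with h (here refl)
        ... | b , here b≡a , n = n b≡a
        partner : ∀ {a} → a ∈ between f → ∃ λ b → b ∈ between f × b ≢ a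
        partner {f' , j} a∈ with ∈-filterᵇ⁻ _ {xs = arcs} a∈
        ... | a∈arcs , h with true-⌊⌋ (f' ≟F f) h
        ... | refl = (f , not j) , ∈-between (pr j a∈arcs) , λ eq → not≢ (cong proj₂ eq)
        notOne : ¬ length (between f) ≡ 1
        notOne one = two (between f) one partner

    private
      single : Fin ne → Bool
      single = inS ⁅ e ⁆

      single-at : single e ≡ true
      single-at = []=⇒lookup (x∈⁅x⁆ e)

      single-off : ∀ f → f ≢ e → single f ≡ false
      single-off f f≢e with inS ⁅ e ⁆ f in eq
      ... | true  = ⊥-elim (f≢e (x∈⁅y⁆⇒x≡y e (lookup⇒[]= f ⁅ e ⁆ eq)))
      ... | false = refl

      module T₁ = Toggle e ∅ single single-off
      module T₀ = Toggle e ∅ ∅ (λ _ _ → refl)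

      cut? : ∀ y → Dec (Reach (Nn e ∅) x₀ y)
      cut? = reach? (Nn? e ∅) x₀

    one-vertex : B ∅ ≡ 1
    one-vertex = squeeze (K-count (Bd? ∅))
      where
        squeeze : ∀ {k} → Count (λ _ → ⊤) (Reach (Bd ∅)) k → k ≡ 1
        squeeze record { reps = [] ; cover = cover } with cover {x₀} tt
        ... | ()
        squeeze record { reps = _ ∷ [] ; size = refl } = refl
        squeeze record { reps = x ∷ y ∷ _ ; indep = (n ∷ _) ∷ _ } = ⊥-elim (n (total x y))

    -- An untwisted ribbon: with `e` cut out, the boundary falls into two stretches, and a long side
    -- connects the two ends of the same stretch.
    TwoSided : Set
    TwoSided = Reach (Nn e ∅) x₀ (λF x₀) × ¬ Reach (Nn e ∅) x₀ (αF x₀)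

    module _ (iso≡0 : iso ≡ 0) where
      private
        bc≡ : RibbonInv.bcS GQ ⁅ e ⁆ ≡ B single
        bc≡ = trans (bcS≡ ⁅ e ⁆) (trans (cong (B single +_) iso≡0) (ℕₚ.+-identityʳ _))

      -- With `e` cut out there are 1 or 2 classes by the curve of the empty state, and 2 or 3 by
      -- the two curves of the state `single`. The common value 2 fixes which transition merges
      -- classes.
      orientable⇒ : orientable e ≡ true → TwoSided
      orientable⇒ or = compare (cut? (λF x₀)) (cut? (αF x₀))
        where
          two : B single ≡ 2
          two = trans (sym bc≡) (true-⌊⌋ (_ ≟ℕ 2) or)
          α-joined : Reach (Nn e ∅) x₀ (αF x₀) → K (Nn? e ∅) ≡ 1
          α-joined a = trans (T₀.toggle-same a) one-vertex
          α-apart : ¬ Reach (Nn e ∅) x₀ (αF x₀) → K (Nn? e ∅) ≡ 2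
          α-apart ¬a = trans (T₀.toggle-merge ¬a) (cong suc one-vertex)
          λ-joined : Reach (Nn e ∅) x₀ (λF x₀) → K (Nn? e ∅) ≡ 2
          λ-joined l = trans (T₁.toggle-same (subst (λ c → Reach (Nn e ∅) x₀ (tr c x₀)) (sym single-at) l)) two
          λ-apart : ¬ Reach (Nn e ∅) x₀ (λF x₀) → K (Nn? e ∅) ≡ 3
          λ-apart ¬l = trans (T₁.toggle-merge (subst (λ c → ¬ Reach (Nn e ∅) x₀ (tr c x₀)) (sym single-at) ¬l)) (cong suc two)
          compare : Dec (Reach (Nn e ∅) x₀ (λF x₀)) → Dec (Reach (Nn e ∅) x₀ (αF x₀)) → TwoSided
          compare (yes l) (no ¬a) = l , ¬a
          compare (yes l) (yes a) = ⊥-elim (ℕₚ.<⇒≢ (s≤s (s≤s z≤n)) (trans (sym (α-joined a)) (λ-joined l)))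
          compare (no ¬l) (no ¬a) = ⊥-elim (ℕₚ.<⇒≢ (s≤s (s≤s (s≤s z≤n))) (trans (sym (α-apart ¬a)) (λ-apart ¬l)))
          compare (no ¬l) (yes a) = ⊥-elim (ℕₚ.<⇒≢ (s≤s (s≤s z≤n)) (trans (sym (α-joined a)) (λ-apart ¬l)))

      orientable⇐ : TwoSided → orientable e ≡ true
      orientable⇐ (l , ¬a) = ⌊⌋-true (_ ≟ℕ 2) (trans bc≡ (trans
        (sym (T₁.toggle-same (subst (λ b → Reach (Nn e ∅) x₀ (tr b x₀)) (sym single-at) l)))
        (trans (T₀.toggle-merge ¬a) (cong suc one-vertex))))

      module _ {_≺_ : Rel (Fin ne) 0ℓ} (sto : IsStrictTotalOrder _≡_ _≺_) where
        open WithOrder sto using (live)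
        open IsStrictTotalOrder sto using (_<?_; irrefl)

        live⇒ : live e ≡ true → ∀ f → f ≺ e → links e f ≡ false
        live⇒ lv f f≺e with All.lookup (Allₚ.all⁺ _ (allFin ne) (true⇒T lv)) (∈-allFin f)
        ... | t with links e f
        ...   | false = refl
        ...   | true rewrite ⌊⌋-true (f <? e) f≺e = ⊥-elim t

        live⇐ : (∀ f → f ≺ e → links e f ≡ false) → live e ≡ true
        live⇐ h = T⇒true (Allₚ.all⁻ _ (All.tabulate {xs = allFin ne} λ {f} _ → ok f))
          where
            ok : ∀ f → T (not (⌊ f <? e ⌋ ∧ links e f))
            ok f with f <? e
            ... | no _     = tt
            ... | yes f≺e rewrite h f f≺e = tt

        -- Edges below `e` keep both transitions, the others only the attaching arcs, which in
        -- G^{E(Q)} are the transitions chosen by `Q`.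
        Lower : Spec
        Lower f b = f ≺ e ⊎ b ≡ false

        -- The cut is the stretch of boundary between the arcs of `e`. A lower edge has both arcs in
        -- it or neither, so its long sides do not leave it; orientability provides the behaviour at
        -- `e`.
        live⇒cut : live e ≡ true → orientable e ≡ true → Cut Lower e false
        live⇒cut lv or = record
          { χ = χ
          ; χ-ν = λ x → inv (gν x)
          ; closed = closed
          ; keeps = keepsλ
          ; flips = flipsα }
          where
            χ : Flag ne → Bool
            χ y = ⌊ cut? y ⌋
            inv : Invariant (Nn e ∅) χ
            inv = reach-invariant (Nn? e ∅) x₀
            even : quad χ e ≡ false
            even = Nn-even {r = ∅} inv
            keepsλ : ClosedAt χ e true
            keepsλ = pair-spread χ even true x₀ refl (trans (⌊⌋-true (cut? (λF x₀)) (proj₁ (orientable⇒ or))) (sym (⌊⌋-true (cut? x₀) ε)))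
            closedα : ∀ f → f ≢ e → ClosedAt χ f false
            closedα f f≢e x refl = inv (gt false x (f≢e , refl))
            closed : ∀ f c → f ≢ e → Lower f c → ClosedAt χ f c
            closed f false f≢e _ = closedα f f≢e
            closed f true f≢e (inj₁ f≺e) (_ , j , i) refl =
              dec-⇔ (cut? (f , not j , i)) (cut? (f , j , i))
                (λ p → subst (λ c → Reach (Nn e ∅) x₀ (f , c , i)) (not-involutive j) (arc⇒reach i (paired (not j) (reach⇒arc f≢e p))))
                (λ p → arc⇒reach i (paired j (reach⇒arc f≢e p)))
              where paired = unlinked⇒paired f≢e (live⇒ lv f f≺e)
            χ₀ : χ x₀ ≡ true
            χ₀ = ⌊⌋-true (cut? x₀) ε
            χα : χ (αF x₀) ≡ false
            χα = ⌊⌋-false (cut? (αF x₀)) (proj₂ (orientable⇒ or))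
            χλ : χ (λF x₀) ≡ true
            χλ = trans (keepsλ x₀ refl) χ₀
            χλα : χ (λF (αF x₀)) ≡ false
            χλα = trans (keepsλ (αF x₀) refl) χα
            flipsα : FlipAt χ e false
            flipsα (_ , false , false) refl = trans χα (cong not (sym χ₀))
            flipsα (_ , false , true)  refl = trans χ₀ (cong not (sym χα))
            flipsα (_ , true , false)  refl = trans χλα (cong not (sym χλ))
            flipsα (_ , true , true)   refl = trans χλ (cong not (sym χλα))

        module _ (cut : Cut Lower e false) where
          open Cut cut
          private
            lower∅ : ∀ f → f ≢ e → Lower f false
            lower∅ _ _ = inj₂ refl
            joins : ∀ x → flagEdge x ≡ e → Reach (Nn e ∅) x (λF x)
            joins = cut-joins cut lower∅

          cut⇒orientable : orientable e ≡ true
          cut⇒orientable = orientable⇐ (joins x₀ refl , cut-separates cut lower∅ x₀ refl)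

          -- All flags lie on one curve, and each passage through `e` lands on one of its four
          -- flags, which `joins` places in the class of `x₀` or of `αF x₀`.
          two-sides : ∀ y → Reach (Nn e ∅) x₀ y ⊎ Reach (Nn e ∅) (αF x₀) y
          two-sides y = go (total x₀ y) (inj₁ ε)
            where
              Sides : Flag ne → Set
              Sides y = Reach (Nn e ∅) x₀ y ⊎ Reach (Nn e ∅) (αF x₀) y
              extend : ∀ {y z} → Reach (Nn e ∅) y z → Sides y → Sides z
              extend p (inj₁ q) = inj₁ (q ◅◅ p)
              extend p (inj₂ q) = inj₂ (q ◅◅ p)
              at-e : ∀ j i → Sides (e , j , i)
              at-e false false = inj₁ ε
              at-e false true  = inj₂ ε
              at-e true  false = inj₁ (joins x₀ refl)
              at-e true  true  = inj₂ (joins (αF x₀) refl)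
              step : ∀ {y z} → Gen (Bd ∅) y z → Sides y → Sides z
              step (gν y) s = extend (gν y ◅ ε) s
              step (gt false y _) s with flagEdge y ≟F e
              step (gt false (_ , j , i) _) s | yes refl = at-e j (not i)
              ... | no y∉e = extend (gt false y (y∉e , refl) ◅ ε) s
              go : ∀ {y z} → Reach (Bd ∅) y z → Sides y → Sides z
              go ε s = s
              go (h ◅ p) s = go p (step h s)

          -- If the two arcs of a lower edge were in different stretches, its long side would cross
          -- the cut.
          cut⇒live : live e ≡ true
          cut⇒live = live⇐ λ f f≺e → paired⇒unlinked (paired f f≺e)
            where
              side : ∀ {y} → Reach (Nn e ∅) x₀ y → χ y ≡ χ x₀
              side = invariant-reach (Nn-invariant cut lower∅)
              paired : ∀ f → f ≺ e → Paired f
              paired f f≺e j a∈ with two-sides (f , not j , false)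
              ... | inj₁ p = reach⇒arc (λ f≡e → irrefl f≡e f≺e) p
              ... | inj₂ p = ⊥-elim (not≢ (trans (sym (flips x₀ refl)) (trans (sym (invariant-reach (Nn-invariant cut lower∅) p))
                    (trans (closed f true (λ f≡e → irrefl f≡e f≺e) (inj₁ f≺e) (f , j , false) refl) (side (arc⇒reach false a∈))))))

-- Every edge set lies in the interval of exactly one quasi-tree

-- Closure under `c` carries a single crossing by the opposite transition to the remaining pair.
flip-half : ∀ {n} (χ : Flag n → Bool) e c → ClosedAt χ e c → χ (e , false , false) ≡ true →
            χ (tr (not c) (e , false , false)) ≡ false → FlipAt χ e (not c)
flip-half χ e false cl t f (_ , false , false) refl = trans f (cong not (sym t))
flip-half χ e false cl t f (_ , false , true) refl =
  trans (trans (cl (e , true , false) refl) f) (cong not (sym (trans (cl (e , false , false) refl) t)))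
flip-half χ e false cl t f (_ , true , false) refl = trans t (cong not (sym f))
flip-half χ e false cl t f (_ , true , true) refl =
  trans (trans (cl (e , false , false) refl) t) (cong not (sym (trans (cl (e , true , false) refl) f)))
flip-half χ e true cl t f (_ , false , false) refl = trans f (cong not (sym t))
flip-half χ e true cl t f (_ , true , false) refl =
  trans (trans (cl (e , false , true) refl) f) (cong not (sym (trans (cl (e , false , false) refl) t)))
flip-half χ e true cl t f (_ , false , true) refl = trans t (cong not (sym f))
flip-half χ e true cl t f (_ , true , true) refl =
  trans (trans (cl (e , false , false) refl) t) (cong not (sym (trans (cl (e , false , true) refl) f)))

module Resolution (G : Ribbon) where
  open Cuts G public

  Total : Spec → Set
  Total S = ∀ x y → Reach S x y

  total-mono : ∀ {S S'} → (∀ f b → S f b → S' f b) → Total S → Total S'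
  total-mono h t x y = Reach-mono h (t x y)

  Cut-mono : ∀ {S S' e b} → (∀ f c → f ≢ e → S' f c → S f c) → Cut S e b → Cut S' e b
  Cut-mono h c = record { Cut c ; closed = λ f c' f≢e s → Cut.closed c f c' f≢e (h f c' f≢e s) }

  -- The flags lying in χ and ψ are even in number; at f the four products contribute χ (tr (not q) x) xor χ x.
  crossing : ∀ χ ψ f q → (∀ x → χ (ν x) ≡ χ x) → (∀ x → ψ (ν x) ≡ ψ x) →
             (∀ g → g ≢ f → ∃ λ b → ClosedAt χ g b × ClosedAt ψ g b) →
             ClosedAt χ f q → ClosedAt ψ f (not q) → FlipAt ψ f q → ClosedAt χ f (not q)
  crossing χ ψ f q χν ψν off χq ψq' ψq =
    pair-spread χ (closed-quad χ q χq) (not q) (base f) refl (side q χq ψq' ψq even)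
    where
      x₀ = base f
      φ : Flag ne → Bool
      φ x = χ x ∧ ψ x
      even : quad φ f ≡ false
      even = even-quads φ (λ x → cong₂ _∧_ (χν x) (ψν x)) f λ g g≢f → let (b , c , d) = off g g≢f in
               closed-quad φ b λ x x∈g → cong₂ _∧_ (c x x∈g) (d x x∈g)
      -- `c` and `c'` are the values of `χ` on the two pairs of `q`, and `d` is the value of `ψ` at
      -- the base flag. On each pair `ψ` takes both values, so the sum is `c xor c'`.
      bool₁ : ∀ c c' d → (c ∧ d) xor ((c ∧ not d) xor ((c' ∧ d) xor ((c' ∧ not d) xor false))) ≡ false → c' ≡ c
      bool₁ true  true  _     _ = refl
      bool₁ false false _     _ = refl
      bool₁ true  false true  ()
      bool₁ true  false false ()
      bool₁ false true  true  ()
      bool₁ false true  false ()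
      bool₂ : ∀ c c' d → (c ∧ d) xor ((c' ∧ d) xor ((c ∧ not d) xor ((c' ∧ not d) xor false))) ≡ false → c' ≡ c
      bool₂ true  true  true  _ = refl
      bool₂ true  true  false _ = refl
      bool₂ false false _     _ = refl
      bool₂ true  false true  ()
      bool₂ true  false false ()
      bool₂ false true  true  ()
      bool₂ false true  false ()
      side : ∀ q → ClosedAt χ f q → ClosedAt ψ f (not q) → FlipAt ψ f q → quad φ f ≡ false → χ (tr (not q) x₀) ≡ χ x₀
      side false χα ψλ ψα ev = bool₁ (χ x₀) (χ (λF x₀)) (ψ x₀) (trans (sym (cong (χ x₀ ∧ ψ x₀ xor_) (cong₂ _xor_
          (cong₂ _∧_ (χα x₀ refl) (ψα x₀ refl)) (cong₂ _xor_ (cong (χ (λF x₀) ∧_) (ψλ x₀ refl))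
          (cong (_xor false) (cong₂ _∧_ (χα (λF x₀) refl) (trans (ψλ (αF x₀) refl) (ψα x₀ refl)))))))) ev)
      side true χλ ψα ψλ ev = bool₂ (χ x₀) (χ (αF x₀)) (ψ x₀) (trans (sym (cong (χ x₀ ∧ ψ x₀ xor_) (cong₂ _xor_
          (cong (χ (αF x₀) ∧_) (ψα x₀ refl)) (cong₂ _xor_ (cong₂ _∧_ (χλ x₀ refl) (ψλ x₀ refl))
          (cong (_xor false) (cong₂ _∧_ (χλ (αF x₀) refl) (trans (ψλ (αF x₀) refl) (cong not (ψα x₀ refl))))))))) ev)

  module Ordered {_≺_ : Rel (Fin ne) 0ℓ} (sto : IsStrictTotalOrder _≡_ _≺_) where
    private module O = IsStrictTotalOrder sto

    ≺⇒≢ : ∀ {f g} → f ≺ g → f ≢ g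
    ≺⇒≢ f≺g f≡g = O.irrefl f≡g f≺g

    -- The edges above e are resolved by Q, those below e are left open.
    Ord : (Fin ne → Bool) → Fin ne → Spec
    Ord Q e f b = f ≺ e ⊎ b ≡ Q f

    module _ (Q D : Fin ne → Bool) (cut : ∀ e → D e ≡ true → Cut (Ord Q e) e (Q e)) where

      -- At a higher edge `f` of `D` only the `Q`-transition is known to respect the cut at `e`;
      -- `crossing` with the cut at `f` supplies the other one. Away from `f` the two cuts share a
      -- closed transition: `not (Q e)` at `e`, which the cut at `f` leaves open since `e ≺ f`, and
      -- `Q g` elsewhere.
      cut-system : ∀ e → D e ≡ true → Cut (Loose Q D) e (Q e)
      cut-system e De = record { Cut (cut e De) ; closed = cl }
        where
          open Cut (cut e De) using (χ; χ-ν; closed; keeps)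
          atQ : ∀ f → f ≢ e → ClosedAt χ f (Q f)
          atQ f f≢e = closed f (Q f) f≢e (inj₂ refl)
          above : ∀ f → e ≺ f → D f ≡ true → ClosedAt χ f (not (Q f))
          above f e≺f Df = crossing χ F.χ f (Q f) χ-ν F.χ-ν off (atQ f (≺⇒≢ e≺f ∘ sym)) F.keeps F.flips
            where
              module F = Cut (cut f Df)
              off : ∀ g → g ≢ f → ∃ λ b → ClosedAt χ g b × ClosedAt F.χ g b
              off g g≢f with g ≟F e
              ... | yes refl = not (Q g) , keeps , F.closed g (not (Q g)) g≢f (inj₁ e≺f)
              ... | no g≢e   = Q g , atQ g g≢e , F.closed g _ g≢f (inj₂ refl)
          cl : ∀ f c → f ≢ e → Loose Q D f c → ClosedAt χ f c
          cl f c f≢e (inj₂ c≡Q) = closed f c f≢e (inj₂ c≡Q)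
          cl f c f≢e (inj₁ Df) with O.compare f e
          ... | tri< f≺e _ _ = closed f c f≢e (inj₁ f≺e)
          ... | tri≈ _ f≡e _ = ⊥-elim (f≢e f≡e)
          ... | tri> _ _ e≺f with c ≟B Q f
          ...   | yes c≡Q = closed f c f≢e (inj₂ c≡Q)
          ...   | no c≢Q  = subst (ClosedAt χ f) (sym (¬-not c≢Q)) (above f e≺f Df)

    -- Membership of `h` in the interval of `Q`, with live orientable edges expressed by their cuts.
    Compatible : (h Q : Fin ne → Bool) → Set
    Compatible h Q = ∀ e → Q e ≢ h e → Cut (Ord Q e) e (Q e)

    -- Every transition of `Q'` respects this cut: above `e` it is that of `Q`, at `e` it is the
    -- opposite one, and below `e` both are allowed. So `Q'` cannot form a single curve.
    cut-blocks : ∀ {Q Q'} e → (∀ f → e ≺ f → Q f ≡ Q' f) → Q e ≢ Q' e → Cut (Ord Q e) e (Q e) → ¬ Total (Bd Q')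
    cut-blocks {Q} {Q'} e above Qe≢ c total =
      not≢ (trans (sym (flips (base e) refl)) (invariant-reach inv (total (base e) (tr (Q e) (base e)))))
      where
        open Cut c
        inv : Invariant (Bd Q') χ
        inv (gν x) = χ-ν x
        inv (gt b x s) with O.compare (flagEdge x) e
        ... | tri< x≺e x≢e _ = closed _ b x≢e (inj₁ x≺e) x refl
        ... | tri> _ x≢e e≺x = closed _ b x≢e (inj₂ (trans s (sym (above _ e≺x)))) x refl
        ... | tri≈ _ refl _  = subst (λ b → χ (tr b x) ≡ χ x) (sym (trans s (¬-not (Qe≢ ∘ sym)))) (keeps x refl)

    -- At the highest edge where `Q` and `Q'` differ, one of them also differs from `h`; its cut
    -- there blocks the other.
    compatible-unique : ∀ {h Q Q'} → Total (Bd Q) → Total (Bd Q') → Compatible h Q → Compatible h Q' → ∀ e → Q e ≡ Q' e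
    compatible-unique {h} {Q} {Q'} tQ tQ' cQ cQ' e = go e (spo-noetherian O.isStrictPartialOrder e)
      where
        go : ∀ e → Acc (λ x y → y ≺ x) e → Q e ≡ Q' e
        go e (acc rs) with Q e ≟B Q' e
        ... | yes eq = eq
        ... | no neq with Q e ≟B h e
        ...   | no Qe≢h  = ⊥-elim (cut-blocks e (λ f e≺f → go f (rs e≺f)) neq (cQ e Qe≢h) tQ')
        ...   | yes Qe≡h = ⊥-elim (cut-blocks e (λ f e≺f → sym (go f (rs e≺f))) (neq ∘ sym)
                                     (cQ' e (λ Q'e≡h → neq (trans Qe≡h (sym Q'e≡h)))) tQ)

    Open : List (Fin ne) → (Fin ne → Bool) → Spec
    Open todo q f b = f ∈ todo ⊎ b ≡ q f

    Open? : ∀ todo q → DecSpec (Open todo q)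
    Open? todo q f b = Any.any? (f ≟F_) todo ⊎-dec (b ≟B q f)

    -- The unresolved edges are closed downwards in the order.
    Above : List (Fin ne) → Set
    Above todo = ∀ f → f ∈ todo ⊎ All (_≺ f) todo

    module Step {e t q} (total : Total (Open (e ∷ t) q)) (up : Above (e ∷ t)) where
      private x₀ = base e

      below : ∀ f → f ≺ e → f ∈ t
      below f f≺e with up f
      ... | inj₁ (here refl) = ⊥-elim (O.irrefl refl f≺e)
      ... | inj₁ (there f∈)  = f∈
      ... | inj₂ (e≺f ∷ _)   = ⊥-elim (O.asym f≺e e≺f)

      -- If `c` alone still connects `x₀` to its partner under `not c`, all four flags of `e` stay
      -- together and nothing is lost. Otherwise the class of `x₀` is itself a cut, crossed by
      -- `not c`.
      resolve : ∀ c → Total (Open t (upd q e c)) ⊎ Cut (Ord q e) e (not c)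
      resolve c with reach? (Open? t (upd q e c)) x₀ (tr (not c) x₀)
      ... | yes p = inj₁ λ x y → lift (total x y)
        where
          S' = Open t (upd q e c)
          own : ∀ x → flagEdge x ≡ e → Reach S' x (tr c x)
          own x refl = gt c x (inj₂ (sym (upd-at q e c))) ◅ ε
          hub : ∀ c → (∀ x → flagEdge x ≡ e → Reach S' x (tr c x)) → Reach S' x₀ (tr (not c) x₀) → ∀ j i → Reach S' x₀ (e , j , i)
          hub false o p false false = ε
          hub false o p false true  = o x₀ refl
          hub false o p true  false = p
          hub false o p true  true  = p ◅◅ o (λF x₀) refl
          hub true  o p false false = ε
          hub true  o p true  false = o x₀ refl
          hub true  o p false true  = p
          hub true  o p true  true  = p ◅◅ o (αF x₀) refl
          at-e : ∀ {x y} → flagEdge x ≡ e → flagEdge y ≡ e → Reach S' x y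
          at-e {_ , j , i} {_ , j' , i'} refl refl = Reach-sym (hub c own p j i) ◅◅ hub c own p j' i'
          lift₁ : ∀ {x y} → Gen (Open (e ∷ t) q) x y → Reach S' x y
          lift₁ (gν x) = gν x ◅ ε
          lift₁ (gt b x s) with flagEdge x ≟F e
          ... | yes x∈e = at-e x∈e (trans (tr-edge b x) x∈e)
          ... | no x∉e with s
          ...   | inj₁ (here x∈e)  = ⊥-elim (x∉e x∈e)
          ...   | inj₁ (there x∈t) = gt b x (inj₁ x∈t) ◅ ε
          ...   | inj₂ b≡          = gt b x (inj₂ (trans b≡ (sym (upd-off q e c _ x∉e)))) ◅ ε
          lift : ∀ {x y} → Reach (Open (e ∷ t) q) x y → Reach S' x y
          lift ε       = ε
          lift (g ◅ p) = lift₁ g ◅◅ lift p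
      ... | no ¬p = inj₂ record
        { χ = χ ; χ-ν = λ x → inv (gν x) ; closed = closed ; keeps = subst (ClosedAt χ e) (sym (not-involutive c)) own
        ; flips = flip-half χ e c own (⌊⌋-true (R? x₀) ε) (⌊⌋-false (R? (tr (not c) x₀)) ¬p) }
        where
          R? = reach? (Open? t (upd q e c)) x₀
          χ : Flag ne → Bool
          χ y = ⌊ R? y ⌋
          inv : Invariant (Open t (upd q e c)) χ
          inv = reach-invariant (Open? t (upd q e c)) x₀
          own : ClosedAt χ e c
          own x refl = inv (gt c x (inj₂ (sym (upd-at q e c))))
          closed : ∀ f b → f ≢ e → Ord q e f b → ClosedAt χ f b
          closed f b f≢e (inj₁ f≺e) x refl = inv (gt b x (inj₁ (below f f≺e)))
          closed f b f≢e (inj₂ b≡) x refl = inv (gt b x (inj₂ (trans b≡ (sym (upd-off q e c f f≢e)))))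

      -- By `crossing`, a cut crossed by `c` would force the one crossed by `not c` to be closed
      -- under `not c`. Hence at least one transition at `e` can always be chosen.
      cuts-exclude : ∀ {c} → Cut (Ord q e) e c → ¬ Cut (Ord q e) e (not c)
      cuts-exclude {c} C₁ C₂ = not≢ (trans (sym (C₂.flips (base e) refl)) (closes (base e) refl))
        where
          module C₁ = Cut C₁
          module C₂ = Cut C₂
          closes : ClosedAt C₂.χ e (not c)
          closes = crossing C₂.χ C₁.χ e c C₂.χ-ν C₁.χ-ν (λ g g≢e → q g , C₂.closed g _ g≢e (inj₂ refl) , C₁.closed g _ g≢e (inj₂ refl))
                     (subst (ClosedAt C₂.χ e) (not-involutive c) C₂.keeps) C₁.keeps C₁.flips

    -- The invariant is that the open state connects all flags: with every edge open this is
    -- connectedness, with none open it says that there is a single curve. A departure from `h`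
    -- happens only where `resolve` has produced a cut.
    compatible-exists : Total (λ _ _ → ⊤) → ∀ h → ∃ λ Q → Total (Bd Q) × Compatible h Q
    compatible-exists total h = finish (process order h sorted (λ f → inj₁ (complete f)) start (λ f f∉ → ⊥-elim (f∉ (complete f))))
      where
        Done : List (Fin ne) → (Fin ne → Bool) → Set
        Done todo q = ∀ f → f ∉ todo → q f ≢ h f → Cut (Ord q f) f (q f)

        S : StrictTotalOrder 0ℓ 0ℓ 0ℓ
        S = record { isStrictTotalOrder = Flip.isStrictTotalOrder sto }
        module Srt = Sort (STO.decTotalOrder S)
        order : List (Fin ne)
        order = Srt.sort (allFin ne)
        complete : ∀ f → f ∈ order
        complete f = ∈-resp-↭ (↭-sym (Srt.sort-↭ (allFin ne))) (∈-allFin f)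
        start : Total (Open order h)
        start = total-mono (λ f _ _ → inj₁ (complete f)) total
        sorted : AllPairs (λ a b → b ≺ a) order
        sorted = AllPairs.zipWith strict (Sortedₚ.Sorted⇒AllPairs (STO.totalOrder S) (Srt.sort-↗ (allFin ne)) ,
            ↭ₛ.AllPairs-resp-↭ (Relation.Binary.PropositionalEquality.setoid (Fin ne)) ≢-sym (resp₂ _≢_)
              (↭⇒↭ₛ (↭-sym (Srt.sort-↭ (allFin ne)))) (Uniqueₚ.allFin⁺ ne))
          where
            strict : ∀ {a b} → (b ≺ a ⊎ a ≡ b) × a ≢ b → b ≺ a
            strict (inj₁ p , _) = p
            strict (inj₂ p , n) = ⊥-elim (n p)

        process : ∀ todo q → AllPairs (λ a b → b ≺ a) todo → Above todo → Total (Open todo q) → Done todo q →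
                  ∃ λ q' → Total (Open [] q') × Done [] q'
        process []      q _ _ tot done = q , tot , done
        process (e ∷ t) q (e≻ ∷ srt) up tot done = choose (resolve (h e))
          where
            open Step tot up
            up' : Above t
            up' f with up f
            ... | inj₁ (here refl) = inj₂ e≻
            ... | inj₁ (there f∈)  = inj₁ f∈
            ... | inj₂ (_ ∷ a)     = inj₂ a
            advance : ∀ c → Total (Open t (upd q e c)) → (c ≢ h e → Cut (Ord q e) e c) → ∃ λ q' → Total (Open [] q') × Done [] q'
            advance c tot' cut = process t (upd q e c) srt up' tot' done'
              where
                done' : Done t (upd q e c)
                done' f f∉t neq with f ≟F e
                ... | yes refl = Cut-mono (λ { g b g≢e (inj₁ p) → inj₁ p
                                            ; g b g≢e (inj₂ p) → inj₂ (trans p (upd-off q e c g g≢e)) }) (cut neq)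
                ... | no f≢e = Cut-mono weaken (done f f∉ neq)
                  where
                    f∉ : f ∉ e ∷ t
                    f∉ (here f≡e) = f≢e f≡e
                    f∉ (there f∈) = f∉t f∈
                    e≺f : e ≺ f
                    e≺f with up f
                    ... | inj₁ f∈      = ⊥-elim (f∉ f∈)
                    ... | inj₂ (p ∷ _) = p
                    weaken : ∀ g b → g ≢ f → Ord (upd q e c) f g b → Ord q f g b
                    weaken g b _ (inj₁ p) = inj₁ p
                    weaken g b _ (inj₂ p) with g ≟F e
                    ... | yes refl = inj₁ e≺f
                    ... | no g≢e   = inj₂ p
            choose : Total (Open t (upd q e (h e))) ⊎ Cut (Ord q e) e (not (h e)) → ∃ λ q' → Total (Open [] q') × Done [] q'
            choose (inj₁ tot') = advance (h e) tot' (λ n → ⊥-elim (n refl))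
            choose (inj₂ cut) with resolve (not (h e))
            ... | inj₁ tot' = advance (not (h e)) tot' (λ _ → cut)
            ... | inj₂ cut' = ⊥-elim (cuts-exclude {not (h e)} cut cut')

        finish : (∃ λ q' → Total (Open [] q') × Done [] q') → ∃ λ Q → Total (Bd Q) × Compatible h Q
        finish (q , tot , done) = q , total-mono (λ { f b (inj₂ p) → p }) tot , λ e → done e (λ ())

-- Sums over edge sets

filterᵇ-cong : ∀ {A : Set} {p q : A → Bool} → (∀ x → p x ≡ q x) → ∀ l → filterᵇ p l ≡ filterᵇ q l
filterᵇ-cong h []      = refl
filterᵇ-cong {p = p} {q} h (x ∷ l) with p x | q x | h x
... | true  | true  | _ = cong (x ∷_) (filterᵇ-cong h l)
... | false | false | _ = filterᵇ-cong h l

sublists-map : ∀ {A B : Set} (g : A → B) l → sublists (map g l) ≡ map (map g) (sublists l)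
sublists-map g []      = refl
sublists-map g (x ∷ l) rewrite sublists-map g l | map-++ (map g) (sublists l) (map (x ∷_) (sublists l)) =
  cong (map (map g) (sublists l) ++_) (trans (sym (map-∘ (sublists l))) (map-∘ (sublists l)))

-- Agreement off `D` as a Boolean, by recursion on the vectors so as to match `allSubsets`.
fits : ∀ {n} → Subset n → Subset n → Subset n → Bool
fits []      []      []      = true
fits (d ∷ D) (q ∷ Q) (h ∷ H) = (d ∨ not (q xor h)) ∧ fits D Q H

fits⇒agree : ∀ {n} (D Q H : Subset n) → fits D Q H ≡ true → ∀ f → inS D f ≡ false → inS H f ≡ inS Q f
fits⇒agree (false ∷ D) (true ∷ Q)  (true ∷ H)  h Fin.zero _ = refl
fits⇒agree (false ∷ D) (false ∷ Q) (false ∷ H) h Fin.zero _ = refl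
fits⇒agree (d ∷ D) (q ∷ Q) (b ∷ H) h (Fin.suc f) = fits⇒agree D Q H (T⇒true (proj₂ (Equivalence.to T-∧ (true⇒T h)))) f

agree⇒fits : ∀ {n} (D Q H : Subset n) → (∀ f → inS D f ≡ false → inS H f ≡ inS Q f) → fits D Q H ≡ true
agree⇒fits [] [] [] h = refl
agree⇒fits (true ∷ D) (q ∷ Q) (b ∷ H) h = agree⇒fits D Q H (h ∘ Fin.suc)
agree⇒fits (false ∷ D) (q ∷ Q) (b ∷ H) h rewrite h Fin.zero refl | xor-same q = agree⇒fits D Q H (h ∘ Fin.suc)

∈-allSubsets : ∀ {n} (H : Subset n) → H ∈ allSubsets n
∈-allSubsets []          = here refl
∈-allSubsets (true ∷ H)  = ∈-++⁺ˡ (∈-map⁺ (true ∷_) (∈-allSubsets H))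
∈-allSubsets (false ∷ H) = ∈-++⁺ʳ (map (true ∷_) (allSubsets _)) (∈-map⁺ (false ∷_) (∈-allSubsets H))

allSubsets-unique : ∀ n → Unique (allSubsets n)
allSubsets-unique zero    = [] ∷ []
allSubsets-unique (suc n) = Uniqueₚ.++⁺ (Uniqueₚ.map⁺ (λ { refl → refl }) (allSubsets-unique n))
  (Uniqueₚ.map⁺ (λ { refl → refl }) (allSubsets-unique n)) disjoint
  where
    disjoint : ∀ {H} → ¬ (H ∈ map (true ∷_) (allSubsets n) × H ∈ map (false ∷_) (allSubsets n))
    disjoint (p , q) with ∈-map⁻ (true ∷_) p | ∈-map⁻ (false ∷_) q
    ... | _ , _ , refl | _ , _ , ()

chosenᵥ : ∀ {n} → Subset n → Subset n → Subset n → Subset n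
chosenᵥ D Q H = zipWith _∧_ H (zipWith _∧_ Q D)

module Sums {c ℓ} (R : CommutativeRing c ℓ) where
  open CommutativeRing R renaming (Carrier to 𝕂; refl to ≈-refl; sym to ≈-sym; trans to ≈-trans; _+_ to _⊕_; _*_ to _⊗_)
  open RingOps R
  open import Relation.Binary.Reasoning.Setoid setoid

  Σ[_]_ : {A : Set} → List A → (A → 𝕂) → 𝕂
  Σ[ l ] f = sumR (map f l)

  when : Bool → 𝕂 → 𝕂
  when b x = if b then x else 0#

  module _ {A : Set} where

    Σ-cong : ∀ {f g : A → 𝕂} l → (∀ {x} → x ∈ l → f x ≈ g x) → Σ[ l ] f ≈ Σ[ l ] g
    Σ-cong []      h = ≈-refl
    Σ-cong (x ∷ l) h = +-cong (h (here refl)) (Σ-cong l (h ∘ there))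

    Σ-zero : ∀ l {f : A → 𝕂} → (∀ {x} → x ∈ l → f x ≈ 0#) → Σ[ l ] f ≈ 0#
    Σ-zero []      h = ≈-refl
    Σ-zero (x ∷ l) h = ≈-trans (+-cong (h (here refl)) (Σ-zero l (h ∘ there))) (+-identityˡ 0#)

    Σ-++ : ∀ (f : A → 𝕂) l m → Σ[ l ++ m ] f ≈ (Σ[ l ] f) ⊕ (Σ[ m ] f)
    Σ-++ f []      m = ≈-sym (+-identityˡ _)
    Σ-++ f (x ∷ l) m = ≈-trans (+-congˡ (Σ-++ f l m)) (≈-sym (+-assoc _ _ _))

    Σ-map : ∀ {B : Set} (f : B → 𝕂) (g : A → B) l → Σ[ map g l ] f ≈ Σ[ l ] (f ∘ g)
    Σ-map f g l = reflexive (cong sumR (sym (map-∘ l)))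

    Σ-+ : ∀ (f g : A → 𝕂) l → Σ[ l ] (λ x → f x ⊕ g x) ≈ (Σ[ l ] f) ⊕ (Σ[ l ] g)
    Σ-+ f g []      = ≈-sym (+-identityˡ 0#)
    Σ-+ f g (x ∷ l) = begin
      (f x ⊕ g x) ⊕ (Σ[ l ] (λ x → f x ⊕ g x))       ≈⟨ +-congˡ (Σ-+ f g l) ⟩
      (f x ⊕ g x) ⊕ ((Σ[ l ] f) ⊕ (Σ[ l ] g))         ≈⟨ +-assoc _ _ _ ⟩
      f x ⊕ (g x ⊕ ((Σ[ l ] f) ⊕ (Σ[ l ] g)))         ≈⟨ +-congˡ (≈-sym (+-assoc _ _ _)) ⟩
      f x ⊕ ((g x ⊕ (Σ[ l ] f)) ⊕ (Σ[ l ] g))         ≈⟨ +-congˡ (+-congʳ (+-comm _ _)) ⟩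
      f x ⊕ (((Σ[ l ] f) ⊕ g x) ⊕ (Σ[ l ] g))         ≈⟨ +-congˡ (+-assoc _ _ _) ⟩
      f x ⊕ ((Σ[ l ] f) ⊕ (g x ⊕ (Σ[ l ] g)))         ≈⟨ ≈-sym (+-assoc _ _ _) ⟩
      (f x ⊕ (Σ[ l ] f)) ⊕ (g x ⊕ (Σ[ l ] g))         ∎

    Σ-*ʳ : ∀ (f : A → 𝕂) k l → Σ[ l ] (λ x → f x ⊗ k) ≈ (Σ[ l ] f) ⊗ k
    Σ-*ʳ f k []      = ≈-sym (zeroˡ k)
    Σ-*ʳ f k (x ∷ l) = ≈-trans (+-congˡ (Σ-*ʳ f k l)) (≈-sym (distribʳ k _ _))

  module _ {A : Set} where

    Σ-swap : ∀ {B : Set} (f : A → B → 𝕂) l m → Σ[ l ] (λ x → Σ[ m ] (f x)) ≈ Σ[ m ] (λ y → Σ[ l ] (λ x → f x y))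
    Σ-swap f []      m = ≈-sym (Σ-zero m (λ _ → ≈-refl))
    Σ-swap f (x ∷ l) m = ≈-trans (+-congˡ (Σ-swap f l m)) (≈-sym (Σ-+ (f x) (λ y → Σ[ l ] (λ x → f x y)) m))

    Σ-single : ∀ (p : A → Bool) k {x l} → Unique l → x ∈ l → p x ≡ true → (∀ {y} → y ∈ l → p y ≡ true → y ≡ x) →
               Σ[ l ] (λ y → when (p y) k) ≈ k
    Σ-single p k {x} {_ ∷ l} (u ∷ _) (here refl) px only rewrite px = ≈-trans (+-congˡ (Σ-zero l off)) (+-identityʳ k)
      where
        off : ∀ {y} → y ∈ l → when (p y) k ≈ 0#
        off {y} y∈ with p y in py
        ... | true  = ⊥-elim (All.lookup u y∈ (sym (only (there y∈) py)))
        ... | false = ≈-refl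
    Σ-single p k {x} {z ∷ l} (u ∷ us) (there x∈) px only with p z in pz
    ... | true  = ⊥-elim (All.lookup u x∈ (only (here refl) pz))
    ... | false = ≈-trans (+-identityˡ _) (Σ-single p k us x∈ px (only ∘ there))

  Σ-regroup : ∀ {A B : Set} (l : List A) (m : List B) (p : B → A → Bool) (t : A → 𝕂) (u : B → 𝕂) → Unique m →
              (∀ x → ∃ λ y → y ∈ m × p y x ≡ true) → (∀ x {y y'} → y ∈ m → y' ∈ m → p y x ≡ true → p y' x ≡ true → y ≡ y') →
              (∀ {y} → y ∈ m → u y ≈ Σ[ l ] (λ x → when (p y x) (t x))) → Σ[ l ] t ≈ Σ[ m ] u
  Σ-regroup l m p t u uniq hit only grouped = begin
    Σ[ l ] t                                           ≈⟨ Σ-cong l (λ {x} _ → ≈-sym (once x)) ⟩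
    Σ[ l ] (λ x → Σ[ m ] (λ y → when (p y x) (t x)))   ≈⟨ ≈-sym (Σ-swap (λ y x → when (p y x) (t x)) m l) ⟩
    Σ[ m ] (λ y → Σ[ l ] (λ x → when (p y x) (t x)))   ≈⟨ Σ-cong m (λ y∈ → ≈-sym (grouped y∈)) ⟩
    Σ[ m ] u                                           ∎
    where
      once : ∀ x → Σ[ m ] (λ y → when (p y x) (t x)) ≈ t x
      once x with hit x
      ... | y , y∈ , py = Σ-single (λ y → p y x) (t x) uniq y∈ py (λ y'∈ py' → only x y'∈ y∈ py' py)

  -- A member of the interval amounts to independent choices on the internal and on the external
  -- edges of `D`, so the sum factorises. An external edge is chosen when it is absent from `H`,
  -- because the dual side uses the complement.
  Σ-interval : ∀ {n} (D Q : Subset n) (F G : List (Fin n) → 𝕂) →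
    Σ[ allSubsets n ] (λ H → when (fits D Q H) (F (pick (chosenᵥ D Q H)) ⊗ G (pick (chosenᵥ D (∁ Q) (∁ H))))) ≈
    (Σ[ sublists (pick (zipWith _∧_ Q D)) ] F) ⊗ (Σ[ sublists (pick (zipWith _∧_ (∁ Q) D)) ] G)
  Σ-interval [] [] F G = ≈-trans (+-identityʳ _) (*-cong (≈-sym (+-identityʳ _)) (≈-sym (+-identityʳ _)))
  Σ-interval {suc n} (d ∷ D) (q ∷ Q) F G = ≈-trans (≈-trans (Σ-++ _ (map (true ∷_) (allSubsets n)) _)
      (+-cong (Σ-map _ (true ∷_) (allSubsets n)) (Σ-map _ (false ∷_) (allSubsets n)))) (cases d q)
    where
      Skip Take : (List (Fin (suc n)) → 𝕂) → List (Fin n) → 𝕂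
      Skip F L = F (map Fin.suc L)
      Take F L = F (Fin.zero ∷ map Fin.suc L)
      skip : ∀ F (P : List (Fin n)) → Σ[ sublists (map Fin.suc P) ] F ≈ Σ[ sublists P ] (Skip F)
      skip F P = ≈-trans (reflexive (cong (λ l → sumR (map F l)) (sublists-map Fin.suc P))) (Σ-map F (map Fin.suc) (sublists P))
      take : ∀ F (P : List (Fin n)) → Σ[ sublists (Fin.zero ∷ map Fin.suc P) ] F ≈ (Σ[ sublists P ] (Skip F)) ⊕ (Σ[ sublists P ] (Take F))
      take F P = ≈-trans (Σ-++ F (sublists (map Fin.suc P)) _) (+-cong (skip F P)
        (≈-trans (Σ-map F (Fin.zero ∷_) (sublists (map Fin.suc P))) (skip (F ∘ (Fin.zero ∷_)) P)))
      IH = Σ-interval D Q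
      I = pick (zipWith _∧_ Q D)
      E = pick (zipWith _∧_ (∁ Q) D)
      term : Bool → Bool → Bool → Subset n → 𝕂
      term d q h H = when (fits (d ∷ D) (q ∷ Q) (h ∷ H))
        (F (pick (chosenᵥ (d ∷ D) (q ∷ Q) (h ∷ H))) ⊗ G (pick (chosenᵥ (d ∷ D) (∁ (q ∷ Q)) (∁ (h ∷ H)))))
      none : Σ[ allSubsets n ] (λ _ → 0#) ≈ 0#
      none = Σ-zero (allSubsets n) (λ _ → ≈-refl)
      cases : ∀ d q → (Σ[ allSubsets n ] (term d q true)) ⊕ (Σ[ allSubsets n ] (term d q false)) ≈
              (Σ[ sublists (pick (zipWith _∧_ (q ∷ Q) (d ∷ D))) ] F) ⊗ (Σ[ sublists (pick (zipWith _∧_ (∁ (q ∷ Q)) (d ∷ D))) ] G)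
      cases false true = ≈-trans (+-cong (IH (Skip F) (Skip G)) none)
        (≈-trans (+-identityʳ _) (*-cong (≈-sym (skip F I)) (≈-sym (skip G E))))
      cases false false = ≈-trans (+-cong none (IH (Skip F) (Skip G)))
        (≈-trans (+-identityˡ _) (*-cong (≈-sym (skip F I)) (≈-sym (skip G E))))
      cases true true = ≈-trans (+-cong (IH (Take F) (Skip G)) (IH (Skip F) (Skip G)))
        (≈-trans (+-comm _ _) (≈-trans (≈-sym (distribʳ _ _ _)) (*-cong (≈-sym (take F I)) (≈-sym (skip G E)))))
      cases true false = ≈-trans (+-cong (IH (Skip F) (Skip G)) (IH (Skip F) (Take G)))
        (≈-trans (≈-sym (distribˡ _ _ _)) (*-cong (≈-sym (skip F I)) (≈-sym (take G E))))

  pow-+ : ∀ x m n → pow x (m + n) ≈ pow x m ⊗ pow x n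
  pow-+ x zero    n = ≈-sym (*-identityˡ _)
  pow-+ x (suc m) n = ≈-trans (*-congˡ (pow-+ x m n)) (≈-sym (*-assoc _ _ _))

  pow-square : ∀ x d → pow (x ⊗ x) d ≈ pow x (2 * d)
  pow-square x zero    = ≈-refl
  pow-square x (suc d) = ≈-trans (*-congˡ (pow-square x d)) (≈-trans (*-assoc _ _ _)
    (*-congˡ (reflexive (cong (pow x) (sym (ℕₚ.+-suc d (d + 0)))))))

  Σ-interval-scaled : ∀ {n} (D Q : Subset n) (F G : List (Fin n) → 𝕂) (p q : 𝕂) (t : Subset n → 𝕂) →
    (∀ H → fits D Q H ≡ true → F (pick (chosenᵥ D Q H)) ⊗ G (pick (chosenᵥ D (∁ Q) (∁ H))) ⊗ p ⊗ q ≈ t H) →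
    (Σ[ sublists (pick (zipWith _∧_ Q D)) ] F) ⊗ (Σ[ sublists (pick (zipWith _∧_ (∁ Q) D)) ] G) ⊗ p ⊗ q ≈
    Σ[ allSubsets n ] (λ H → when (fits D Q H) (t H))
  Σ-interval-scaled {n} D Q F G p q t h = begin
    _ ≈⟨ *-congʳ (*-congʳ (≈-sym (Σ-interval D Q F G))) ⟩
    (Σ[ allSubsets n ] part) ⊗ p ⊗ q                   ≈⟨ *-assoc _ _ _ ⟩
    (Σ[ allSubsets n ] part) ⊗ (p ⊗ q)                 ≈⟨ ≈-sym (Σ-*ʳ part _ (allSubsets n)) ⟩
    Σ[ allSubsets n ] (λ H → part H ⊗ (p ⊗ q))         ≈⟨ Σ-cong (allSubsets n) (λ {H} _ → each H) ⟩
    Σ[ allSubsets n ] (λ H → when (fits D Q H) (t H))  ∎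
    where
      part : Subset n → 𝕂
      part H = when (fits D Q H) (F (pick (chosenᵥ D Q H)) ⊗ G (pick (chosenᵥ D (∁ Q) (∁ H))))
      each : ∀ H → part H ⊗ (p ⊗ q) ≈ when (fits D Q H) (t H)
      each H with fits D Q H in ft
      ... | false = zeroˡ _
      ... | true  = ≈-trans (≈-sym (*-assoc _ _ _)) (h H ft)

  tutteTerm : (H : OGraph) → 𝕂 → 𝕂 → List (OGraph.Node H × OGraph.Node H) → 𝕂
  tutteTerm H x y S = pow x (ncomp nodes S ∸ ncomp nodes edges) ⊗ pow y ((length S + ncomp nodes S) ∸ length nodes)
    where
      open OGraph H
      open Conn _≟N_

  tutte-reindex : ∀ {E : Set} (H : OGraph) x y (g : E → OGraph.Node H × OGraph.Node H) l l' → OGraph.edges H ≡ map g l → l ≡ l' →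
                  tutte H x y ≈ Σ[ sublists l' ] (tutteTerm H x y ∘ map g)
  tutte-reindex H x y g l .l eq refl = ≈-trans
    (reflexive (cong (λ k → Σ[ k ] (tutteTerm H x y)) (trans (cong sublists eq) (sublists-map g l))))
    (Σ-map (tutteTerm H x y) (map g) (sublists l))

∧-true : ∀ {a b} → a ∧ b ≡ true → a ≡ true × b ≡ true
∧-true h with Equivalence.to T-∧ (true⇒T h)
... | p , q = T⇒true p , T⇒true q

-- The contribution of an edge set in the interval of a quasi-tree

module Exponents (G : Ribbon) (Q V S : Subset (Ribbon.ne G)) (D : Fin (Ribbon.ne G) → Bool)
                 (cut : ∀ e → D e ≡ true → Cuts.Cut G (Cuts.Loose G (inS Q) D) e (inS Q e))
                 (total : ∀ x y → Counts.Reach G (Counts.Bd G (inS Q)) x y)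
                 (V≡ : ∀ f → inS V f ≡ inS Q f ∧ not (D f)) (S≡ : ∀ f → inS S f ≡ inS Q f ∧ D f) where
  open Cuts G
  open CutSystem (inS Q) D cut
  open Quotient G V S public using (nodes; edges; edge; length-nodes)
  open Quotient G V S using (quotient-components; _≟N_)
  open RibbonInv G using (cS; sS; cG)
  open Conn _≟N_ public using () renaming (ncomp to ncompN)

  private
    split : ∀ f {h : Fin ne → Bool} → h f ∧ inS Q f ≡ true → inS V f ≡ true ⊎ h f ∧ inS Q f ∧ D f ≡ true
    split f {h} p with ∧-true {h f} p | D f in Df
    ... | hf , Qf | true  = inj₂ (cong₂ _∧_ hf (cong (_∧ true) Qf))
    ... | hf , Qf | false = inj₁ (trans (V≡ f) (cong₂ (λ q d → q ∧ not d) Qf Df))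

    V⇒Q : ∀ f → inS V f ≡ true → inS Q f ≡ true × D f ≡ false
    V⇒Q f p with ∧-true (trans (sym (V≡ f)) p)
    ... | Qf , nD = Qf , trans (sym (not-involutive (D f))) (cong not nD)

  rank nullity : List (Fin ne) → ℕ
  rank    L = ncompN nodes (map edge L) ∸ ncompN nodes edges
  nullity L = (length (map edge L) + ncompN nodes (map edge L)) ∸ length nodes

  -- `V` and the edges of the quotient graph together make up `Q`; its boundary curve already
  -- connects all flags, so `Q` has as many components as `G`.
  all-components : ncompN nodes edges ≡ cG
  all-components = trans (quotient-components (filterᵇ (inS S) (allFin ne)) {inS Q} (λ f → proj₁ ∘ V⇒Q f)
      (λ {f} f∈ → proj₁ (∧-true (trans (sym (S≡ f)) (proj₂ (∈-filterᵇ⁻ (inS S) {xs = allFin ne} f∈)))))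
      (λ f Qf → case f Qf (split f {λ _ → true} Qf)))
    (trans (cong (_+ iso) (K-cong (Cp? (inS Q)) (Cp? (inS Full)) (λ {x} {y} _ → total-Full x y)
      (λ {x} {y} _ → total-Cp x y))) (sym (cS≡ Full)))
    where
      case : ∀ f → inS Q f ≡ true → inS V f ≡ true ⊎ true ∧ inS Q f ∧ D f ≡ true → inS V f ≡ true ⊎ f ∈ filterᵇ (inS S) (allFin ne)
      case f Qf (inj₁ v) = inj₁ v
      case f Qf (inj₂ d) = inj₂ (∈-filterᵇ⁺ (inS S) (∈-allFin f) (trans (S≡ f) d))
      total-Cp : ∀ x y → Reach (Cp (inS Q)) x y
      total-Cp x y = Reach-mono (λ _ _ → inj₂) (total x y)
      total-Full : ∀ x y → Reach (Cp (inS Full)) x y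
      total-Full x y = Reach-mono full (total x y)
        where
          full : ∀ f b → Bd (inS Q) f b → Cp (inS Full) f b
          full f true  _ = inj₂ (sym (lookup-replicate f true))
          full f false _ = inj₁ refl

  module _ (H : Subset ne) (ag : AgreeOff D (inS H) (inS Q)) (L : List (Fin ne))
           (L≡ : filterᵇ (chosen (inS H)) (allFin ne) ≡ L) where

    private
      h = inS H

      components : ncompN nodes (map edge L) ≡ C (internal h) + iso
      components = quotient-components L {internal h}
        (λ f Vf → let (Qf , Df) = V⇒Q f Vf in cong₂ _∧_ (trans (ag f Df) Qf) Qf)
        (λ {f} f∈ → let (hf , p) = ∧-true {h f} (proj₂ (∈-filterᵇ⁻ (chosen h) {xs = allFin ne} (subst (f ∈_) (sym L≡) f∈))) in
                     cong₂ _∧_ hf (proj₁ (∧-true {inS Q f} p)))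
        (λ f p → case f (split f {h} p))
        where
          case : ∀ f → inS V f ≡ true ⊎ chosen h f ≡ true → inS V f ≡ true ⊎ f ∈ L
          case f (inj₁ v) = inj₁ v
          case f (inj₂ c) = inj₂ (subst (f ∈_) L≡ (∈-filterᵇ⁺ (chosen h) (∈-allFin f) c))

    components-exponent : rank L ≡ cS H ∸ cG
    components-exponent = cong₂ _∸_ (trans components (sym (cS-split {H} {V} ag V≡))) all-components

    genus-exponent : 2 * nullity L + sS V ≡ sS H
    genus-exponent = sym (trans (sS-split {H} {V} ag V≡)
        (cong (λ z → 2 * z + sS V) (cong₂ _∸_ (cong₂ _+_ len (sym components)) (sym length-nodes))))
      where
        len : size (chosen h) ≡ length (map edge L)
        len = trans (cong length L≡) (sym (length-map edge L))

-- Quasi-trees and their intervals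

module QuasiTrees (G : Ribbon) (conn : Connected G) {_≺_ : Rel (Fin (Ribbon.ne G)) 0ℓ} (sto : IsStrictTotalOrder _≡_ _≺_) where
  open Resolution G
  open Ordered sto
  open RibbonInv G using (isQuasiTree; bcS; cG)

  count-total : ∀ {S} {k} → Count (λ _ → ⊤) (Reach S) k → k ≤ 1 → Total S
  count-total {S} c k≤1 x y = go (Count.reps c) (subst (_≤ 1) (sym (Count.size c)) k≤1) (Count.cover c tt) (Count.cover c tt)
    where
      go : ∀ l → length l ≤ 1 → Any (Reach S x) l → Any (Reach S y) l → Reach S x y
      go (z ∷ [])    _        (here p) (here q) = p ◅◅ Reach-sym q
      go (_ ∷ _ ∷ _) (s≤s ()) _        _

  connected : C (inS Full) + iso ≡ 1
  connected = trans (sym (cS≡ Full)) conn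

  total-Full : Total (Cp (inS Full))
  total-Full = count-total (K-count (Cp? (inS Full))) (subst (C (inS Full) ≤_) connected (ℕₚ.m≤m+n _ iso))

  -- An edge supplies a component that has flags, and connectedness leaves room for no other.
  iso≡0 : Fin ne → iso ≡ 0
  iso≡0 e = vanish (Count.size c) (Count.cover c {base e} tt) connected
    where
      c = K-count (Cp? (inS Full))
      vanish : ∀ {k} {l : List (Flag ne)} → length l ≡ k → Any (Reach (Cp (inS Full)) (base e)) l → k + iso ≡ 1 → iso ≡ 0
      vanish {l = _ ∷ l} refl _ h = ℕₚ.m+n≡0⇒n≡0 (length l) (ℕₚ.suc-injective h)

  quasiTree⇒total : ∀ Q → isQuasiTree Q ≡ true → Total (Bd (inS Q))
  quasiTree⇒total Q h = count-total (K-count (Bd? (inS Q)))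
    (subst (B (inS Q) ≤_) (trans (sym (bcS≡ Q)) (true-⌊⌋ (bcS Q ≟ℕ 1) h)) (ℕₚ.m≤m+n _ iso))

  -- Two total relations have equally many classes. Comparison with the components of `G` also
  -- covers the edgeless graph, where the one boundary curve belongs to the isolated vertex.
  total⇒quasiTree : ∀ Q → Total (Bd (inS Q)) → isQuasiTree Q ≡ true
  total⇒quasiTree Q tot = ⌊⌋-true (bcS Q ≟ℕ 1) (trans (bcS≡ Q) (trans (cong (_+ iso)
    (K-cong (Bd? (inS Q)) (Cp? (inS Full)) (λ {x} {y} _ → total-Full x y) (λ {x} {y} _ → tot x y))) connected))

  module _ (Q : Subset ne) where
    open QuasiTree G Q using (orientable; module WithOrder)
    open WithOrder sto using (live)

    abstract
      D : Fin ne → Bool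
      D e = live e ∧ orientable e

      D≡ : ∀ e → D e ≡ live e ∧ orientable e
      D≡ e = refl

    Dᵥ : Subset ne
    Dᵥ = tabulate D

    inS-Dᵥ : ∀ f → inS Dᵥ f ≡ D f
    inS-Dᵥ = lookup∘tabulate D

  module _ {Q : Subset ne} (total : Total (Bd (inS Q))) where
    private
      module W = Walk G Q
      open PartialDual G Q
      total' : W.Total (W.Bd W.∅)
      total' x y = subst₂ (W.Reach (W.Bd W.∅)) (swapOn-invol Q x) (swapOn-invol Q y)
        (reach-transfer (λ { f b refl → xor-same (inS Q f) }) (total (swapOn Q x) (swapOn Q y)))

    -- The cut is found in `GQ`, where the state `Q` is empty, and carried back by the swap.
    live-cut : ∀ e → D Q e ≡ true → Cut (Ord (inS Q) e) e (inS Q e)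
    live-cut e De with ∧-true (trans (sym (D≡ Q e)) De)
    ... | lv , or = cut-transfer⁻ {S = Ord (inS Q) e} (λ { f b (inj₁ p) → inj₁ p ; f b (inj₂ refl) → inj₂ (xor-same (inS Q f)) })
                      (W.live⇒cut total' e (iso≡0 e) sto lv or)

    cut-live : ∀ e → Cut (Ord (inS Q) e) e (inS Q e) → D Q e ≡ true
    cut-live e c = trans (D≡ Q e) (cong₂ _∧_ (W.cut⇒live total' e (iso≡0 e) sto c') (W.cut⇒orientable total' e (iso≡0 e) sto c'))
      where
        c' : W.Cut (W.Lower total' e (iso≡0 e) sto) e false
        c' = subst (W.Cut _ e) (xor-same (inS Q e))
               (cut-transfer (λ { f b (inj₁ p) → inj₁ p ; f b (inj₂ refl) → inj₂ refl }) c)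

    loose-cut : ∀ e → D Q e ≡ true → Cut (Loose (inS Q) (D Q)) e (inS Q e)
    loose-cut = cut-system (inS Q) (D Q) live-cut

    agree⇒compatible : ∀ {h} → AgreeOff (D Q) h (inS Q) → Compatible h (inS Q)
    agree⇒compatible ag e neq = [ live-cut e , (λ De → ⊥-elim (neq (sym (ag e De)))) ]′ (true-or-false (D Q e))
      where
        true-or-false : ∀ c → c ≡ true ⊎ c ≡ false
        true-or-false true  = inj₁ refl
        true-or-false false = inj₂ refl

  fits-unique : ∀ H {Q Q'} → isQuasiTree Q ≡ true → isQuasiTree Q' ≡ true →
                fits (Dᵥ Q) Q H ≡ true → fits (Dᵥ Q') Q' H ≡ true → Q ≡ Q'
  fits-unique H {Q} {Q'} q q' f f' = trans (sym (tabulate∘lookup Q)) (trans (tabulate-cong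
      (compatible-unique tQ tQ' (agree⇒compatible tQ (agree f)) (agree⇒compatible tQ' (agree f')))) (tabulate∘lookup Q'))
    where
      tQ = quasiTree⇒total Q q
      tQ' = quasiTree⇒total Q' q'
      agree : ∀ {Q} → fits (Dᵥ Q) Q H ≡ true → AgreeOff (D Q) (inS H) (inS Q)
      agree {Q} f e De = fits⇒agree (Dᵥ Q) Q H f e (trans (inS-Dᵥ Q e) De)

  fits-exists : ∀ H → ∃ λ Q → isQuasiTree Q ≡ true × fits (Dᵥ Q) Q H ≡ true
  fits-exists H = build (compatible-exists (total-mono (λ _ _ _ → tt) total-Full) (inS H))
    where
    build : (∃ λ q → Total (Bd q) × Compatible (inS H) q) → ∃ λ Q → isQuasiTree Q ≡ true × fits (Dᵥ Q) Q H ≡ true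
    build (q , tot , comp) = Q , total⇒quasiTree Q tQ , agree⇒fits (Dᵥ Q) Q H agree
      where
      Q = tabulate q
      Q≡ : ∀ f → inS Q f ≡ q f
      Q≡ = lookup∘tabulate q
      tQ : Total (Bd (inS Q))
      tQ = total-mono (λ f b p → trans p (sym (Q≡ f))) tot
      agree : ∀ f → inS (Dᵥ Q) f ≡ false → inS H f ≡ inS Q f
      -- A disagreement at `f` yields a cut there by compatibility, which makes `f` live and
      -- orientable, against `Df`.
      agree f Df = decidable-stable (inS H f ≟B inS Q f) λ neq →
        not-¬ Df (trans (inS-Dᵥ Q f) (cut-live tQ f (subst (Cut (Ord (inS Q) f) f) (sym (Q≡ f))
          (Cut-mono (λ { g b _ (inj₁ p) → inj₁ p ; g b _ (inj₂ p) → inj₂ (trans p (Q≡ g)) })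
            (comp f (λ eq → neq (trans (sym eq) (sym (Q≡ f)))))))))

-- From intervals to the polynomial identity

module Expansion {c ℓ} (R : CommutativeRing c ℓ) (G : Ribbon) (conn : Connected G)
                 {_≺_ : Rel (Fin (Ribbon.ne G)) 0ℓ} (sto : IsStrictTotalOrder _≡_ _≺_)
                 (X Y a b : CommutativeRing.Carrier R) where
  open CommutativeRing R using (_≈_; *-cong; *-assoc; *-congˡ; *-congʳ; reflexive; setoid; *-commutativeSemigroup)
    renaming (Carrier to 𝕂; refl to ≈-refl; sym to ≈-sym; trans to ≈-trans; _*_ to _⊗_)
  open RingOps R
  open Sums R
  open Ribbon G using (ne)
  open QuasiTrees G conn sto
  open Resolution G using (Total; Bd; Loose; Cut; AgreeOff; Reach)
  open RibbonInv G using (isQuasiTree; cS; sS; cG)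
  private
    module d = RibbonInv (dual G)
    module C* = Cuts (dual G)

  krushkalTerm : Subset ne → 𝕂
  krushkalTerm H = pow X (cS H ∸ cG) ⊗ pow Y (d.cS (∁ H) ∸ d.cG) ⊗ pow a (sS H) ⊗ pow b (d.sS (∁ H))

  expansionTerm : Subset ne → 𝕂
  expansionTerm Q = tutte (RibbonInv.quotGraph G VI Io) X (a ⊗ a) ⊗ tutte (RibbonInv.quotGraph (dual G) VE Eo) Y (b ⊗ b)
                  ⊗ pow a (sS VI) ⊗ pow b (d.sS VE)
    where open QuasiTree.WithOrder G Q sto

  rearrange : ∀ x α y β p q → (x ⊗ α) ⊗ (y ⊗ β) ⊗ p ⊗ q ≈ x ⊗ y ⊗ (α ⊗ p) ⊗ (β ⊗ q)
  rearrange x α y β p q = begin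
    (x ⊗ α) ⊗ (y ⊗ β) ⊗ p ⊗ q         ≈⟨ *-congʳ (*-congʳ (interchange x α y β)) ⟩
    (x ⊗ y) ⊗ (α ⊗ β) ⊗ p ⊗ q         ≈⟨ *-assoc _ _ _ ⟩
    (x ⊗ y) ⊗ (α ⊗ β) ⊗ (p ⊗ q)       ≈⟨ *-assoc _ _ _ ⟩
    (x ⊗ y) ⊗ ((α ⊗ β) ⊗ (p ⊗ q))     ≈⟨ *-congˡ (interchange α β p q) ⟩
    (x ⊗ y) ⊗ ((α ⊗ p) ⊗ (β ⊗ q))     ≈⟨ ≈-sym (*-assoc _ _ _) ⟩
    x ⊗ y ⊗ (α ⊗ p) ⊗ (β ⊗ q)         ∎
    where
      open import Relation.Binary.Reasoning.Setoid setoid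
      open CSemi *-commutativeSemigroup using (interchange)

  inS-∁ : ∀ (P : Subset ne) f → inS (∁ P) f ≡ not (inS P f)
  inS-∁ P f = lookup-map f not P

  module _ (Q : Subset ne) (total : Total (Bd (inS Q))) where
    open QuasiTree.WithOrder G Q sto using (live; Io; Eo; VI; VE)
    open QuasiTree G Q using (orientable)

    private
      Df = D Q
      Dv = Dᵥ Q

      not-D : ∀ f → not (live f) ∨ not (orientable f) ≡ not (Df f)
      not-D f = trans (de-morgan (live f) (orientable f)) (cong not (sym (D≡ Q f)))
        where
          de-morgan : ∀ x y → not x ∨ not y ≡ not (x ∧ y)
          de-morgan true  y = refl
          de-morgan false y = refl

      VI≡ : ∀ f → inS VI f ≡ inS Q f ∧ not (Df f)
      VI≡ f = trans (lookup∘tabulate _ f) (cong (inS Q f ∧_) (not-D f))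

      VE≡ : ∀ f → inS VE f ≡ inS (∁ Q) f ∧ not (Df f)
      VE≡ f = trans (lookup∘tabulate _ f) (cong₂ _∧_ (sym (inS-∁ Q f)) (not-D f))

      Io≡ : ∀ f → inS Io f ≡ inS Q f ∧ Df f
      Io≡ f = trans (lookup∘tabulate _ f) (cong (inS Q f ∧_) (sym (D≡ Q f)))

      Eo≡ : ∀ f → inS Eo f ≡ inS (∁ Q) f ∧ Df f
      Eo≡ f = trans (lookup∘tabulate _ f) (cong₂ _∧_ (sym (inS-∁ Q f)) (sym (D≡ Q f)))

      open PartialDual G Full

      xor-Full : ∀ c (f : Fin ne) → c xor inS Full f ≡ not c
      xor-Full c f = trans (cong (c xor_) (lookup-replicate f true)) (xor-comm c true)

      -- Swapping on all edges carries the cuts of `Q` to cuts of its complement in the dual with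
      -- the same `D`, so the external edges play the part of internal ones there.
      dual-cut : ∀ e → Df e ≡ true → C*.Cut (C*.Loose (inS (∁ Q)) Df) e (inS (∁ Q) e)
      dual-cut e De = subst (C*.Cut (C*.Loose (inS (∁ Q)) Df) e) (trans (xor-Full (inS Q e) e) (sym (inS-∁ Q e)))
        (cut-transfer {S = Loose (inS Q) Df} weaken (loose-cut total e De))
        where
          weaken : ∀ f c → C*.Loose (inS (∁ Q)) Df f c → Loose (inS Q) Df f (c xor inS Full f)
          weaken f c (inj₁ p) = inj₁ p
          weaken f c (inj₂ p) = inj₂ (trans (xor-Full c f) (trans (cong not (trans p (inS-∁ Q f))) (not-involutive _)))

      dual-total : ∀ x y → C*.Reach (C*.Bd (inS (∁ Q))) x y
      dual-total x y = subst₂ (C*.Reach (C*.Bd (inS (∁ Q)))) (swapOn-invol Full x) (swapOn-invol Full y)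
        (reach-transfer {S = Bd (inS Q)} (λ { f c refl → trans (xor-Full c f) (sym (inS-∁ Q f)) }) (total (swapOn Full x) (swapOn Full y)))

      module I = Exponents G Q VI Io Df (loose-cut total) total VI≡ Io≡
      module E = Exponents (dual G) (∁ Q) VE Eo Df dual-cut dual-total VE≡ Eo≡

      GI = RibbonInv.quotGraph G VI Io
      GE = RibbonInv.quotGraph (dual G) VE Eo

      F F* : List (Fin ne) → 𝕂
      F  = tutteTerm GI X (a ⊗ a) ∘ map I.edge
      F* = tutteTerm GE Y (b ⊗ b) ∘ map E.edge

      pick-filter : ∀ {p : Fin ne → Bool} (P : Subset ne) → (∀ f → p f ≡ inS P f) → filterᵇ p (allFin ne) ≡ pick P
      pick-filter P h = trans (filterᵇ-cong h (allFin ne)) (filter≡pick P)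

      zip-D : ∀ (P : Subset ne) f → inS P f ∧ Df f ≡ inS (zipWith _∧_ P Dv) f
      zip-D P f = sym (trans (lookup-zipWith _∧_ f P Dv) (cong (inS P f ∧_) (inS-Dᵥ Q f)))

      chosen≡ : ∀ (P H : Subset ne) f → inS H f ∧ inS P f ∧ Df f ≡ inS (chosenᵥ Dv P H) f
      chosen≡ P H f = sym (trans (lookup-zipWith _∧_ f H _) (cong (inS H f ∧_) (sym (zip-D P f))))

      tutte-I : tutte GI X (a ⊗ a) ≈ Σ[ sublists (pick (zipWith _∧_ Q Dv)) ] F
      tutte-I = tutte-reindex GI X (a ⊗ a) I.edge (filterᵇ (inS Io) (allFin ne)) (pick (zipWith _∧_ Q Dv)) refl
        (pick-filter (zipWith _∧_ Q Dv) (λ f → trans (Io≡ f) (zip-D Q f)))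

      tutte-E : tutte GE Y (b ⊗ b) ≈ Σ[ sublists (pick (zipWith _∧_ (∁ Q) Dv)) ] F*
      tutte-E = tutte-reindex GE Y (b ⊗ b) E.edge (filterᵇ (inS Eo) (allFin ne)) (pick (zipWith _∧_ (∁ Q) Dv)) refl
        (pick-filter (zipWith _∧_ (∁ Q) Dv) (λ f → trans (Eo≡ f) (zip-D (∁ Q) f)))

      sI = sS VI
      sE = d.sS VE

      join-pow : ∀ x d s {t} → 2 * d + s ≡ t → pow (x ⊗ x) d ⊗ pow x s ≈ pow x t
      join-pow x d s refl = ≈-trans (*-congʳ (pow-square x d)) (≈-sym (pow-+ x (2 * d) s))

      -- The chosen internal edges give the exponents of `X` and `a` in `G`; the external edges
      -- missing from `H` give those of `Y` and `b` by the same argument in the dual.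
      term-factors : ∀ H → AgreeOff Df (inS H) (inS Q) →
                     F (pick (chosenᵥ Dv Q H)) ⊗ F* (pick (chosenᵥ Dv (∁ Q) (∁ H))) ⊗ pow a sI ⊗ pow b sE ≈ krushkalTerm H
      term-factors H ag = ≈-trans
        (rearrange (pow X (I.rank L)) (pow (a ⊗ a) (I.nullity L)) (pow Y (E.rank L*)) (pow (b ⊗ b) (E.nullity L*)) (pow a sI) (pow b sE))
        (*-cong (*-cong (*-cong
          (reflexive (cong (pow X) (I.components-exponent H ag L L≡)))
          (reflexive (cong (pow Y) (E.components-exponent (∁ H) ag* L* L*≡))))
          (join-pow a (I.nullity L) sI (I.genus-exponent H ag L L≡)))
          (join-pow b (E.nullity L*) sE (E.genus-exponent (∁ H) ag* L* L*≡)))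
        where
          L = pick (chosenᵥ Dv Q H)
          L* = pick (chosenᵥ Dv (∁ Q) (∁ H))
          L≡ = pick-filter (chosenᵥ Dv Q H) (chosen≡ Q H)
          L*≡ = pick-filter (chosenᵥ Dv (∁ Q) (∁ H)) (chosen≡ (∁ Q) (∁ H))
          ag* : AgreeOff Df (inS (∁ H)) (inS (∁ Q))
          ag* f p = trans (inS-∁ H f) (trans (cong not (ag f p)) (sym (inS-∁ Q f)))

    interval-sum : expansionTerm Q ≈ Σ[ allSubsets ne ] (λ H → when (fits Dv Q H) (krushkalTerm H))
    interval-sum = ≈-trans (*-congʳ (*-congʳ (*-cong tutte-I tutte-E)))
      (Σ-interval-scaled Dv Q F F* (pow a sI) (pow b sE) krushkalTerm
        (λ H ft → term-factors H (λ f p → fits⇒agree Dv Q H ft f (trans (inS-Dᵥ Q f) p))))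

  quasiTrees : List (Subset ne)
  quasiTrees = filterᵇ isQuasiTree (allSubsets ne)

  isQT : ∀ {Q} → Q ∈ quasiTrees → isQuasiTree Q ≡ true
  isQT Q∈ = proj₂ (∈-filterᵇ⁻ isQuasiTree {xs = allSubsets ne} Q∈)

  term-regroup : Σ[ allSubsets ne ] krushkalTerm ≈ Σ[ quasiTrees ] expansionTerm
  term-regroup = Σ-regroup (allSubsets ne) quasiTrees (λ Q H → fits (Dᵥ Q) Q H) krushkalTerm expansionTerm
    (Uniqueₚ.filter⁺ _ (allSubsets-unique ne))
    (λ H → let (Q , qt , ft) = fits-exists H in Q , ∈-filterᵇ⁺ isQuasiTree (∈-allSubsets Q) qt , ft)
    (λ H Q∈ Q'∈ → fits-unique H (isQT Q∈) (isQT Q'∈))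
    (λ {Q} Q∈ → interval-sum Q (quasiTree⇒total Q (isQT Q∈)))

  krushkal-expansion : Polys.krushkal R G X Y a b ≈ Polys.expansion R G sto X Y a b
  krushkal-expansion = term-regroup

theorem4p4 : ∀ {c ℓ} (R : CommutativeRing c ℓ) (G : Ribbon) (_≺_ : Rel (Fin (Ribbon.ne G)) 0ℓ)
    → (sto : IsStrictTotalOrder _≡_ _≺_) → Connected G
    → (X Y a b : CommutativeRing.Carrier R)
    → CommutativeRing._≈_ R (Polys.krushkal R G X Y a b) (Polys.expansion R G sto X Y a b)
theorem4p4 R G _≺_ sto conn X Y a b = Expansion.krushkal-expansion R G conn sto X Y a b
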